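{- Fix a finite signature $\Sigma$ and $n\in\mathbb{N}$. Then it is decidable, given an MSO sentence $\Xi$ over $\Sigma$ (possibly mentioning finitely many constants), whether $\Xi$ has a model $I$ (a countable instance over $\Sigma$) with $\mathrm{cw}(I)\le n$. Consequently, cliquewidth is an MSO-friendly width measure.
   Context: Instances: fix disjoint countably infinite sets of constants and nulls; an instance over a finite signature $\Sigma$ is a countable set of atoms over $\Sigma$ whose terms are constants or nulls; $\mathrm{adom}(I)$ is its set of terms; a unary predicate $\top$ is considered to hold of every term. Cliquewidth. Let $\mathbb{L}$ be a finite set of colors, $\mathrm{Cnst}$ a finite set of constants. Consider the infinite binary tree with nodes $\{0,1\}^*$ (root $\varepsilon$, children $s0,s1$ of $s$). A $(\mathbb{L},\mathrm{Cnst},\Sigma)$-well-decorated tree assigns to every node exactly one decorator among: $c_k$ ($c\in\mathrm{Cnst}\cup\{*\}$, $k\in\mathbb{L}$), $\mathrm{Add}_{R,\vec k}$ ($R\in\Sigma$, $\vec k\in\mathbb{L}^{\mathrm{ar}(R)}$), $\mathrm{Recolor}_{k\to k'}$ ($k,k'\in\mathbb{L}$), $\oplus$, $\mathrm{Void}$, such that: each $c\in\mathrm{Cnst}$ occurs in at most one decorator $c_k$ at at most one node; if $s$ is decorated $\mathrm{Add}$ or $\mathrm{Recolor}$ then $s0$ is not $\mathrm{Void}$ and $s1$ is $\mathrm{Void}$; if $s$ is $\oplus$ then neither child is $\mathrm{Void}$; if $s$ is $\mathrm{Void}$ or some $c_k$ then both children are $\mathrm{Void}$. The entities $\mathrm{ent}(s)$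 of node $s$ are the nodes $ss'$ decorated with some $*_k$ and the constants $c$ decorated $c_k$ at some node $ss'$. Colors $\mathrm{col}_s(e)$ for $e\in\mathrm{ent}(s)$: if $s$ is $c_k$ (resp. $*_k$ and $e=s$) then $k$; if $s$ is $\mathrm{Recolor}_{k\to k'}$ then $k'$ if $\mathrm{col}_{s0}(e)=k$ and $\mathrm{col}_{s0}(e)$ otherwise; if $s$ is $\mathrm{Add}$ then $\mathrm{col}_{s0}(e)$; if $s$ is $\oplus$ then $\mathrm{col}_{sb}(e)$ for the $b$ with $e\in\mathrm{ent}(sb)$. Atoms of node $s$: $\{\top(c)\}$ if $s$ is $c_k$ with $c\in\mathrm{Cnst}$; $\{\top(s)\}$ if $s$ is $*_k$; $\{R(\vec e)\mid \vec e$ over $\mathrm{ent}(s)$, $\mathrm{col}_s(\vec e)=\vec k\}$ if $s$ is $\mathrm{Add}_{R,\vec k}$; empty otherwise. The colored instance represented by the tree is the union of the atoms of all nodes, with coloring $\mathrm{col}_\varepsilon$. The cliquewidth $\mathrm{cw}(I,\lambda)$ of a colored instance ($\lambda:\mathrm{adom}(I)\to$ colors) with finitely many constants is the least $|\mathbb{L}|$ such that $(I,\lambda)$ is isomorphic to a colored instance represented by some $(\mathbb{L},\mathrm{Cnst},\Sigma)$-well-decorated tree ($\infty$ if none); $\mathrm{cw}(I)$ is the minimum of $\mathrm{cw}(I,\lambda)$ over all colorings $\lambda$. A width measure $\mathrm{w}$ (function from countable instances to $\mathbb{N}\cup\{\infty\}$) is MSO-friendly if there is an algorithm that, on input $n$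 and an MSO sentence $\Xi$, never terminates if $\Xi$ is unsatisfiable and always terminates if $\Xi$ has a model $I$ with $\mathrm{w}(I)\le n$. -}

module Defs where

open import Level using (Level; Lift; 0ℓ) renaming (suc to lsuc)
open import Data.Nat using (ℕ; _≤_; _≟_)
open import Data.Bool using (Bool; true; false)
open import Data.Fin using (Fin)
open import Data.List using (List; []; _++_; _∷ʳ_)
open import Data.List.Membership.Propositional using () renaming (_∈_ to _∈L_)
open import Data.Vec using (Vec; lookup; map)
open import Data.Product using (Σ; ∃; ∃₂; _×_; _,_)
open import Data.Sum using (_⊎_)
open import Data.Empty using (⊥)
open import Data.Unit using (⊤)
open import Relation.Nullary using (¬_)
open import Relation.Binary.PropositionalEquality using (_≡_)
open import Function.Definitions using (Injective)
open import Axiom.ExcludedMiddle using (ExcludedMiddle)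

record Signature : Set where
  field
    nRel  : ℕ
    arity : Fin nRel → ℕ
open Signature public

data Term : Set where
  const : ℕ → Term
  null  : ℕ → Term

-- Atoms over S, plus atoms of the unary predicate ⊤.
data Atom (S : Signature) : Set where
  rel : (R : Fin (nRel S)) → Vec Term (arity S R) → Atom S
  top : Term → Atom S

-- An instance: a (necessarily countable) set of atoms.
Instance : Signature → Set₁
Instance S = Atom S → Set

Adom : {S : Signature} → Instance S → Term → Set
Adom {S} I t =
  (Σ (Fin (nRel S)) λ R → Σ (Vec Term (arity S R)) λ ts →
     I (rel R ts) × Σ (Fin (arity S R)) λ i → lookup ts i ≡ t)
  ⊎ I (top t)

Node : Set
Node = List Bool

data Deco (S : Signature) (k : ℕ) : Set where
  cst     : ℕ → Fin k → Deco S k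
  star    : Fin k → Deco S k
  add     : (R : Fin (nRel S)) → Vec (Fin k) (arity S R) → Deco S k
  recolor : Fin k → Fin k → Deco S k
  plus    : Deco S k
  void    : Deco S k

Tree : Signature → ℕ → Set
Tree S k = Node → Deco S k

LocalOK : {S : Signature} {k : ℕ} → Deco S k → Deco S k → Deco S k → Set
LocalOK (cst c j)     l r = l ≡ void × r ≡ void
LocalOK (star j)      l r = l ≡ void × r ≡ void
LocalOK (add R ks)    l r = ¬ (l ≡ void) × r ≡ void
LocalOK (recolor a b) l r = ¬ (l ≡ void) × r ≡ void
LocalOK plus          l r = ¬ (l ≡ void) × ¬ (r ≡ void)
LocalOK void          l r = l ≡ void × r ≡ void

WellDecorated : {S : Signature} {k : ℕ} → List ℕ → Tree S k → Set
WellDecorated Cnst T =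
  (∀ s → LocalOK (T s) (T (s ∷ʳ false)) (T (s ∷ʳ true)))
  × (∀ s c j → T s ≡ cst c j → c ∈L Cnst)
  × (∀ s s' c j j' → T s ≡ cst c j → T s' ≡ cst c j' → s ≡ s')

data Ent : Set where
  node : Node → Ent
  cnst : ℕ → Ent

InEnt : {S : Signature} {k : ℕ} → Tree S k → Node → Ent → Set
InEnt T s (node u) = Σ Node λ s' → u ≡ s ++ s' × Σ _ λ j → T u ≡ star j
InEnt T s (cnst c) = Σ Node λ s' → Σ _ λ j → T (s ++ s') ≡ cst c j

-- Col T s e j  :  col_s(e) = j   (inductive rendering of the recursive definition)
data Col {S : Signature} {k : ℕ} (T : Tree S k) : Node → Ent → Fin k → Set where
  col-cst  : ∀ {s c j} → T s ≡ cst c j → Col T s (cnst c) j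
  col-star : ∀ {s j} → T s ≡ star j → Col T s (node s) j
  col-rec≡ : ∀ {s e a b} → T s ≡ recolor a b → Col T (s ∷ʳ false) e a → Col T s e b
  col-rec≢ : ∀ {s e a b j} → T s ≡ recolor a b → Col T (s ∷ʳ false) e j → ¬ (j ≡ a) →
             Col T s e j
  col-add  : ∀ {s e R ks j} → T s ≡ add R ks → Col T (s ∷ʳ false) e j → Col T s e j
  col-plus : ∀ {s e j} (b : Bool) → T s ≡ plus → InEnt T (s ∷ʳ b) e →
             Col T (s ∷ʳ b) e j → Col T s e j

RepAtom : {S : Signature} {k : ℕ} → Tree S k → (R : Fin (nRel S)) → Vec Ent (arity S R) → Set
RepAtom {S} T R es = Σ Node λ s → Σ (Vec _ (arity S R)) λ ks → T s ≡ add R ks ×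
  (∀ i → InEnt T s (lookup es i) × Col T s (lookup es i) (lookup ks i))

-- (I, λ) is isomorphic to the colored instance represented by T, where the
-- colors Fin k of the tree are named by lab. The domain of the represented
-- instance is ent(ε) (every entity carries a ⊤-atom); constants are fixed.
IsoRep : {S : Signature} {k : ℕ} → Instance S → (Term → ℕ) → (Fin k → ℕ) → Tree S k → Set
IsoRep {S} I λc lab T = Σ (Term → Ent) λ f →
    (∀ t → Adom I t → InEnt T [] (f t))
  × (∀ t u → Adom I t → Adom I u → f t ≡ f u → t ≡ u)
  × (∀ e → InEnt T [] e → Σ Term λ t → Adom I t × f t ≡ e)
  × (∀ t c → Adom I t → (t ≡ const c → f t ≡ cnst c) × (f t ≡ cnst c → t ≡ const c))
  × (∀ R ts → (∀ i → Adom I (lookup ts i)) →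
       (I (rel R ts) → RepAtom T R (map f ts)) × (RepAtom T R (map f ts) → I (rel R ts)))
  × (∀ t j → Adom I t → Col T [] (f t) j → λc t ≡ lab j)

-- cw(I, λ) ≤ n  (λ a coloring of adom(I) with colors in ℕ; values off adom irrelevant)
CwColoredLe : {S : Signature} → Instance S → (Term → ℕ) → ℕ → Set
CwColoredLe {S} I λc n = Σ ℕ λ k → k ≤ n × Σ (Fin k → ℕ) λ lab → Injective _≡_ _≡_ lab ×
  Σ (List ℕ) λ Cnst → Σ (Tree S k) λ T → WellDecorated Cnst T × IsoRep I λc lab T

-- cw(I) ≤ n  (cw(I) is the minimum over colorings λ)
CwLe : {S : Signature} → Instance S → ℕ → Set
CwLe I n = Σ (Term → ℕ) λ λc → CwColoredLe I λc n

data FOT : Set where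
  var : ℕ → FOT
  con : ℕ → FOT

data Formula (S : Signature) : Set where
  atom  : (R : Fin (nRel S)) → Vec FOT (arity S R) → Formula S
  equal : FOT → FOT → Formula S
  memb  : FOT → ℕ → Formula S
  neg   : Formula S → Formula S
  conj  : Formula S → Formula S → Formula S
  ex1   : ℕ → Formula S → Formula S
  ex2   : ℕ → Formula S → Formula S

ScopedT : List ℕ → FOT → Set
ScopedT xs (var x) = x ∈L xs
ScopedT xs (con c) = ⊤

Scoped : {S : Signature} → List ℕ → List ℕ → Formula S → Set
Scoped {S} xs Xs (atom R ts) = ∀ i → ScopedT xs (lookup ts i)
Scoped xs Xs (equal a b) = ScopedT xs a × ScopedT xs b
Scoped xs Xs (memb a X) = ScopedT xs a × X ∈L Xs
Scoped xs Xs (neg φ) = Scoped xs Xs φ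
Scoped xs Xs (conj φ ψ) = Scoped xs Xs φ × Scoped xs Xs ψ
Scoped xs Xs (ex1 x φ) = Scoped (x Data.List.∷ xs) Xs φ
Scoped xs Xs (ex2 X φ) = Scoped xs (X Data.List.∷ Xs) φ

Sentence : {S : Signature} → Formula S → Set
Sentence = Scoped [] []

update : {A : Set₁} → (ℕ → A) → ℕ → A → ℕ → A
update ν x a y with x ≟ y
... | Relation.Nullary.yes _ = a
... | Relation.Nullary.no _  = ν y

updateT : (ℕ → Term) → ℕ → Term → ℕ → Term
updateT ν x a y with x ≟ y
... | Relation.Nullary.yes _ = a
... | Relation.Nullary.no _  = ν y

evalT : (ℕ → Term) → FOT → Term
evalT ν (var x) = ν x
evalT ν (con c) = const c

Sat : {S : Signature} → Instance S → (ℕ → Term) → (ℕ → (Term → Set)) → Formula S → Set₁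
Sat I ν μ (atom R ts) = Lift (lsuc 0ℓ) (I (rel R (map (evalT ν) ts)))
Sat I ν μ (equal a b) = Lift (lsuc 0ℓ) (evalT ν a ≡ evalT ν b)
Sat I ν μ (memb a X) = Lift (lsuc 0ℓ) (μ X (evalT ν a))
Sat I ν μ (neg φ) = ¬ Sat I ν μ φ
Sat I ν μ (conj φ ψ) = Sat I ν μ φ × Sat I ν μ ψ
Sat I ν μ (ex1 x φ) = Σ Term λ t → Lift (lsuc 0ℓ) (Adom I t) × Sat I (updateT ν x t) μ φ
Sat I ν μ (ex2 X φ) = Σ (Term → Set) λ P →
  Lift (lsuc 0ℓ) (∀ t → P t → Adom I t) × Sat I ν (update μ X P) φ

-- I ⊨ Ξ (for sentences the environments are irrelevant)
Models : {S : Signature} → Instance S → Formula S → Set₁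
Models I Ξ = Sat I (λ _ → null 0) (λ _ _ → ⊥) Ξ

Satisfiable : {S : Signature} → Formula S → Set₁
Satisfiable {S} Ξ = Σ (Instance S) λ I → Models I Ξ

-- Ξ has a model I with w(I) ≤ n, for a width measure given by "w(I) ≤ n"
HasModelW : {S : Signature} → (Instance S → ℕ → Set) → ℕ → Formula S → Set₁
HasModelW {S} WLe n Ξ = Σ (Instance S) λ I → Models I Ξ × Lift (lsuc 0ℓ) (WLe I n)

-- Decidability and MSO-friendliness.
-- An algorithm is an Agda function (computed without any axiom); its
-- correctness is proved classically (assuming excluded middle).

DecidesBoundedSat : (S : Signature) → (Instance S → ℕ → Set) → ℕ → Set₂
DecidesBoundedSat S WLe n = Σ (Formula S → Bool) λ f →
  ExcludedMiddle (lsuc 0ℓ) → ∀ Ξ → Sentence Ξ →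
    (f Ξ ≡ true → HasModelW WLe n Ξ) × (HasModelW WLe n Ξ → f Ξ ≡ true)

-- Termination modelled by step-indexing: g n Ξ t ≡ true means
-- "the algorithm has terminated on input (n, Ξ) within t steps".
MSOFriendly : (S : Signature) → (Instance S → ℕ → Set) → Set₂
MSOFriendly S WLe = Σ (ℕ → Formula S → ℕ → Bool) λ g →
  ExcludedMiddle (lsuc 0ℓ) → ∀ n Ξ → Sentence Ξ →
    (¬ Satisfiable Ξ → ∀ t → g n Ξ t ≡ false)
    × (HasModelW WLe n Ξ → Σ ℕ λ t → g n Ξ t ≡ true)

{-# OPTIONS --safe #-}
module Submission where

-- A tree language is given by a universal parity automaton that reads the tree together with a
-- guessed annotation. Such languages are closed under conjunction and projection for trivial
-- reasons. For the complement, the automaton is determinised along branches and the acceptance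
-- game becomes a parity game, which is positionally determined: if the tree is rejected, a
-- positional strategy of the opponent can be guessed as an annotation, and all plays against it
-- form a universal automaton again. Emptiness is decided by the same game on the finite graph of
-- states. An MSO sentence about an instance of cliquewidth at most n is then read as a property
-- of the decorated tree: an element becomes the node that introduces it, and an atom R(e) holds
-- if some node Add_R lies above all e_i and the recolourings on the way up turn the colours of
-- the e_i into the required ones.

open import Defs
open import Level using (Lift; lift; lower; 0ℓ) renaming (suc to lsuc)
open import Axiom.ExcludedMiddle using (ExcludedMiddle)
open import Data.Bool using (Bool; true; false; not; _∧_; _∨_; if_then_else_) renaming (_≟_ to _≟ᵇ_)
open import Data.Bool.Properties using (¬-not; not-¬; not-injective; not-involutive)
open import Data.Empty using (⊥; ⊥-elim)
open import Data.Fin using (Fin; zero; suc; toℕ; fromℕ; punchIn; fromℕ<)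
import Data.Fin.Properties as Finₚ
open import Data.List using (List; []; _∷_; _++_; _∷ʳ_; length; InitLast; _∷ʳ′_; initLast)
import Data.List as List
import Data.List.Properties as Listₚ
open import Data.List.Membership.Propositional using (_∈_)
open import Data.List.Membership.Propositional.Properties
open import Data.List.Relation.Unary.Any using (here; there; index)
open import Data.List.Relation.Unary.Any.Properties using (lookup-index)
open import Data.Maybe using (Maybe; just; nothing)
open import Data.Nat
open import Data.Nat.Properties
open import Data.Product using (Σ; ∃; ∃₂; _×_; _,_; proj₁; proj₂)
open import Data.Sum using (_⊎_; inj₁; inj₂)
open import Data.Unit using (⊤; tt)
open import Data.Vec using (Vec; []; _∷_; lookup; tabulate; replicate)
import Data.Vec as Vec
import Data.Vec.Properties as Vecₚ
open import Function using (_∘_; id; case_of_)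
open import Relation.Binary.PropositionalEquality
open import Relation.Nullary using (¬_; Dec; yes; no; contradiction; does)
open import Relation.Nullary.Decidable using (map′; dec-true; dec-false; _×-dec_)

-- Finite types, and the parity condition

-- Two constraints shape the proof. The decision procedure must compute without axioms, so all
-- automata, the determinisation and the emptiness test are finite data obtained by enumeration;
-- excluded middle enters only the correctness proofs, as an argument `em`. It reaches no further
-- than `Set₁`, which dictates how winning regions are united. Determinisation is needed because an
-- annotation is a function of the node. In a game whose positions carry a single state of a
-- universal automaton, a strategy could annotate one node differently for two runs through it. A
-- deterministic state is a function of the path, so a positional strategy on pairs of node and
-- state does yield an annotation. A tree with few colours may still use arbitrarily many constants,
-- whereas the emptiness test needs a finite alphabet. Constants that are not below a bound computed
-- from the sentence therefore become anonymous entities; the sentence does not name them and cannot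
-- tell the difference.

record Finite (A : Set) : Set where
  field
    elems    : List A
    complete : ∀ a → a ∈ elems

  size : ℕ
  size = length elems

  enc : A → Fin size
  enc a = index (complete a)

  dec : Fin size → A
  dec = List.lookup elems

  dec-enc : ∀ a → dec (enc a) ≡ a
  dec-enc a = sym (lookup-index (complete a))

  enc-injective : ∀ {a b} → enc a ≡ enc b → a ≡ b
  enc-injective {a} {b} p = trans (sym (dec-enc a)) (trans (cong dec p) (dec-enc b))

open Finite

abstract
  Fin-finite : ∀ n → Finite (Fin n)
  Fin-finite n = record { elems = List.allFin n ; complete = ∈-allFin }

  ⊤-finite : Finite ⊤
  ⊤-finite = record { elems = tt ∷ [] ; complete = λ _ → here refl }

  Bool-finite : Finite Bool
  Bool-finite = record { elems = false ∷ true ∷ [] ; complete = λ { false → here refl ; true → there (here refl) } }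

  Maybe-finite : ∀ {A} → Finite A → Finite (Maybe A)
  Maybe-finite F = record
    { elems = nothing ∷ List.map just (elems F)
    ; complete = λ { nothing → here refl ; (just a) → there (∈-map⁺ just (complete F a)) } }

  ×-finite : ∀ {A B} → Finite A → Finite B → Finite (A × B)
  ×-finite F G = record
    { elems = List.cartesianProduct (elems F) (elems G)
    ; complete = λ { (a , b) → ∈-cartesianProduct⁺ (complete F a) (complete G b) } }

  ⊎-finite : ∀ {A B} → Finite A → Finite B → Finite (A ⊎ B)
  ⊎-finite F G = record
    { elems = List.map inj₁ (elems F) ++ List.map inj₂ (elems G)
    ; complete = λ { (inj₁ a) → ∈-++⁺ˡ (∈-map⁺ inj₁ (complete F a))
                   ; (inj₂ b) → ∈-++⁺ʳ (List.map inj₁ (elems F)) (∈-map⁺ inj₂ (complete G b)) } }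

  Vec-finite : ∀ {A} → Finite A → ∀ n → Finite (Vec A n)
  Vec-finite F zero = record { elems = [] ∷ [] ; complete = λ { [] → here refl } }
  Vec-finite F (suc n) = record
    { elems = List.cartesianProductWith _∷_ (elems F) (elems (Vec-finite F n))
    ; complete = λ { (a ∷ v) → ∈-cartesianProductWith⁺ _∷_ (complete F a) (complete (Vec-finite F n) v) } }

any-finite : ∀ {A} (F : Finite A) {P : A → Set} → (∀ a → Dec (P a)) → Dec (∃ P)
any-finite F {P} P? = map′ (λ { (i , p) → dec F i , p })
  (λ { (a , p) → enc F a , subst P (sym (dec-enc F a)) p })
  (Finₚ.any? (λ i → P? (dec F i)))

upper-bound : ∀ {A} → Finite A → (g : A → ℕ) → ∃ λ n → ∀ a → g a ≤ n
upper-bound F g = total (elems F) , λ a → g≤total (complete F a)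
  where
  total : List _ → ℕ
  total = List.foldr (λ a n → g a + n) 0
  g≤total : ∀ {a xs} → a ∈ xs → g a ≤ total xs
  g≤total {xs = x ∷ xs} (here refl) = m≤m+n (g x) _
  g≤total {xs = x ∷ xs} (there p) = ≤-trans (g≤total p) (m≤n+m _ (g x))

-- Functions out of a finite type are stored as vectors, which can again be enumerated and compared;
-- for the function type itself this would require extensionality.
Tab : ∀ {A} → Finite A → Set → Set
Tab F B = Vec B (size F)

Tab-finite : ∀ {A B} (F : Finite A) → Finite B → Finite (Tab F B)
Tab-finite F G = Vec-finite G (size F)

abstract
  get : ∀ {A B} (F : Finite A) → Tab F B → A → B
  get F v a = lookup v (enc F a)

  tab : ∀ {A B} (F : Finite A) → (A → B) → Tab F B
  tab F f = tabulate (f ∘ dec F)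

  get-tab : ∀ {A B} (F : Finite A) (f : A → B) a → get F (tab F f) a ≡ f a
  get-tab F f a = trans (Vecₚ.lookup∘tabulate (f ∘ dec F) (enc F a)) (cong f (dec-enc F a))

does⁻ : ∀ {P : Set} (d : Dec P) → does d ≡ true → P
does⁻ (yes p) _ = p

∧⁺ : ∀ {a b} → a ≡ true → b ≡ true → a ∧ b ≡ true
∧⁺ refl refl = refl

∧⁻ : ∀ {a b} → a ∧ b ≡ true → a ≡ true × b ≡ true
∧⁻ {true} p = refl , p

true≢false : true ≢ false
true≢false ()

not-true⁻ : ∀ {b} → not b ≡ true → b ≡ false
not-true⁻ {false} _ = refl

not-true⁺ : ∀ {b} → b ≢ true → not b ≡ true
not-true⁺ n = cong not (¬-not n)

InfOften Eventually : (ℕ → Set) → Set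
InfOften P = ∀ m → ∃ λ k → m ≤ k × P k
Eventually P = ∃ λ m → ∀ k → m ≤ k → P k

even : ℕ → Bool
even zero = true
even (suc n) = not (even n)

-- The max-parity condition: `limit` is the limit superior of `f`, and its parity names the winner,
-- `true` for even.
record Wins (i : Bool) (f : ℕ → ℕ) : Set where
  constructor winning
  field
    limit : ∃ λ p → even p ≡ i × InfOften (λ k → f k ≡ p) × Eventually (λ k → f k ≤ p)

Wins-unique : ∀ {i j f} → Wins i f → Wins j f → i ≡ j
Wins-unique {f = f} (winning (p , ep , iop , m , evp)) (winning (q , eq , ioq , n , evq)) =
  trans (sym ep) (trans (cong even (≤-antisym p≤q q≤p)) eq)
  where
  p≤q : p ≤ q
  p≤q with k , n≤k , fk ← iop n = subst (_≤ q) fk (evq k n≤k)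
  q≤p : q ≤ p
  q≤p with k , m≤k , fk ← ioq m = subst (_≤ p) fk (evp k m≤k)

Wins-cong : ∀ {i f g} → (∀ k → f k ≡ g k) → Wins i f → Wins i g
Wins-cong e (winning (p , ep , iop , m , evp)) = winning (
  p , ep , (λ n → let k , n≤k , fk = iop n in k , n≤k , trans (sym (e k)) fk)
  , m , (λ k m≤k → subst (_≤ p) (e k) (evp k m≤k)))

Wins-suc : ∀ {i f} → Wins i f → Wins (not i) (suc ∘ f)
Wins-suc (winning (p , ep , iop , m , evp)) = winning (
  suc p , cong not ep , (λ n → let k , n≤k , fk = iop n in k , n≤k , cong suc fk)
  , m , (λ k m≤k → s≤s (evp k m≤k)))

Wins-suc⁻ : ∀ {i f} → Wins (not i) (suc ∘ f) → Wins i f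
Wins-suc⁻ (winning (zero , _ , iop , _)) with iop 0
... | _ , _ , ()
Wins-suc⁻ (winning (suc p , ep , iop , m , evp)) = winning (
  p , not-injective ep , (λ n → let k , n≤k , fk = iop n in k , n≤k , suc-injective fk)
  , m , (λ k m≤k → s≤s⁻¹ (evp k m≤k)))

Wins-shift⁻ : ∀ {i f} n → Wins i (λ k → f (n + k)) → Wins i f
Wins-shift⁻ {f = f} n (winning (p , ep , iop , m , evp)) = winning (
  p , ep , (λ l → let k , l≤k , fk = iop l in n + k , ≤-trans l≤k (m≤n+m k n) , fk)
  , n + m , λ k h → subst (λ z → f z ≤ p) (m+[n∸m]≡n (≤-trans (m≤m+n n m) h))
      (evp (k ∸ n) (subst (_≤ k ∸ n) (m+n∸m≡n n m) (∸-monoˡ-≤ n h))))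

EM₁ : Set₂
EM₁ = ExcludedMiddle (lsuc 0ℓ)

module Classical (em : EM₁) where

  lem : (P : Set) → Dec P
  lem P = map′ lower lift (em {Lift (lsuc 0ℓ) P})

  stable : {P : Set} → ¬ ¬ P → P
  stable {P} nnp with lem P
  ... | yes p = p
  ... | no np = contradiction np nnp

  ¬∀⟶∃¬ : {A : Set} {P : A → Set} → ¬ (∀ a → P a) → ∃ λ a → ¬ P a
  ¬∀⟶∃¬ {A} {P} h with lem (∃ λ a → ¬ P a)
  ... | yes p = p
  ... | no np = contradiction (λ a → stable (λ npa → np (a , npa))) h

  Eventually-or-InfOften : (P : ℕ → Set) → Eventually (λ k → ¬ P k) ⊎ InfOften P
  Eventually-or-InfOften P with lem (Eventually (λ k → ¬ P k))
  ... | yes e = inj₁ e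
  ... | no ne = inj₂ λ m → stable λ h → ne (m , λ k m≤k pk → h (k , m≤k , pk))

  limsup : ∀ b (f : ℕ → ℕ) → (∀ k → f k ≤ b) → ∃ λ p → InfOften (λ k → f k ≡ p) × Eventually (λ k → f k ≤ p)
  limsup b f f≤b = go b (0 , λ k _ → f≤b k)
    where
    go : ∀ p → Eventually (λ k → f k ≤ p) → ∃ λ p → InfOften (λ k → f k ≡ p) × Eventually (λ k → f k ≤ p)
    go p (m , ev) with Eventually-or-InfOften (λ k → f k ≡ p)
    ... | inj₂ io = p , io , m , ev
    go zero (m , ev) | inj₁ (m' , ev') =
      contradiction (n≤0⇒n≡0 (ev (m + m') (m≤m+n m m'))) (ev' (m + m') (m≤n+m m' m))
    go (suc p) (m , ev) | inj₁ (m' , ev') = go p (m + m' , λ k h →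
      s≤s⁻¹ (≤∧≢⇒< (ev k (≤-trans (m≤m+n m m') h)) (ev' k (≤-trans (m≤n+m m' m) h))))

  Wins-total : ∀ b (f : ℕ → ℕ) → (∀ k → f k ≤ b) → Wins true f ⊎ Wins false f
  Wins-total b f f≤b with limsup b f f≤b
  ... | p , io , ev with even p in eq
  ...   | true = inj₁ (winning (p , eq , io , ev))
  ...   | false = inj₂ (winning (p , eq , io , ev))

  InfOften-pigeonhole : ∀ {A} → Finite A → (P : ℕ → Set) (f : ℕ → A) → InfOften P →
    ∃ λ a → InfOften (λ k → P k × f k ≡ a)
  InfOften-pigeonhole F P f io = stable λ h →
    let bound = λ a → stable-ev a (λ io' → h (a , io'))
        (n , bound≤) = upper-bound F (proj₁ ∘ bound)
        (k , mk , pk) = io n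
    in proj₂ (bound (f k)) k (≤-trans (bound≤ (f k)) mk) (pk , refl)
    where
    stable-ev : ∀ a → ¬ InfOften (λ k → P k × f k ≡ a) → Eventually (λ k → ¬ (P k × f k ≡ a))
    stable-ev a nio with Eventually-or-InfOften (λ k → P k × f k ≡ a)
    ... | inj₁ e = e
    ... | inj₂ io = contradiction io nio

-- Determinisation

even-double : ∀ n → even (n + n) ≡ true
even-double zero = refl
even-double (suc n) rewrite +-suc n n | even-double n = refl

module Factorisation {S X : Set} (ε : S) (ext : S → X → S) where

  -- The state reached on the part of w from i to j; it is ε for j < i.
  val : (ℕ → X) → ℕ → ℕ → S
  val w i zero = ε
  val w i (suc j) with i ≤? j
  ... | yes _ = ext (val w i j) (w j)
  ... | no _ = ε

  val-self : ∀ w i → val w i i ≡ ε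
  val-self w zero = refl
  val-self w (suc i) with suc i ≤? i
  ... | yes p = contradiction p 1+n≰n
  ... | no _ = refl

  val-suc : ∀ w {i j} → i ≤ j → val w i (suc j) ≡ ext (val w i j) (w j)
  val-suc w {i} {j} h with i ≤? j
  ... | yes _ = refl
  ... | no ¬h = contradiction h ¬h

  val-merge : ∀ w {p q k} j → p ≤ k → q ≤ k → k ≤ j → val w p k ≡ val w q k → val w p j ≡ val w q j
  val-merge w j pk qk kj e with m≤n⇒m<n∨m≡n kj
  ... | inj₂ refl = e
  val-merge w (suc j) pk qk kj e | inj₁ (s≤s k≤j) =
    trans (val-suc w (≤-trans pk k≤j))
      (trans (cong (λ s → ext s (w j)) (val-merge w j pk qk k≤j e)) (sym (val-suc w (≤-trans qk k≤j))))

  -- The outcome of Ramsey's theorem for words. `block` covers all pairs of cuts and not only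
  -- neighbouring ones, so that cuts may be thinned out; whether a losing run exists will depend on
  -- the pair `s`, `f` alone.
  record Ramsey (w : ℕ → X) (s f : S) : Set where
    field
      cut        : ℕ → ℕ
      increasing : ∀ n → cut n < cut (suc n)
      prefix     : ∀ n → val w 0 (cut n) ≡ s
      block      : ∀ {m n} → m < n → val w (cut m) (cut n) ≡ f

-- Determinisation by merging: a copy of the automaton (S , ε , ext) is started at every
-- position, and two copies that reach the same state stay together from then on, so that
-- one more thread than there are states suffices. Slot 0 holds the newest thread. If i is the
-- largest slot whose thread is removed infinitely often, then the threads in the slots above i
-- are eventually fixed, one of them absorbs infinitely many threads from slot i, and the
-- starting points of the absorbed threads cut the word into blocks of constant value.
module Determinize {S X : Set} (F : Finite S) (ε : S) (ext : S → X → S) (bad : S → S → Bool) where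

  open Factorisation ε ext

  N : ℕ
  N = suc (size F)

  -- The current value of each thread, and the values that the threads had when newer threads
  -- started: entry (a , b) is the value of thread a at the start of thread b, for b ≤ a.
  DState : Set
  DState = Vec S N × Vec (Vec S N) N

  DState-finite : Finite DState
  DState-finite = ×-finite (Vec-finite F N) (Vec-finite (Vec-finite F N) N)

  entry : Vec (Vec S N) N → Fin N → Fin N → S
  entry h a b = lookup (lookup h a) b

  oldest : Fin N
  oldest = fromℕ (size F)

  collision : (v : Vec S N) → ∃₂ λ i j → toℕ i < toℕ j × lookup v i ≡ lookup v j
  collision v with Finₚ.pigeonhole (n<1+n (size F)) (enc F ∘ lookup v)
  ... | i , j , i<j , e = i , j , i<j , enc-injective F e

  -- Slot numbers grow with age, so of two colliding threads the newer one is removed and the older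
  -- one absorbs it.
  removed absorbing : DState → Fin N
  removed (v , _) = proj₁ (collision v)
  absorbing (v , _) = proj₁ (proj₂ (collision v))

  Event : Set
  Event = Fin N × Fin N × S × S

  Event-finite : Finite Event
  Event-finite = ×-finite (Fin-finite N) (×-finite (Fin-finite N) (×-finite F F))

  -- The oldest thread started at position 0, so the third component is the value of the prefix
  -- before the start of the removed thread. The fourth is the value of the part between the starts
  -- of the two colliding threads.
  event : DState → Event
  event d@(_ , h) = removed d , absorbing d , entry h oldest (removed d) , entry h (absorbing d) (removed d)

  bit : Bool → ℕ
  bit true = 1
  bit false = 0

  -- Slot `r` owns the priorities 2r and 2r + 1. The slot dominates, so the limit superior finds the
  -- largest slot that is emptied infinitely often; the verdict `bad` only decides the parity.
  event-priority : Event → ℕ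
  event-priority (r , _ , s , f) = bit (bad s f) + (toℕ r + toℕ r)

  priority : DState → ℕ
  priority d = event-priority (event d)

  values : DState → X → Vec S N
  -- `punchIn` skips the removed slot: newer threads move up by one slot, older ones stay where they
  -- are.
  values d@(v , _) x = ε ∷ tabulate (λ l → ext (lookup v (punchIn (removed d) l)) x)

  shifted : DState → Fin N → Fin (size F) → S
  -- Filler: this is an entry for a thread that started after the one of its row.
  shifted d zero b = ε
  shifted d@(_ , h) (suc a) b = entry h (punchIn (removed d) a) (punchIn (removed d) b)

  step : DState → X → DState
  step d x = values d x , tabulate (λ a → lookup (values d x) a ∷ tabulate (shifted d a))

  start : DState
  start = replicate N ε , replicate N (replicate N ε)

  run : (ℕ → X) → ℕ → DState
  run w zero = start
  run w (suc k) = step (run w k) (w k)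

  bit≤1 : ∀ b → bit b ≤ 1
  bit≤1 true = ≤-refl
  bit≤1 false = z≤n

  priority-bound : ∀ d → priority d ≤ 1 + (N + N)
  priority-bound d = +-mono-≤ (bit≤1 (bad _ _))
    (+-mono-≤ (<⇒≤ (Finₚ.toℕ<n (removed d))) (<⇒≤ (Finₚ.toℕ<n (removed d))))

  priority-slot : ∀ b c {m n} → bit b + (m + m) ≤ bit c + (n + n) → m ≤ n
  priority-slot b c {m} {n} h = ≮⇒≥ λ n<m → <-irrefl refl (begin-strict
    bit c + (n + n)  ≤⟨ +-monoˡ-≤ (n + n) (bit≤1 c) ⟩
    suc n + n        <⟨ +-monoʳ-< (suc n) n<m ⟩
    suc n + m        ≤⟨ +-monoˡ-≤ m n<m ⟩
    m + m            ≤⟨ m≤n+m (m + m) (bit b) ⟩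
    bit b + (m + m)  ≤⟨ h ⟩
    bit c + (n + n)  ∎)
    where open ≤-Reasoning

  even-priority : ∀ b n → even (bit b + (n + n)) ≡ not b
  even-priority true n rewrite even-double n = refl
  even-priority false n = even-double n

  toℕ-punchIn-< : ∀ {n} (i : Fin (suc n)) (j : Fin n) → toℕ j < toℕ i → toℕ (punchIn i j) ≡ toℕ j
  toℕ-punchIn-< (suc i) zero _ = refl
  toℕ-punchIn-< (suc i) (suc j) (s≤s h) = cong suc (toℕ-punchIn-< i j h)

  punchIn-≥ : ∀ {n} (i : Fin (suc n)) (j : Fin n) → toℕ i ≤ toℕ j → punchIn i j ≡ suc j
  punchIn-≥ zero j _ = refl
  punchIn-≥ (suc i) (suc j) (s≤s h) = cong suc (punchIn-≥ i j h)

  punchIn-mono-< : ∀ {n} (i : Fin (suc n)) (j k : Fin n) → toℕ j < toℕ k → toℕ (punchIn i j) < toℕ (punchIn i k)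
  punchIn-mono-< i j k h = ≤∧≢⇒< (Finₚ.punchIn-mono-≤ i j k (<⇒≤ h))
    (λ e → <⇒≢ h (cong toℕ (Finₚ.punchIn-injective i j k (Finₚ.toℕ-injective e))))

  module Correct (w : ℕ → X) where

    removedAt : ℕ → Fin N
    removedAt k = removed (run w k)

    -- Identifiers of the threads. The initial threads all start at position 0 and get the
    -- identifiers 0 , … , size F; the thread that starts at k > 0 gets the identifier size F + k.
    ident : ℕ → Fin N → ℕ
    ident zero l = size F ∸ toℕ l
    ident (suc k) zero = size F + suc k
    ident (suc k) (suc l) = ident k (punchIn (removedAt k) l)

    pos : ℕ → Fin N → ℕ
    pos k l = ident k l ∸ size F

    ident-newest : ∀ k → ident k zero ≡ size F + k
    ident-newest zero = sym (+-identityʳ _)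
    ident-newest (suc k) = refl

    ident-≤ : ∀ k l → ident k l ≤ size F + k
    ident-≤ zero l = ≤-trans (m∸n≤m (size F) (toℕ l)) (m≤m+n _ 0)
    ident-≤ (suc k) zero = ≤-refl
    ident-≤ (suc k) (suc l) = ≤-trans (ident-≤ k _) (+-monoʳ-≤ (size F) (n≤1+n k))

    -- Strictness is the point of identifiers: start positions would not separate the initial
    -- threads, which all start at 0.
    ident-decreasing : ∀ k a b → toℕ a < toℕ b → ident k b < ident k a
    ident-decreasing zero a b h = ∸-monoʳ-< h (Finₚ.toℕ≤pred[n] b)
    ident-decreasing (suc k) zero (suc b) h =
      ≤-trans (s≤s (ident-≤ k _)) (≤-reflexive (sym (+-suc (size F) k)))
    ident-decreasing (suc k) (suc a) (suc b) (s≤s h) = ident-decreasing k _ _ (punchIn-mono-< (removedAt k) a b h)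

    ident-antitone : ∀ k a b → toℕ a ≤ toℕ b → ident k b ≤ ident k a
    ident-antitone k a b h with m≤n⇒m<n∨m≡n h
    ... | inj₁ h' = <⇒≤ (ident-decreasing k a b h')
    ... | inj₂ e rewrite Finₚ.toℕ-injective e = ≤-refl

    ident-fixed : ∀ k l → toℕ (removedAt k) < toℕ l → ident (suc k) l ≡ ident k l
    ident-fixed k (suc l) (s≤s h) = cong (ident k) (punchIn-≥ (removedAt k) l h)

    removed<N : ∀ k → toℕ (removedAt k) < size F
    removed<N k = let i , j , i<j , _ = collision (proj₁ (run w k)) in <-≤-trans i<j (Finₚ.toℕ≤pred[n] j)

    ident-oldest : ∀ k → ident k oldest ≡ 0
    ident-oldest zero = trans (cong (size F ∸_) (Finₚ.toℕ-fromℕ (size F))) (n∸n≡0 (size F))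
    ident-oldest (suc k) = trans
      (ident-fixed k oldest (subst (toℕ (removedAt k) <_) (sym (Finₚ.toℕ-fromℕ (size F))) (removed<N k)))
      (ident-oldest k)

    -- Such a slot either keeps its thread or receives a newer one.
    ident-grows : ∀ k l → toℕ (removedAt k) ≤ toℕ l → ident k l ≤ ident (suc k) l
    ident-grows k zero _ = ≤-trans (ident-≤ k zero) (+-monoʳ-≤ (size F) (n≤1+n k))
    ident-grows k (suc l) h = ident-antitone k _ (suc l) (go (removedAt k) l)
      where
      go : ∀ {n} (i : Fin (suc n)) (j : Fin n) → toℕ (punchIn i j) ≤ suc (toℕ j)
      go zero j = ≤-refl
      go (suc i) zero = z≤n
      go (suc i) (suc j) = s≤s (go i j)

    ident-jumps : ∀ k l → removedAt k ≡ l → ident k l < ident (suc k) l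
    ident-jumps k zero _ = ≤-trans (s≤s (ident-≤ k zero)) (≤-reflexive (sym (+-suc (size F) k)))
    ident-jumps k (suc l) e = ident-decreasing k (punchIn (removedAt k) l) (suc l)
      (subst (λ r → toℕ (punchIn r l) < suc (toℕ l)) (sym e)
        (≤-reflexive (cong suc (toℕ-punchIn-< (suc l) l ≤-refl))))

    pos≤ : ∀ k l → pos k l ≤ k
    pos≤ k l = ≤-trans (∸-monoˡ-≤ (size F) (ident-≤ k l)) (≤-reflexive (m+n∸m≡n (size F) k))

    pos-newest : ∀ k → pos k zero ≡ k
    pos-newest k = trans (cong (_∸ size F) (ident-newest k)) (m+n∸m≡n (size F) k)

    value-correct : ∀ k l → lookup (proj₁ (run w k)) l ≡ val w (pos k l) k
    value-correct zero l = trans (Vecₚ.lookup-replicate l ε)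
      (trans (sym (val-self w 0)) (cong (λ p → val w p 0) (sym (n≤0⇒n≡0 (pos≤ 0 l)))))
    value-correct (suc k) zero = trans (sym (val-self w (suc k))) (cong (λ p → val w p (suc k)) (sym (pos-newest (suc k))))
    value-correct (suc k) (suc l) = trans (Vecₚ.lookup∘tabulate _ l)
      (trans (cong (λ s → ext s (w k)) (value-correct k _)) (sym (val-suc w (pos≤ k _))))

    entry-step : ∀ k a b → entry (proj₂ (run w (suc k))) a b
      ≡ lookup (lookup (run w (suc k) .proj₁) a ∷ tabulate (shifted (run w k) a)) b
    entry-step k a b = cong (λ v → lookup v b)
      (Vecₚ.lookup∘tabulate (λ a → lookup (values (run w k) (w k)) a ∷ tabulate (shifted (run w k) a)) a)

    entry-correct : ∀ k a b → toℕ b ≤ toℕ a → entry (proj₂ (run w k)) a b ≡ val w (pos k a) (pos k b)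
    entry-correct zero a b _ = trans (cong (λ v → lookup v b) (Vecₚ.lookup-replicate a (replicate N ε)))
      (trans (Vecₚ.lookup-replicate b ε) (cong (val w (pos 0 a)) (sym (n≤0⇒n≡0 (pos≤ 0 b)))))
    entry-correct (suc k) a zero _ = trans (entry-step k a zero)
      (trans (value-correct (suc k) a) (cong (val w (pos (suc k) a)) (sym (pos-newest (suc k)))))
    entry-correct (suc k) (suc a) (suc b) (s≤s h) = trans (entry-step k (suc a) (suc b))
      (trans (Vecₚ.lookup∘tabulate (shifted (run w k) (suc a)) b)
        (entry-correct k _ _ (Finₚ.punchIn-mono-≤ (removedAt k) b a h)))

    module _ (em : EM₁) where
      open Classical em

      module FromEvent (r j : Fin N) (s f : S) (T : ℕ)
        (often : InfOften (λ k → event (run w k) ≡ (r , j , s , f)))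
        (late : ∀ k → T ≤ k → toℕ (removedAt k) ≤ toℕ r) where

        ident-mono : ∀ {k} k' → T ≤ k → k ≤ k' → ident k r ≤ ident k' r
        ident-mono {k} k' h h' with m≤n⇒m<n∨m≡n h'
        ... | inj₂ refl = ≤-refl
        ident-mono (suc k') h h' | inj₁ (s≤s h'') =
          ≤-trans (ident-mono k' h h'') (ident-grows k' r (late k' (≤-trans h h'')))

        ident-unbounded : ∀ x → ∃ λ k → T ≤ k × x ≤ ident k r
        ident-unbounded zero = T , ≤-refl , z≤n
        ident-unbounded (suc x) with ident-unbounded x
        ... | k , Tk , xk with often k
        ... | k' , kk' , e = suc k' , ≤-trans Tk (≤-trans kk' (n≤1+n k'))
          , ≤-<-trans (≤-trans xk (ident-mono k' Tk kk')) (ident-jumps k' r (cong proj₁ e))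

        r<j : toℕ r < toℕ j
        r<j with often 0
        ... | k , _ , e = let i , j' , i<j , _ = collision (proj₁ (run w k)) in
          subst₂ (λ a b → toℕ a < toℕ b) (cong proj₁ e) (cong (proj₁ ∘ proj₂) e) i<j

        absorber-fixed : ∀ k → T ≤ k → ident k j ≡ ident T j
        absorber-fixed k h with m≤n⇒m<n∨m≡n h
        ... | inj₂ refl = refl
        absorber-fixed (suc k) h | inj₁ (s≤s h') =
          trans (ident-fixed k j (≤-<-trans (late k h') r<j)) (absorber-fixed k h')

        pick : ∀ y → ∃ λ k → y ≤ k × T ≤ k × event (run w k) ≡ (r , j , s , f) × y ≤ pos k r
        pick y with ident-unbounded (size F + y)
        ... | k , Tk , xk with often (k + y)
        ... | k' , h , e = k' , ≤-trans (m≤n+m y k) h , Tk' , e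
          , subst (_≤ pos k' r) (m+n∸m≡n (size F) y) (∸-monoˡ-≤ (size F) (≤-trans xk (ident-mono k' Tk (≤-trans (m≤m+n k y) h))))
          where Tk' = ≤-trans Tk (≤-trans (m≤m+n k y) h)

        time : ℕ → ℕ
        time zero = proj₁ (pick 0)
        -- The next thread must start after the previous removal, so that the collision behind one
        -- cut is over before the next cut.
        time (suc n) = proj₁ (pick (suc (time n)))

        T≤time : ∀ n → T ≤ time n
        T≤time zero = proj₁ (proj₂ (proj₂ (pick 0)))
        T≤time (suc n) = proj₁ (proj₂ (proj₂ (pick (suc (time n)))))

        event-time : ∀ n → event (run w (time n)) ≡ (r , j , s , f)
        event-time zero = proj₁ (proj₂ (proj₂ (proj₂ (pick 0))))
        event-time (suc n) = proj₁ (proj₂ (proj₂ (proj₂ (pick (suc (time n))))))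

        cut : ℕ → ℕ
        cut n = pos (time n) r

        cut≤time : ∀ n → cut n ≤ time n
        cut≤time n = pos≤ (time n) r

        time<cut : ∀ n → time n < cut (suc n)
        time<cut n = proj₂ (proj₂ (proj₂ (proj₂ (pick (suc (time n))))))

        time<cut′ : ∀ {m n} → m < n → time m < cut n
        time<cut′ {m} {suc n} (s≤s m≤n) with m≤n⇒m<n∨m≡n m≤n
        ... | inj₂ refl = time<cut n
        ... | inj₁ m<n = <-trans (time<cut′ m<n) (≤-<-trans (cut≤time n) (time<cut n))

        entry-at : ∀ n a b → toℕ b ≤ toℕ a → entry (proj₂ (run w (time n))) a b ≡ val w (pos (time n) a) (pos (time n) b)
        entry-at n = entry-correct (time n)

        prefix : ∀ n → val w 0 (cut n) ≡ s
        prefix n = trans (cong (λ p → val w p (cut n)) (sym pos-oldest))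
          (trans (sym (entry-at n oldest r (subst (toℕ r ≤_) (sym (Finₚ.toℕ-fromℕ (size F))) (Finₚ.toℕ≤pred[n] r))))
            (trans (cong (entry h oldest) (sym (cong proj₁ e))) (cong (proj₁ ∘ proj₂ ∘ proj₂) e)))
          where
          h = proj₂ (run w (time n))
          e = event-time n
          pos-oldest : pos (time n) oldest ≡ 0
          pos-oldest = trans (cong (_∸ size F) (ident-oldest (time n))) (0∸n≡0 (size F))

        -- The thread started at `cut m` has merged with the thread in slot `j` by `time m`, which
        -- lies before `cut n`. Hence at `cut n` both have the same value. Slot `j` still holds the
        -- same thread at `time n`, and the event of that time records its value at `cut n` as `f`.
        block : ∀ {m n} → m < n → val w (cut m) (cut n) ≡ f
        block {m} {n} m<n = trans
          (val-merge w (cut n) (pos≤ (time m) r) (pos≤ (time m) j) (<⇒≤ (time<cut′ m<n)) merged)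
          (trans (cong (λ p → val w (p ∸ size F) (cut n)) (trans (absorber-fixed _ (T≤time m)) (sym (absorber-fixed _ (T≤time n)))))
            (trans (sym (entry-at n j r (<⇒≤ r<j)))
              (trans (cong₂ (entry h) (sym (cong (proj₁ ∘ proj₂) e)) (sym (cong proj₁ e))) (cong (proj₂ ∘ proj₂ ∘ proj₂) e))))
          where
          h = proj₂ (run w (time n))
          e = event-time n
          merged : val w (pos (time m) r) (time m) ≡ val w (pos (time m) j) (time m)
          merged = let v = proj₁ (run w (time m)); _ , _ , _ , c = collision v in
            trans (sym (value-correct (time m) r))
              (trans (subst₂ (λ a b → lookup v a ≡ lookup v b) (cong proj₁ (event-time m)) (cong (proj₁ ∘ proj₂) (event-time m)) c)
                (value-correct (time m) j))

        ramsey : Ramsey w s f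
        ramsey = record { cut = cut ; increasing = λ n → ≤-<-trans (cut≤time n) (time<cut n)
                        ; prefix = prefix ; block = block }

      -- There are finitely many events, so one event of the limit priority recurs. Its pair `s`,
      -- `f` is the one of the factorisation, and the parity of its priority is the verdict on this
      -- very pair.
      determinize-correct : ∃₂ λ s f → Ramsey w s f × Wins (not (bad s f)) (priority ∘ run w)
      determinize-correct with limsup (1 + (N + N)) (priority ∘ run w) (priority-bound ∘ run w)
      ... | p , io , T , ev with InfOften-pigeonhole Event-finite (λ k → priority (run w k) ≡ p) (event ∘ run w) io
      ... | e@(r , j , s , f) , io′ = s , f
        , FromEvent.ramsey r j s f T (λ m → let k , mk , _ , q = io′ m in k , mk , q)
            (λ k h → let _ , _ , s′ , f′ = event (run w k) in priority-slot (bad s′ f′) (bad s f) (subst (priority (run w k) ≤_) (sym p-event) (ev k h)))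
        , winning (p , trans (cong even (sym p-event)) (even-priority (bad s f) (toℕ r)) , io , T , ev)
        where
        p-event : event-priority e ≡ p
        p-event = let k , _ , pk , q = io′ 0 in trans (cong event-priority (sym q)) pk

-- Runs of parity automata on words

≟-finite : ∀ {A} → Finite A → (a b : A) → Dec (a ≡ b)
≟-finite F a b = map′ (enc-injective F) (cong (enc F)) (enc F a Finₚ.≟ enc F b)

module Concatenation {A : Set} (cut : ℕ → ℕ) (cut-zero : cut 0 ≡ 0) (increasing : ∀ n → cut n < cut (suc n))
  (segment : ℕ → ℕ → A) (glue : ∀ n → segment n (cut (suc n)) ≡ segment (suc n) (cut (suc n))) where

  cut-mono : ∀ {m n} → m ≤ n → cut m ≤ cut n
  cut-mono {m} {n} h with m≤n⇒m<n∨m≡n h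
  ... | inj₂ refl = ≤-refl
  cut-mono {n = suc n} h | inj₁ (s≤s h′) = ≤-trans (cut-mono h′) (<⇒≤ (increasing n))

  n≤cut : ∀ n → n ≤ cut n
  n≤cut zero = z≤n
  n≤cut (suc n) = ≤-<-trans (n≤cut n) (increasing n)

  Within : ℕ → ℕ → Set
  Within t n = cut n ≤ t × t < cut (suc n)

  locate : ∀ t → ∃ (Within t)
  locate zero = 0 , ≤-reflexive cut-zero , ≤-<-trans z≤n (increasing 0)
  locate (suc t) with locate t
  ... | n , lo , hi with suc t <? cut (suc n)
  ... | yes h = n , ≤-trans lo (n≤1+n t) , h
  ... | no h = suc n , ≮⇒≥ h , ≤-<-trans hi (increasing (suc n))

  Within-≤ : ∀ {t m n} → Within t m → Within t n → m ≤ n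
  Within-≤ (lo , _) (_ , hi) = ≮⇒≥ λ n<m → <-irrefl refl (<-≤-trans hi (≤-trans (cut-mono n<m) lo))

  abstract
    joined : ℕ → A
    joined t = segment (proj₁ (locate t)) t

    joined-within : ∀ {t n} → Within t n → joined t ≡ segment n t
    joined-within {t} h = cong (λ n → segment n t)
      (≤-antisym (Within-≤ (proj₂ (locate t)) h) (Within-≤ h (proj₂ (locate t))))

    joined-segment : ∀ {t n} → cut n ≤ t → t ≤ cut (suc n) → joined t ≡ segment n t
    joined-segment {t} {n} lo hi with m≤n⇒m<n∨m≡n hi
    ... | inj₁ hi′ = joined-within (lo , hi′)
    ... | inj₂ refl = trans (joined-within (≤-refl , increasing (suc n))) (sym (glue n))

module ParityRuns {Q : Set} (F : Finite Q) (init : Q → Bool) (prio : Q → ℕ) (c : ℕ) (prio≤ : ∀ q → prio q ≤ c) where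

  Letter : Set
  Letter = Q → Q → Bool

  IsRun : (ℕ → Letter) → (ℕ → Q) → Set
  IsRun w ρ = init (ρ 0) ≡ true × (∀ t → w t (ρ t) (ρ (suc t)) ≡ true)

  Key : Set
  Key = Q × Fin (suc c) × Q

  Key-finite : Finite Key
  Key-finite = ×-finite F (×-finite (Fin-finite (suc c)) F)

  -- The triples (q , m , q′) such that some path from q to q′ has maximal priority m, where the
  -- first state of a path is not counted and the empty path has priority 0.
  Paths : Set
  Paths = Tab Key-finite Bool

  Paths-finite : Finite Paths
  Paths-finite = Tab-finite Key-finite Bool-finite

  _∋_ : Paths → Key → Set
  x ∋ k = get Key-finite x k ≡ true

  ε-dec : (k : Key) → Dec (proj₁ k ≡ proj₂ (proj₂ k) × toℕ (proj₁ (proj₂ k)) ≡ 0)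
  ε-dec (q , m , q′) = ≟-finite F q q′ ×-dec (toℕ m ≟ 0)

  Extends : Paths → Letter → Key → Q × Fin (suc c) → Set
  Extends x R (q , m , q″) (q′ , m′) = x ∋ (q , m′ , q′) × R q′ q″ ≡ true × toℕ m ≡ toℕ m′ ⊔ prio q″

  Extends? : ∀ x R k → Dec (∃ (Extends x R k))
  Extends? x R (q , m , q″) = any-finite (×-finite F (Fin-finite (suc c))) λ (q′ , m′) →
    (get Key-finite x _ ≟ᵇ true) ×-dec ((R q′ q″ ≟ᵇ true) ×-dec (toℕ m ≟ toℕ m′ ⊔ prio q″))

  -- A losing run in finite form: reach `q` over the prefix, then return to `q` over every block
  -- with an odd maximum.
  Lasso : Paths → Paths → Q × Q × Fin (suc c) × Fin (suc c) → Set
  Lasso s f (q₀ , q , m₀ , m) = init q₀ ≡ true × s ∋ (q₀ , m₀ , q) × even (toℕ m) ≡ false × f ∋ (q , m , q)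

  Lasso? : ∀ s f → Dec (∃ (Lasso s f))
  Lasso? s f = any-finite (×-finite F (×-finite F (×-finite (Fin-finite (suc c)) (Fin-finite (suc c)))))
    λ (q₀ , q , m₀ , m) → (init q₀ ≟ᵇ true) ×-dec ((get Key-finite s _ ≟ᵇ true)
      ×-dec ((even (toℕ m) ≟ᵇ false) ×-dec (get Key-finite f _ ≟ᵇ true)))

  abstract
    ε : Paths
    ε = tab Key-finite (does ∘ ε-dec)

    ext : Paths → Letter → Paths
    ext x R = tab Key-finite (does ∘ Extends? x R)

    bad : Paths → Paths → Bool
    bad s f = does (Lasso? s f)

    ε⁺ : ∀ q → ε ∋ (q , zero , q)
    ε⁺ q = trans (get-tab Key-finite (does ∘ ε-dec) _) (dec-true (ε-dec _) (refl , refl))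

    ε⁻ : ∀ {q m q′} → ε ∋ (q , m , q′) → q ≡ q′ × toℕ m ≡ 0
    ε⁻ h = does⁻ (ε-dec _) (trans (sym (get-tab Key-finite (does ∘ ε-dec) _)) h)

    ext⁺ : ∀ x R k → ∃ (Extends x R k) → ext x R ∋ k
    ext⁺ x R k e = trans (get-tab Key-finite (does ∘ Extends? x R) k) (dec-true (Extends? x R k) e)

    ext⁻ : ∀ x R k → ext x R ∋ k → ∃ (Extends x R k)
    ext⁻ x R k h = does⁻ (Extends? x R k) (trans (sym (get-tab Key-finite (does ∘ Extends? x R) k)) h)

    bad⁺ : ∀ s f → ∃ (Lasso s f) → bad s f ≡ true
    bad⁺ s f = dec-true (Lasso? s f)

    bad⁻ : ∀ s f → bad s f ≡ true → ∃ (Lasso s f)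
    bad⁻ s f = does⁻ (Lasso? s f)

  open Factorisation ε ext public

  RunOn : (ℕ → Letter) → ℕ → ℕ → (ℕ → Q) → Set
  RunOn w i j ρ = ∀ t → i ≤ t → t < j → w t (ρ t) (ρ (suc t)) ≡ true

  -- The start is not counted, so that maxima of adjacent stretches combine; the alternative `m ≡ 0`
  -- accounts for empty stretches.
  MaxOn : (ℕ → Q) → ℕ → ℕ → ℕ → Set
  MaxOn ρ i j m = (∀ t → i < t → t ≤ j → prio (ρ t) ≤ m)
    × (m ≡ 0 ⊎ ∃ λ t → i < t × t ≤ j × prio (ρ t) ≡ m)

  MaxOn-empty : ∀ ρ i → MaxOn ρ i i 0
  MaxOn-empty ρ i = (λ t h h′ → contradiction (<-≤-trans h h′) (<-irrefl refl)) , inj₁ refl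

  MaxOn-suc : ∀ {ρ i j m} → i ≤ j → MaxOn ρ i j m → MaxOn ρ i (suc j) (m ⊔ prio (ρ (suc j)))
  MaxOn-suc {ρ} {i} {j} {m} i≤j (ub , att) = ub′ , att′
    where
    ub′ : ∀ t → i < t → t ≤ suc j → prio (ρ t) ≤ m ⊔ prio (ρ (suc j))
    ub′ t h h′ with m≤n⇒m<n∨m≡n h′
    ... | inj₂ refl = m≤n⊔m m _
    ... | inj₁ (s≤s h″) = ≤-trans (ub t h h″) (m≤m⊔n m _)
    att′ : m ⊔ prio (ρ (suc j)) ≡ 0 ⊎ ∃ λ t → i < t × t ≤ suc j × prio (ρ t) ≡ m ⊔ prio (ρ (suc j))
    att′ with ≤-total m (prio (ρ (suc j)))
    ... | inj₁ h = inj₂ (suc j , s≤s i≤j , ≤-refl , sym (m≤n⇒m⊔n≡n h))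
    ... | inj₂ h = case att of λ
      { (inj₁ e) → inj₁ (trans (m≥n⇒m⊔n≡m h) e)
      ; (inj₂ (t , a , b , e)) → inj₂ (t , a , ≤-trans b (n≤1+n j) , trans e (sym (m≥n⇒m⊔n≡m h))) }

  MaxOn-cong : ∀ {ρ ρ′ i j m} → (∀ t → i ≤ t → t ≤ j → ρ t ≡ ρ′ t) → MaxOn ρ i j m → MaxOn ρ′ i j m
  MaxOn-cong {m = m} e (ub , att) = (λ t h h′ → subst (λ q → prio q ≤ m) (e t (<⇒≤ h) h′) (ub t h h′)) ,
    (case att of λ { (inj₁ z) → inj₁ z
                   ; (inj₂ (t , h , h′ , q)) → inj₂ (t , h , h′ , trans (cong prio (sym (e t (<⇒≤ h) h′))) q) })

  MaxOn-≤ : ∀ {ρ i j m p} → MaxOn ρ i j m → (∀ t → i < t → prio (ρ t) ≤ p) → m ≤ p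
  MaxOn-≤ (_ , inj₁ refl) _ = z≤n
  MaxOn-≤ (_ , inj₂ (t , lo , _ , refl)) ub = ub t lo

  abstract
    val-complete : ∀ w ρ {i} j → i ≤ j → RunOn w i j ρ →
      ∃ λ m → val w i j ∋ (ρ i , m , ρ j) × MaxOn ρ i j (toℕ m)
    val-complete w ρ {i} j i≤j run with m≤n⇒m<n∨m≡n i≤j
    ... | inj₂ refl = zero , subst (_∋ (ρ i , zero , ρ i)) (sym (val-self w i)) (ε⁺ (ρ i)) , MaxOn-empty ρ i
    val-complete w ρ {i} (suc j) _ run | inj₁ (s≤s i≤j)
      with val-complete w ρ j i≤j (λ t h h′ → run t h (≤-trans h′ (n≤1+n j)))
    ... | m , v , mx = m″
      , subst (_∋ (ρ i , m″ , ρ (suc j))) (sym (val-suc w i≤j))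
          (ext⁺ (val w i j) (w j) _ ((ρ j , m) , v , run j i≤j ≤-refl , Finₚ.toℕ-fromℕ< _))
      , subst (MaxOn ρ i (suc j)) (sym (Finₚ.toℕ-fromℕ< _)) (MaxOn-suc i≤j mx)
      where
      m″ : Fin (suc c)
      m″ = fromℕ< (s≤s (⊔-lub (Finₚ.toℕ≤pred[n] m) (prio≤ (ρ (suc j)))))

  override : (ℕ → Q) → ℕ → Q → ℕ → Q
  override ρ j q t with t ≟ j
  ... | yes _ = q
  ... | no _ = ρ t

  override-at : ∀ ρ j q → override ρ j q j ≡ q
  override-at ρ j q with j ≟ j
  ... | yes _ = refl
  ... | no h = contradiction refl h

  override-below : ∀ ρ j q {t} → t < j → override ρ j q t ≡ ρ t
  override-below ρ j q {t} h with t ≟ j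
  ... | yes refl = contradiction h (<-irrefl refl)
  ... | no _ = refl

  Segment : (ℕ → Letter) → ℕ → ℕ → Q → ℕ → Q → Set
  Segment w i j q m q′ = ∃ λ ρ → ρ i ≡ q × ρ j ≡ q′ × RunOn w i j ρ × MaxOn ρ i j m

  abstract
    val-sound : ∀ w {i} j {q m q′} → i ≤ j → val w i j ∋ (q , m , q′) → Segment w i j q (toℕ m) q′
    val-sound w {i} j {q} {m} {q′} i≤j h with m≤n⇒m<n∨m≡n i≤j
    ... | inj₂ refl with ε⁻ {q} {m} {q′} (subst (_∋ (q , m , q′)) (val-self w i) h)
    ...   | e , z = (λ _ → q) , refl , e
      , (λ t a b → contradiction (≤-<-trans a b) (<-irrefl refl))
      , subst (MaxOn (λ _ → q) i i) (sym z) (MaxOn-empty (λ _ → q) i)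
    val-sound w {i} (suc j) {q} {m} {q″} _ h | inj₁ (s≤s i≤j)
      with ext⁻ (val w i j) (w j) _ (subst (_∋ (q , m , q″)) (val-suc w i≤j) h)
    ... | (q′ , m′) , v , r , e with val-sound w j i≤j v
    ...   | ρ , ei , ej , run , mx = ρ′
      , trans (below i≤j) ei , override-at ρ (suc j) q″ , run′
      , subst (MaxOn ρ′ i (suc j)) (trans (cong (λ a → toℕ m′ ⊔ prio a) (override-at ρ (suc j) q″)) (sym e))
          (MaxOn-suc i≤j (MaxOn-cong (λ t _ t≤j → sym (below t≤j)) mx))
      where
      ρ′ : ℕ → Q
      ρ′ = override ρ (suc j) q″
      below : ∀ {t} → t ≤ j → ρ′ t ≡ ρ t
      below t≤j = override-below ρ (suc j) q″ (s≤s t≤j)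
      run′ : RunOn w i (suc j) ρ′
      run′ t a (s≤s b) with m≤n⇒m<n∨m≡n b
      ... | inj₁ b′ = trans (cong₂ (w t) (below b) (below b′)) (run t a b′)
      ... | inj₂ refl = trans (cong₂ (w t) (trans (below b) ej) (override-at ρ (suc j) q″)) r

  module _ {w : ℕ → Letter} {s f : Paths} (ramsey : Ramsey w s f) where
    open Ramsey ramsey

    lasso⇒run : bad s f ≡ true → ∃ λ ρ → IsRun w ρ × Wins false (prio ∘ ρ)
    lasso⇒run h with bad⁻ s f h
    ... | (q₀ , q , m₀ , m) , i , p , odd , l = joined
      , (subst (λ a → init a ≡ true) (sym start) i , step)
      , winning (toℕ m , odd , often , suc (cut′ 1) , bounded)
      where
      -- `cut 0` is dropped: it may be 0, and the first segment has to be nonempty.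
      cut′ : ℕ → ℕ
      cut′ zero = 0
      cut′ (suc n) = cut (suc n)

      increasing′ : ∀ n → cut′ n < cut′ (suc n)
      increasing′ zero = ≤-<-trans z≤n (increasing 0)
      increasing′ (suc n) = increasing (suc n)

      first : Segment w 0 (cut 1) q₀ (toℕ m₀) q
      first = val-sound w (cut 1) z≤n (subst (_∋ (q₀ , m₀ , q)) (sym (prefix 1)) p)

      later : ∀ n → Segment w (cut (suc n)) (cut (suc (suc n))) q (toℕ m) q
      later n = val-sound w _ (<⇒≤ (increasing (suc n))) (subst (_∋ (q , m , q)) (sym (block (n<1+n (suc n)))) l)

      segment : ℕ → ℕ → Q
      segment zero = proj₁ first
      segment (suc n) = proj₁ (later n)

      ends : ∀ n → segment n (cut′ (suc n)) ≡ q
      ends zero = proj₁ (proj₂ (proj₂ first))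
      ends (suc n) = proj₁ (proj₂ (proj₂ (later n)))

      runs : ∀ n → RunOn w (cut′ n) (cut′ (suc n)) (segment n)
      runs zero = proj₁ (proj₂ (proj₂ (proj₂ first)))
      runs (suc n) = proj₁ (proj₂ (proj₂ (proj₂ (later n))))

      open Concatenation cut′ refl increasing′ segment (λ n → trans (ends n) (sym (proj₁ (proj₂ (later n)))))

      start : joined 0 ≡ q₀
      start = trans (joined-segment {n = 0} z≤n z≤n) (proj₁ (proj₂ first))

      step : ∀ t → w t (joined t) (joined (suc t)) ≡ true
      step t = let n , lo , hi = locate t in
        trans (cong₂ (w t) (joined-segment lo (<⇒≤ hi)) (joined-segment (≤-trans lo (n≤1+n t)) hi)) (runs n t lo hi)

      maxima : ∀ n → MaxOn joined (cut′ (suc n)) (cut′ (suc (suc n))) (toℕ m)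
      maxima n = MaxOn-cong (λ t lo hi → sym (joined-segment lo hi)) (proj₂ (proj₂ (proj₂ (proj₂ (later n)))))

      often : InfOften (λ t → prio (joined t) ≡ toℕ m)
      often k with proj₂ (maxima k)
      ... | inj₁ z = contradiction (trans (sym (cong even z)) odd) true≢false
      ... | inj₂ (t , lo , hi , e) = t , ≤-trans (≤-trans (n≤1+n k) (n≤cut (suc k))) (<⇒≤ lo) , e

      bounded : ∀ t → suc (cut′ 1) ≤ t → prio (joined t) ≤ toℕ m
      bounded (suc t) (s≤s h) = go (locate t)
        where
        go : ∃ (Within t) → prio (joined (suc t)) ≤ toℕ m
        go (zero , lo , hi) = contradiction (<-≤-trans hi h) (<-irrefl refl)
        go (suc n , lo , hi) = proj₁ (maxima n) (suc t) (s≤s lo) hi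

    cut-increasing : ∀ n → n ≤ cut n
    cut-increasing zero = z≤n
    cut-increasing (suc n) = ≤-<-trans (cut-increasing n) (increasing n)

    -- Some state recurs at infinitely many cuts. Take one such cut so late that priorities stay at
    -- most `p`, and a second one after a further occurrence of `p`. The maximum between them is
    -- exactly `p`, and since `block` holds for distant cuts this stretch is a loop over `f`.
    run⇒lasso : EM₁ → (∃ λ ρ → IsRun w ρ × Wins false (prio ∘ ρ)) → bad s f ≡ true
    run⇒lasso em (ρ , (i , step) , winning (p , odd , often , T , bounded)) =
      bad⁺ s f ((ρ 0 , q , m₀ , m) , i
        , subst₂ (λ x a → x ∋ (ρ 0 , m₀ , a)) (prefix n₁) e₁ pre
        , trans (cong even m≡p) odd
        , subst₂ (λ a b → f ∋ (a , m , b)) e₁ e₂ (subst (_∋ (ρ (cut n₁) , m , ρ (cut n₂))) (block n₁<n₂) blk))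
      where
      open Classical em
      recurrent = InfOften-pigeonhole F (λ _ → ⊤) (ρ ∘ cut) (λ n → n , ≤-refl , tt)
      q = proj₁ recurrent
      first = proj₂ recurrent T
      n₁ = proj₁ first
      T≤n₁ = proj₁ (proj₂ first)
      e₁ = proj₂ (proj₂ (proj₂ first))
      occurrence = often (suc (cut n₁))
      t = proj₁ occurrence
      second = proj₂ recurrent (suc n₁ + t)
      n₂ = proj₁ second
      e₂ = proj₂ (proj₂ (proj₂ second))
      n₁<n₂ : n₁ < n₂
      n₁<n₂ = ≤-trans (m≤m+n (suc n₁) t) (proj₁ (proj₂ second))
      t≤cut : t ≤ cut n₂
      t≤cut = ≤-trans (≤-trans (m≤n+m t (suc n₁)) (proj₁ (proj₂ second))) (cut-increasing n₂)
      cut< : cut n₁ < cut n₂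
      cut< = <-≤-trans (proj₁ (proj₂ occurrence)) t≤cut
      prefix-path = val-complete w ρ (cut n₁) z≤n (λ t _ _ → step t)
      m₀ = proj₁ prefix-path
      pre = proj₁ (proj₂ prefix-path)
      block-path = val-complete w ρ (cut n₂) (<⇒≤ cut<) (λ t _ _ → step t)
      m = proj₁ block-path
      blk = proj₁ (proj₂ block-path)
      p≤m : p ≤ toℕ m
      p≤m = subst (_≤ toℕ m) (proj₂ (proj₂ occurrence))
        (proj₁ (proj₂ (proj₂ block-path)) t (proj₁ (proj₂ occurrence)) t≤cut)
      m≤p : toℕ m ≤ p
      m≤p = MaxOn-≤ (proj₂ (proj₂ block-path))
        (λ u lo → bounded u (≤-trans T≤n₁ (≤-trans (cut-increasing n₁) (<⇒≤ lo))))
      m≡p : toℕ m ≡ p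
      m≡p = ≤-antisym m≤p p≤m

-- Positional determinacy of parity games

unary : ℕ → List Bool → List Bool
unary zero s = false ∷ s
unary (suc n) s = true ∷ unary n s

unary-injective : ∀ {m n s t} → unary m s ≡ unary n t → m ≡ n × s ≡ t
unary-injective {zero} {zero} refl = refl , refl
unary-injective {suc m} {suc n} e with unary-injective {m} {n} (Listₚ.∷-injectiveʳ e)
... | refl , q = refl , q

-- Base two with the digits 1 and 2, least digit first.
number : List Bool → ℕ
number [] = 0
number (false ∷ s) = suc (number s + number s)
number (true ∷ s) = suc (suc (number s + number s))

double-injective : ∀ {m n} → m + m ≡ n + n → m ≡ n
double-injective {m} {n} e = trans (n≡⌊n+n/2⌋ m) (trans (cong ⌊_/2⌋ e) (sym (n≡⌊n+n/2⌋ n)))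

double≢suc-double : ∀ m n → m + m ≢ suc (n + n)
double≢suc-double m n e =
  true≢false (trans (sym (even-double m)) (trans (cong even e) (cong not (even-double n))))

number-injective : ∀ {s t} → number s ≡ number t → s ≡ t
number-injective {[]} {[]} _ = refl
number-injective {[]} {false ∷ t} ()
number-injective {[]} {true ∷ t} ()
number-injective {false ∷ s} {[]} ()
number-injective {true ∷ s} {[]} ()
number-injective {false ∷ s} {false ∷ t} e = cong (false ∷_) (number-injective (double-injective (suc-injective e)))
number-injective {true ∷ s} {true ∷ t} e =
  cong (true ∷_) (number-injective (double-injective (suc-injective (suc-injective e))))
number-injective {false ∷ s} {true ∷ t} e = contradiction (suc-injective e) (double≢suc-double (number s) (number t))
number-injective {true ∷ s} {false ∷ t} e = contradiction (sym (suc-injective e)) (double≢suc-double (number t) (number s))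

≢-not⁻ : ∀ {a b} → a ≢ not b → a ≡ b
≢-not⁻ {b = b} h = trans (¬-not h) (not-involutive b)

least : EM₁ → (P : ℕ → Set) → ∃ P → ∃ λ k → P k × (∀ j → P j → k ≤ j)
least em P (n , p) = go P n p
  where
  go : (P : ℕ → Set) → ∀ n → P n → ∃ λ k → P k × (∀ j → P j → k ≤ j)
  go P zero p = zero , p , λ _ _ → z≤n
  go P (suc n) p with Classical.lem em (P 0)
  ... | yes p₀ = zero , p₀ , λ _ _ → z≤n
  ... | no ¬p₀ with go (P ∘ suc) n p
  ...   | k , pk , mk = suc k , pk , λ { zero p₀ → contradiction p₀ ¬p₀ ; (suc j) pj → s≤s (mk j pj) }

-- Positional determinacy by Zielonka's argument. On an arena whose largest priority n belongs to
-- player i, let W be the union of all regions on which the opponent wins positionally. In the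
-- complement Z of W, remove the i-attractor of the positions of priority n; by induction the rest
-- is determined, and the opponent wins nowhere on it since W is maximal. Hence i wins on Z by
-- attracting to priority n whenever possible. Finite branching makes the attractor ranks natural
-- numbers, and the injection into ℕ allows to merge the strategies of the opponent.
module ParityGame (em : EM₁) {V : Set} (own : V → Bool) (E : V → V → Set) (pr : V → ℕ)
  (code : V → ℕ) (code-injective : ∀ {u v} → code u ≡ code v → u ≡ v)
  (branching : ∀ v (f : V → ℕ) → ∃ λ n → ∀ w → E v w → f w ≤ n) where

  open Classical em

  IsArena : (V → Set) → Set
  IsArena X = ∀ v → X v → ∃ λ w → E v w × X w

  record Conforms (i : Bool) (σ : V → V) (ρ : ℕ → V) : Set where
    constructor conforms
    field
      edge   : ∀ k → E (ρ k) (ρ (suc k))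
      follow : ∀ k → own (ρ k) ≡ i → ρ (suc k) ≡ σ (ρ k)

  open Conforms

  -- `move` and `trap` keep every play within `X` that conforms to `σ` inside `Y`, so `wins` need
  -- only speak of plays that stay in `Y`.
  record Region (X : V → Set) (i : Bool) (Y : V → Set) (σ : V → V) : Set where
    field
      sub  : ∀ {v} → Y v → X v
      move : ∀ {v} → Y v → own v ≡ i → E v (σ v) × Y (σ v)
      trap : ∀ {v w} → Y v → own v ≢ i → E v w → X w → Y w
      wins : ∀ ρ → (∀ k → Y (ρ k)) → Conforms i σ ρ → Wins i (pr ∘ ρ)

  open Region

  Conforms-shift : ∀ {i σ ρ} n → Conforms i σ ρ → Conforms i σ (λ k → ρ (n + k))
  Conforms-shift {i} {σ} {ρ} n (conforms edges conf) =
    conforms (λ k → subst (λ m → E (ρ (n + k)) (ρ m)) (sym (+-suc n k)) (edges (n + k)))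
    (λ k o → trans (cong ρ (+-suc n k)) (conf (n + k) o))

  Conforms-cong : ∀ {i σ τ ρ} → (∀ k → own (ρ k) ≡ i → σ (ρ k) ≡ τ (ρ k)) → Conforms i σ ρ → Conforms i τ ρ
  Conforms-cong e (conforms edges conf) = conforms edges λ k o → trans (conf k o) (e k o)

  Solution : (V → Set) → Bool → Set₁
  Solution X i = ∃₂ (Region X i)

  Determined : (V → Set) → Set₁
  Determined X = Σ (∀ i → Solution X i) λ R → ∀ v → X v → proj₁ (R true) v ⊎ proj₁ (R false) v

  determined : ∀ {X} i → (a : Solution X i) (b : Solution X (not i)) →
    (∀ v → X v → proj₁ a v ⊎ proj₁ b v) → Determined X
  determined true a b cover = (λ { true → a ; false → b }) , cover
  determined false a b cover = (λ { true → b ; false → a }) , λ v x → case cover v x of λ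
    { (inj₁ y) → inj₂ y ; (inj₂ y) → inj₁ y }

  module Maximal (X : V → Set) (j : Bool) where

    -- The union of all regions quantifies over subsets of `V` and would be too large to be a `Set`.
    -- Excluded middle for `Set₁` instead picks, for each code, one region that contains the
    -- position with this code; the union is then indexed by numbers.
    Candidate : ℕ → Set₁
    Candidate k = Σ (V → Set) λ Y → Σ (V → V) λ σ → Region X j Y σ × ∃ λ v → Y v × code v ≡ k

    pick : ∀ {k} → Dec (Candidate k) → Solution X j
    pick (yes (Y , σ , R , _)) = Y , σ , R
    pick (no _) = (λ _ → ⊥) , id , record
      { sub = λ () ; move = λ () ; trap = λ () ; wins = λ ρ y _ → contradiction (y 0) λ () }

    family : ∀ k → Solution X j
    family k = pick {k} em

    set : ℕ → V → Set
    set k = proj₁ (family k)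

    strategy : ℕ → V → V
    strategy k = proj₁ (proj₂ (family k))

    region : ∀ k → Region X j (set k) (strategy k)
    region k = proj₂ (proj₂ (family k))

    W : V → Set
    W v = ∃ λ k → set k v

    maximal : ∀ {Y σ v} → Region X j Y σ → Y v → W v
    maximal {Y} {σ} {v} R y = code v , go em
      where
      go : (d : Dec (Candidate (code v))) → proj₁ (pick d) v
      go (yes (Y′ , _ , _ , v′ , y′ , e)) = subst Y′ (code-injective e) y′
      go (no n) = contradiction (Y , σ , R , v , y , refl) n

    index-of : ∀ {v} → Dec (W v) → ℕ
    index-of {v} (yes p) = proj₁ (least em (λ k → set k v) p)
    index-of (no _) = 0

    idx : V → ℕ
    idx v = index-of (lem (W v))

    idx-spec : ∀ {v} → W v → set (idx v) v × (∀ k → set k v → idx v ≤ k)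
    idx-spec {v} p = go (lem (W v))
      where
      go : (d : Dec (W v)) → set (index-of d) v × (∀ k → set k v → index-of d ≤ k)
      go (yes q) = proj₂ (least em (λ k → set k v) q)
      go (no n) = contradiction p n

    σ* : V → V
    σ* v = strategy (idx v) v

    -- At each position the strategy of the least index is played. Along a play this index never
    -- increases, so from some point on a single strategy is followed, and the parity condition
    -- ignores what came before.
    maximal-region : Region X j W σ*
    maximal-region = record
      { sub = λ (k , y) → sub (region k) y
      ; move = λ {v} y o → let e , y′ = move (region (idx v)) (proj₁ (idx-spec y)) o in e , idx v , y′
      ; trap = λ {v} y o e x → idx v , trap (region (idx v)) (proj₁ (idx-spec y)) o e x
      ; wins = wins* }
      where
      wins* : ∀ ρ → (∀ k → W (ρ k)) → Conforms j σ* ρ → Wins j (pr ∘ ρ)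
      wins* ρ y conf = Wins-shift⁻ n (wins (region c) (λ k → ρ (n + k)) in-c
        (Conforms-cong (λ k _ → cong (λ a → strategy a (ρ (n + k))) (constant k)) (Conforms-shift n conf)))
        where
        next-in : ∀ k → set (idx (ρ k)) (ρ (suc k))
        next-in k with own (ρ k) ≟ᵇ j
        ... | yes o = subst (set (idx (ρ k))) (sym (follow conf k o)) (proj₂ (move (region (idx (ρ k))) (proj₁ (idx-spec (y k))) o))
        ... | no ¬o = trap (region (idx (ρ k))) (proj₁ (idx-spec (y k))) ¬o (edge conf k)
          (sub (region (proj₁ (y (suc k)))) (proj₂ (y (suc k))))
        descends : ∀ k → idx (ρ (suc k)) ≤ idx (ρ k)
        descends k = proj₂ (idx-spec (y (suc k))) _ (next-in k)
        smallest = least em (λ a → ∃ λ k → idx (ρ k) ≡ a) (idx (ρ 0) , 0 , refl)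
        c = proj₁ smallest
        n = proj₁ (proj₁ (proj₂ smallest))
        below : ∀ k → idx (ρ (n + k)) ≤ c
        below zero = ≤-reflexive (trans (cong (idx ∘ ρ) (+-identityʳ n)) (proj₂ (proj₁ (proj₂ smallest))))
        below (suc k) = ≤-trans (≤-trans (≤-reflexive (cong (idx ∘ ρ) (+-suc n k))) (descends (n + k))) (below k)
        constant : ∀ k → idx (ρ (n + k)) ≡ c
        constant k = ≤-antisym (below k) (proj₂ (proj₂ smallest) _ (n + k , refl))
        in-c : ∀ k → set c (ρ (n + k))
        in-c k = subst (λ a → set a (ρ (n + k))) (constant k) (proj₁ (idx-spec (y (n + k))))

  override-dec : {Y : V → Set} → (V → V) → (V → V) → (∀ v → Dec (Y v)) → V → V
  override-dec σ τ Y? v with Y? v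
  ... | yes _ = σ v
  ... | no _ = τ v

  -- A play either enters `Y`, where it stays and is won by `σ`, or it remains in `Z` outside `Y`
  -- and is won by `τ`.
  module Extend {X j Y σ} (R : Region X j Y σ) (Z : V → Set) (τ : V → V)
    (Z⊆X : ∀ {v} → Z v → X v)
    (moveZ : ∀ {v} → Z v → own v ≡ j → E v (τ v) × (Z (τ v) ⊎ Y (τ v)))
    (trapZ : ∀ {v w} → Z v → own v ≢ j → E v w → X w → Z w ⊎ Y w)
    (winsZ : ∀ ρ → (∀ k → Z (ρ k) × ¬ Y (ρ k)) → Conforms j τ ρ → Wins j (pr ∘ ρ)) where

    combined : V → V
    combined = override-dec σ τ (λ v → lem (Y v))

    combined-Y : ∀ {v} → Y v → combined v ≡ σ v
    combined-Y {v} y with lem (Y v)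
    ... | yes _ = refl
    ... | no n = contradiction y n

    combined-¬Y : ∀ {v} → ¬ Y v → combined v ≡ τ v
    combined-¬Y {v} n with lem (Y v)
    ... | yes y = contradiction y n
    ... | no _ = refl

    extended : Region X j (λ v → Z v ⊎ Y v) combined
    extended = record { sub = λ { (inj₁ z) → Z⊆X z ; (inj₂ y) → sub R y }
                      ; move = moveC ; trap = trapC ; wins = winsC }
      where
      moveC : ∀ {v} → Z v ⊎ Y v → own v ≡ j → E v (combined v) × (Z (combined v) ⊎ Y (combined v))
      moveC {v} h o with lem (Y v)
      ... | yes y = let e , y′ = move R y o in e , inj₂ y′
      moveC (inj₁ z) o | no n = moveZ z o
      moveC (inj₂ y) o | no n = contradiction y n
      trapC : ∀ {v w} → Z v ⊎ Y v → own v ≢ j → E v w → X w → Z w ⊎ Y w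
      trapC (inj₁ z) o e x = trapZ z o e x
      trapC (inj₂ y) o e x = inj₂ (trap R y o e x)
      winsC : ∀ ρ → (∀ k → Z (ρ k) ⊎ Y (ρ k)) → Conforms j combined ρ → Wins j (pr ∘ ρ)
      winsC ρ h conf with lem (∃ λ k → Y (ρ k))
      ... | no n = winsZ ρ (λ k → in-Z k (h k) , λ y → n (k , y))
            (Conforms-cong (λ k _ → combined-¬Y (λ y → n (k , y))) conf)
        where
        in-Z : ∀ k → Z (ρ k) ⊎ Y (ρ k) → Z (ρ k)
        in-Z k (inj₁ z) = z
        in-Z k (inj₂ y) = contradiction (k , y) n
      ... | yes (n , yn) = Wins-shift⁻ n (wins R (λ k → ρ (n + k)) stays
            (Conforms-cong (λ k _ → combined-Y (stays k)) (Conforms-shift n conf)))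
        where
        in-X : ∀ k → Z (ρ k) ⊎ Y (ρ k) → X (ρ k)
        in-X k (inj₁ z) = Z⊆X z
        in-X k (inj₂ y) = sub R y
        stays : ∀ k → Y (ρ (n + k))
        stays zero = subst (Y ∘ ρ) (sym (+-identityʳ n)) yn
        stays (suc k) with own (ρ (n + k)) ≟ᵇ j
        ... | yes o = subst Y (sym (trans (cong ρ (+-suc n k)) (trans (follow conf (n + k) o) (combined-Y (stays k)))))
                        (proj₂ (move R (stays k) o))
        ... | no ¬o = subst (Y ∘ ρ) (sym (+-suc n k))
                        (trap R (stays k) ¬o (edge conf (n + k)) (in-X (suc (n + k)) (h (suc (n + k)))))

  module Step (n : ℕ) (solve : ∀ X → IsArena X → (∀ {v} → X v → pr v < n) → Determined X)
    (X : V → Set) (arena : IsArena X) (pr< : ∀ {v} → X v → pr v < suc n) where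

    i : Bool
    i = even n

    open Maximal X (not i)

    Z : V → Set
    Z v = X v × ¬ W v

    -- A position from which the opponent forces the next position into `W` can be added to `W` as a
    -- one-point extension, so by maximality it was there already.
    W-closed : ∀ {v} (τ : V → V) → X v → (own v ≡ not i → E v (τ v) × W (τ v)) →
      (own v ≢ not i → ∀ w → E v w → X w → W w) → W v
    W-closed {v} τ x m t = maximal
        (Extend.extended maximal-region (v ≡_) τ (λ { refl → x })
          (λ { refl o → let e , y = m o in e , inj₂ y })
          (λ { refl o e x′ → inj₂ (t o _ e x′) })
          -- No play remains at `v` outside `W`: its second position lies in `W`.
          (λ ρ y conf → contradiction (leaves ρ y conf) (proj₂ (y 1))))
        (inj₁ refl)
      where
      leaves : ∀ ρ → (∀ k → v ≡ ρ k × ¬ W (ρ k)) → Conforms (not i) τ ρ → W (ρ 1)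
      leaves ρ y (conforms edges conf) with own v ≟ᵇ not i
      ... | yes o = subst W (sym (trans (conf 0 (trans (cong own (sym v≡ρ0)) o)) (cong τ (sym v≡ρ0)))) (proj₂ (m o))
        where v≡ρ0 = proj₁ (y 0)
      ... | no ¬o = t ¬o (ρ 1) (subst (λ u → E u (ρ 1)) (sym (proj₁ (y 0))) (edges 0)) (subst X (proj₁ (y 1)) x)

    Z-trap : ∀ {v w} → Z v → own v ≢ i → E v w → X w → Z w
    Z-trap {v} {w} (x , ¬y) o e x′ = x′ , λ y → ¬y (W-closed (λ _ → w) x (λ _ → e , y)
      (λ ¬o → contradiction (≢-not⁻ ¬o) o))

    Z-arena : IsArena Z
    Z-arena v z@(x , ¬y) with own v ≟ᵇ i
    ... | no ¬o = let w , e , x′ = arena v x in w , e , Z-trap z ¬o e x′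
    ... | yes o = stable λ h → ¬y (W-closed id x
      (λ o′ → contradiction o′ (not-¬ o))
      (λ _ w e x′ → stable λ ¬y′ → h (w , e , x′ , ¬y′)))

    Top : V → Set
    Top v = Z v × pr v ≡ n

    Att : ℕ → V → Set
    Att zero v = Top v
    Att (suc m) v = Att m v ⊎ (Z v × (own v ≡ i → ∃ λ w → E v w × Att m w)
                                   × (own v ≢ i → ∀ w → E v w → Z w → Att m w))

    A : V → Set
    A v = ∃ λ m → Att m v

    Att⊆Z : ∀ m {v} → Att m v → Z v
    Att⊆Z zero (z , _) = z
    Att⊆Z (suc m) (inj₁ a) = Att⊆Z m a
    Att⊆Z (suc m) (inj₂ (z , _)) = z

    Att-mono : ∀ {m m′ v} → m ≤ m′ → Att m v → Att m′ v
    Att-mono {m′ = m′} h a with m≤n⇒m<n∨m≡n h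
    ... | inj₂ refl = a
    Att-mono {m′ = suc m′} h a | inj₁ (s≤s h′) = inj₁ (Att-mono h′ a)

    rank-of : ∀ {v} → Dec (A v) → ℕ
    rank-of {v} (yes p) = proj₁ (least em (λ m → Att m v) p)
    rank-of (no _) = 0

    rank : V → ℕ
    rank v = rank-of (lem (A v))

    rank-spec : ∀ {v} → A v → Att (rank v) v × (∀ m → Att m v → rank v ≤ m)
    rank-spec {v} p with lem (A v)
    ... | yes q = proj₂ (least em (λ m → Att m v) q)
    ... | no ¬q = contradiction p ¬q

    rank-outside : ∀ {v} → ¬ A v → rank v ≡ 0
    rank-outside {v} ¬a with lem (A v)
    ... | yes a = contradiction a ¬a
    ... | no _ = refl

    A-closed-i : ∀ {v w} → Z v → own v ≡ i → E v w → A w → A v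
    A-closed-i z o e (m , a) = suc m , inj₂ (z , (λ _ → _ , e , a) , λ ¬o → contradiction o ¬o)

    -- Here finite branching enters: the ranks of all successors have a common bound, so one finite
    -- stage of the attractor contains them all.
    A-closed-j : ∀ {v} → Z v → own v ≢ i → (∀ w → E v w → Z w → A w) → A v
    A-closed-j {v} z ¬o h = let m , b = branching v rank in
      suc m , inj₂ (z , (λ o → contradiction o ¬o)
        , λ _ w e z′ → Att-mono (b w e) (proj₁ (rank-spec (h w e z′))))

    Rest : V → Set
    Rest v = Z v × ¬ A v

    Rest-arena : IsArena Rest
    Rest-arena v (z , ¬a) with own v ≟ᵇ i
    ... | yes o = let w , e , z′ = Z-arena v z in w , e , z′ , λ a → ¬a (A-closed-i z o e a)
    ... | no ¬o = stable λ h → ¬a (A-closed-j z ¬o λ w e z′ → stable λ ¬a′ → h (w , e , z′ , ¬a′))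

    rest : Determined Rest
    rest = solve Rest Rest-arena λ (z@(x , _) , ¬a) →
      ≤∧≢⇒< (s≤s⁻¹ (pr< x)) (λ e → ¬a (0 , z , e))

    -- A region of the opponent in `Rest` extends `W`: player `i` cannot escape from it into the
    -- attractor, as the position moved from would then belong to the attractor itself. Maximality
    -- puts that region into `W`, from which `Rest` is disjoint.
    Rest-W : ∀ {v} → Rest v → proj₁ (proj₁ rest i) v
    Rest-W {v} r@(z , _) = go i refl (proj₂ rest v r)
      where
      module _ (j : Bool) (eq : j ≡ not i) where
        Y = proj₁ (proj₁ rest (not i))
        τ = proj₁ (proj₂ (proj₁ rest (not i)))
        R = proj₂ (proj₂ (proj₁ rest (not i)))
        extended : Region X (not i) (λ v → Y v ⊎ W v) _
        extended = Extend.extended maximal-region Y τ (λ y → proj₁ (proj₁ (sub R y)))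
          (λ y o → let e , y′ = move R y o in e , inj₁ y′)
          (λ {v} {w} y ¬o e x → case lem (W w) of λ
            { (yes u) → inj₂ u
            ; (no ¬u) → inj₁ (trap R y ¬o e ((x , ¬u) , λ a → proj₂ (sub R y)
                (A-closed-i (proj₁ (sub R y)) (≢-not⁻ ¬o) e a))) })
          (λ ρ y conf → wins R ρ (proj₁ ∘ y) conf)
        opponent-empty : proj₁ (proj₁ rest j) v → ⊥
        opponent-empty y = proj₂ z (maximal extended (inj₁ (subst (λ b → proj₁ (proj₁ rest b) v) eq y)))
      go : ∀ b → b ≡ i → proj₁ (proj₁ rest true) v ⊎ proj₁ (proj₁ rest false) v → proj₁ (proj₁ rest i) v
      go true e (inj₁ y) = subst (λ b → proj₁ (proj₁ rest b) v) e y
      go false e (inj₂ y) = subst (λ b → proj₁ (proj₁ rest b) v) e y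
      go true e (inj₂ y) = ⊥-elim (opponent-empty false (cong not e) y)
      go false e (inj₁ y) = ⊥-elim (opponent-empty true (cong not e) y)

    Closer : V → Set
    Closer v = ∃ λ w → E v w × Z w × ∃ λ m → m < rank v × Att m w

    -- Inside the attractor the rank is lowered, at priority `n` any move within `Z` will do, and
    -- elsewhere the strategy of `rest` is used. Positions outside the attractor have the default
    -- rank 0, so they are never mistaken for the first case.
    attract : V → V
    attract v with lem (Closer v) | lem (∃ λ w → Top v × E v w × Z w)
    ... | yes (w , _) | _ = w
    ... | no _ | yes (w , _) = w
    ... | no _ | no _ = proj₁ (proj₂ (proj₁ rest i)) v

    descend : ∀ {v} → A v → ¬ Top v → own v ≡ i → Closer v
    descend {v} a ¬t o with rank v | rank-spec a
    ... | zero | t , _ = contradiction t ¬t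
    ... | suc m | inj₁ a′ , l = contradiction (l m a′) 1+n≰n
    ... | suc m | inj₂ (_ , f , _) , l = let w , e , a′ = f o in w , e , Att⊆Z m a′ , m , ≤-refl , a′

    descend-j : ∀ {v w} → A v → ¬ Top v → own v ≢ i → E v w → Z w → ∃ λ m → m < rank v × Att m w
    descend-j {v} {w} a ¬t ¬o e z with rank v | rank-spec a
    ... | zero | t , _ = contradiction t ¬t
    ... | suc m | inj₁ a′ , l = contradiction (l m a′) 1+n≰n
    ... | suc m | inj₂ (_ , _ , g) , l = m , ≤-refl , g ¬o w e z

    attract-closer : ∀ {v} → Closer v → ∃ λ m → m < rank v × Att m (attract v)
    attract-closer {v} c with lem (Closer v)
    ... | yes (w , _ , _ , h) = h
    ... | no ¬c = contradiction c ¬c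

    attract-rest : ∀ {v} → Rest v → attract v ≡ proj₁ (proj₂ (proj₁ rest i)) v
    attract-rest {v} (z , ¬a) with lem (Closer v) | lem (∃ λ w → Top v × E v w × Z w)
    ... | yes (_ , _ , _ , m , h , _) | _ = contradiction (subst (m <_) (rank-outside ¬a) h) λ ()
    ... | no _ | yes (_ , t , _) = contradiction (0 , t) ¬a
    ... | no _ | no _ = refl

    attract-move : ∀ {v} → Z v → own v ≡ i → E v (attract v) × Z (attract v)
    attract-move {v} z o with lem (Closer v) | lem (∃ λ w → Top v × E v w × Z w)
    ... | yes (w , e , z′ , _) | _ = e , z′
    ... | no _ | yes (w , _ , e , z′) = e , z′
    ... | no ¬c | no ¬t = let e , y = move R (Rest-W (z , ¬a)) o in e , proj₁ (sub R y)
      where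
      R = proj₂ (proj₂ (proj₁ rest i))
      ¬top : ¬ Top v
      ¬top t = let w , e , z′ = Z-arena v z in ¬t (w , t , e , z′)
      ¬a : ¬ A v
      ¬a a = ¬c (descend a ¬top o)

    -- If priority `n` recurs, it decides the play for `i`. If it stops occurring, the play has left
    -- the attractor for good, because inside it the ranks would fall until a position of priority
    -- `n` is reached; the rest is then won by induction.
    Z-region : Region X i Z attract
    Z-region = record { sub = proj₁ ; move = attract-move ; trap = Z-trap ; wins = winsZ }
      where
      winsZ : ∀ ρ → (∀ k → Z (ρ k)) → Conforms i attract ρ → Wins i (pr ∘ ρ)
      winsZ ρ z conf with Eventually-or-InfOften (λ k → pr (ρ k) ≡ n)
      ... | inj₂ io = winning (n , refl , io , 0 , λ k _ → s≤s⁻¹ (pr< (proj₁ (z k))))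
      ... | inj₁ (m , never) = Wins-shift⁻ m (wins (proj₂ (proj₂ (proj₁ rest i))) (λ k → ρ (m + k))
          (Rest-W ∘ in-rest) (Conforms-cong (λ k _ → attract-rest (in-rest k)) (Conforms-shift m conf)))
        where
        not-in-A : ∀ b k → m ≤ k → A (ρ k) → rank (ρ k) < b → ⊥
        not-in-A (suc b) k h a (s≤s r) =
          not-in-A b (suc k) (≤-trans h (n≤1+n k)) (proj₁ closer , proj₂ (proj₂ closer))
            (<-≤-trans (≤-<-trans (proj₂ (rank-spec (proj₁ closer , proj₂ (proj₂ closer))) _ (proj₂ (proj₂ closer)))
              (proj₁ (proj₂ closer))) r)
          where
          ¬top : ¬ Top (ρ k)
          ¬top t = never k h (proj₂ t)
          closer : ∃ λ l → l < rank (ρ k) × Att l (ρ (suc k))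
          closer with own (ρ k) ≟ᵇ i
          ... | yes o = subst (λ w → ∃ λ l → l < rank (ρ k) × Att l w) (sym (follow conf k o))
                          (attract-closer (descend a ¬top o))
          ... | no ¬o = descend-j a ¬top ¬o (edge conf k) (z (suc k))
        in-rest : ∀ k → Rest (ρ (m + k))
        in-rest k = z (m + k) , λ a → not-in-A _ (m + k) (m≤m+n m k) a ≤-refl

    step : Determined X
    step = determined i (Z , attract , Z-region) (W , σ* , maximal-region) cover
      where
      cover : ∀ v → X v → Z v ⊎ W v
      cover v x with lem (W v)
      ... | yes y = inj₂ y
      ... | no ¬y = inj₁ (x , ¬y)

  zielonka : ∀ n X → IsArena X → (∀ {v} → X v → pr v < n) → Determined X
  zielonka zero X arena pr< = determined true (empty true) (empty false) (λ v x → contradiction (pr< x) λ ())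
    where
    empty : ∀ i → Solution X i
    empty i = (λ _ → ⊥) , id , record
      { sub = λ () ; move = λ () ; trap = λ () ; wins = λ ρ y _ → contradiction (y 0) λ () }
  zielonka (suc n) X arena pr< = Step.step n (zielonka n) X arena pr<

-- Games played in rounds

Wins-unstretch : ∀ {i f} → Wins i (f ∘ ⌊_/2⌋) → Wins i f
Wins-unstretch {f = f} (winning (p , ep , io , m , ev)) = winning (p , ep
  , (λ n → let k , nk , e = io (n + n) in ⌊ k /2⌋ , subst (_≤ ⌊ k /2⌋) (sym (n≡⌊n+n/2⌋ n)) (⌊n/2⌋-mono nk) , e)
  , m , λ k h → subst (λ a → f a ≤ p) (sym (n≡⌊n+n/2⌋ k)) (ev (k + k) (≤-trans h (m≤m+n k k))))

-- In each round Eve names a move and Adam, who sees it, answers with a direction. For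
-- complementation `P` consists of pairs of node and state, and the moves are annotations; for
-- emptiness `P` consists of states alone, and Eve also chooses the letter.
module Lockstep (em : EM₁) {P M : Set} (M-finite : Finite M) (m₀ : M) (next : P → M → Bool → P)
  (pr : P → ℕ) (c : ℕ) (pr≤ : ∀ p → pr p ≤ c)
  (code : P → List Bool) (code-injective : ∀ {p q} → code p ≡ code q → p ≡ q) where

  open Classical em

  Position : Set
  Position = P × Maybe M

  own : Position → Bool
  own (_ , nothing) = true
  own (_ , just _) = false

  E : Position → Position → Set
  E (p , nothing) v = ∃ λ m → v ≡ (p , just m)
  E (p , just m) v = ∃ λ b → v ≡ (next p m b , nothing)

  tag : Maybe M → ℕ
  tag nothing = 0
  tag (just m) = suc (toℕ (enc M-finite m))

  tag-injective : ∀ {x y} → tag x ≡ tag y → x ≡ y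
  tag-injective {nothing} {nothing} _ = refl
  tag-injective {just _} {just _} e = cong just (enc-injective M-finite (Finₚ.toℕ-injective (suc-injective e)))

  position-code : Position → ℕ
  position-code (p , x) = number (unary (tag x) (code p))

  position-code-injective : ∀ {u v} → position-code u ≡ position-code v → u ≡ v
  position-code-injective {p , x} {q , y} e =
    let e₁ , e₂ = unary-injective {tag x} {tag y} (number-injective e) in cong₂ _,_ (code-injective e₂) (tag-injective e₁)

  branching : ∀ v (f : Position → ℕ) → ∃ λ n → ∀ w → E v w → f w ≤ n
  branching (p , nothing) f = let n , h = upper-bound M-finite (λ m → f (p , just m)) in
    n , λ { _ (m , refl) → h m }
  branching (p , just m) f = let n , h = upper-bound Bool-finite (λ b → f (next p m b , nothing)) in
    n , λ { _ (b , refl) → h b }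

  open ParityGame em own E (pr ∘ proj₁) position-code position-code-injective branching

  abstract
    solution : Determined (λ _ → ⊤)
    solution = zielonka (suc c) (λ _ → ⊤) arena (λ _ → s≤s (pr≤ _))
      where
      arena : IsArena (λ _ → ⊤)
      arena (p , nothing) _ = (p , just m₀) , (m₀ , refl) , tt
      arena (p , just m) _ = (next p m false , nothing) , (false , refl) , tt

  interleave : (ℕ → P) → (ℕ → M) → ℕ → Position
  interleave π μ 0 = π 0 , nothing
  interleave π μ 1 = π 0 , just (μ 0)
  interleave π μ (suc (suc k)) = interleave (π ∘ suc) (μ ∘ suc) k

  interleave-all : (R : Position → Position → Set) → ∀ π μ →
    (∀ k → R (π k , nothing) (π k , just (μ k))) → (∀ k → R (π k , just (μ k)) (π (suc k) , nothing)) →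
    ∀ k → R (interleave π μ k) (interleave π μ (suc k))
  interleave-all R π μ f g 0 = f 0
  interleave-all R π μ f g 1 = g 0
  interleave-all R π μ f g (suc (suc k)) = interleave-all R (π ∘ suc) (μ ∘ suc) (f ∘ suc) (g ∘ suc) k

  interleave-pr : ∀ π μ k → pr (proj₁ (interleave π μ k)) ≡ pr (π ⌊ k /2⌋)
  interleave-pr π μ 0 = refl
  interleave-pr π μ 1 = refl
  interleave-pr π μ (suc (suc k)) = interleave-pr (π ∘ suc) (μ ∘ suc) k

  EveWins AdamWins : P → Set
  EveWins p₀ = Σ (P → M) λ σ → ∀ π (β : ℕ → Bool) → π 0 ≡ p₀ →
    (∀ k → π (suc k) ≡ next (π k) (σ (π k)) (β k)) → Wins true (pr ∘ π)
  AdamWins p₀ = Σ (P → M → Bool) λ τ → ∀ π (μ : ℕ → M) → π 0 ≡ p₀ →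
    (∀ k → π (suc k) ≡ next (π k) (μ k) (τ (π k) (μ k))) → Wins false (pr ∘ π)

  module _ {i Y σ̂} (R : Region (λ _ → ⊤) i Y σ̂) (π : ℕ → P) (μ : ℕ → M) (start : Y (π 0 , nothing))
    (eve : ∀ k → Y (π k , nothing) → E (π k , nothing) (π k , just (μ k))
                   × (true ≡ i → (π k , just (μ k)) ≡ σ̂ (π k , nothing)))
    (adam : ∀ k → Y (π k , just (μ k)) → E (π k , just (μ k)) (π (suc k) , nothing)
                   × (false ≡ i → (π (suc k) , nothing) ≡ σ̂ (π k , just (μ k)))) where

    open Region R

    advance : ∀ {u v} → Y u → E u v → (own u ≡ i → v ≡ σ̂ u) → Y v
    advance {u} y e f with own u ≟ᵇ i
    ... | yes o = subst Y (sym (f o)) (proj₂ (move y o))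
    ... | no ¬o = trap y ¬o e tt

    at-eve : ∀ k → Y (π k , nothing)
    at-adam : ∀ k → Y (π k , just (μ k))
    at-eve zero = start
    at-eve (suc k) = let e , f = adam k (at-adam k) in advance (at-adam k) e f
    at-adam k = let e , f = eve k (at-eve k) in advance (at-eve k) e f

    region-wins : Wins i (pr ∘ π)
    region-wins = Wins-unstretch (Wins-cong (interleave-pr π μ) (wins (interleave π μ)
      (interleave-all (λ u _ → Y u) π μ at-eve at-adam)
      (conforms (interleave-all E π μ (λ k → proj₁ (eve k (at-eve k))) (λ k → proj₁ (adam k (at-adam k))))
        (interleave-all (λ u v → own u ≡ i → v ≡ σ̂ u) π μ
          (λ k → proj₂ (eve k (at-eve k))) (λ k → proj₂ (adam k (at-adam k)))))))

  lockstep-determined : ∀ p₀ → EveWins p₀ ⊎ AdamWins p₀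
  lockstep-determined p₀ with proj₂ solution (p₀ , nothing) tt
  ... | inj₁ y = inj₁ (σ , λ π β e step → region-wins R π (σ ∘ π) (subst (λ p → Y (p , nothing)) (sym e) y)
        (λ k yk → (σ (π k) , refl) , λ _ → sym (chosen yk))
        (λ k _ → (β k , cong (_, nothing) (step k)) , λ ()))
    where
    Y = proj₁ (proj₁ solution true)
    σ̂ = proj₁ (proj₂ (proj₁ solution true))
    R = proj₂ (proj₂ (proj₁ solution true))
    choice : Maybe M → M
    choice (just m) = m
    choice nothing = m₀
    σ : P → M
    σ p = choice (proj₂ (σ̂ (p , nothing)))
    chosen : ∀ {p} → Y (p , nothing) → σ̂ (p , nothing) ≡ (p , just (σ p))
    chosen {p} yp with proj₁ (Region.move R yp refl)
    ... | m , e = trans e (cong (λ x → p , just (choice (proj₂ x))) (sym e))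
  ... | inj₂ y = inj₂ (τ , λ π μ e step → region-wins R π μ (subst (λ p → Y (p , nothing)) (sym e) y)
        (λ k _ → (μ k , refl) , λ ())
        (λ k yk → (τ (π k) (μ k) , cong (_, nothing) (step k)) , λ _ → trans (cong (_, nothing) (step k)) (sym (chosen yk))))
    where
    Y = proj₁ (proj₁ solution false)
    σ̂ = proj₁ (proj₂ (proj₁ solution false))
    R = proj₂ (proj₂ (proj₁ solution false))
    Chosen : P → M → Set
    Chosen p m = ∃ λ b → σ̂ (p , just m) ≡ (next p m b , nothing)
    choice : ∀ {p m} → Dec (Chosen p m) → Bool
    choice (yes (b , _)) = b
    choice (no _) = false
    τ : P → M → Bool
    τ p m = choice (lem (Chosen p m))
    chosen : ∀ {p m} → Y (p , just m) → σ̂ (p , just m) ≡ (next p m (τ p m) , nothing)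
    chosen {p} {m} yp = go (lem (Chosen p m))
      where
      go : (d : Dec (Chosen p m)) → σ̂ (p , just m) ≡ (next p m (choice d) , nothing)
      go (yes (_ , e)) = e
      go (no n) = contradiction (proj₁ (Region.move R yp refl)) n

-- A computable factorisation of a constant word: the values of its prefixes are eventually
-- periodic, so the blocks can be taken of a length beyond the preperiod divisible by the period.
module ConstantWord {S X : Set} (F : Finite S) (ε : S) (ext : S → X → S) (x : X) where

  open Factorisation ε ext

  iter : ℕ → S
  iter zero = ε
  iter (suc n) = ext (iter n) x

  iter-cong : ∀ a b m → iter a ≡ iter b → iter (a + m) ≡ iter (b + m)
  iter-cong a b zero e = trans (cong iter (+-identityʳ a)) (trans e (cong iter (sym (+-identityʳ b))))
  iter-cong a b (suc m) e = trans (cong iter (+-suc a m))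
    (trans (cong (λ s → ext s x) (iter-cong a b m e)) (cong iter (sym (+-suc b m))))

  val-iter : ∀ i j → i ≤ j → val (λ _ → x) i j ≡ iter (j ∸ i)
  val-iter i j h with m≤n⇒m<n∨m≡n h
  ... | inj₂ refl = trans (val-self (λ _ → x) i) (cong iter (sym (n∸n≡0 i)))
  val-iter i (suc j) h | inj₁ (s≤s h′) = trans (val-suc (λ _ → x) h′)
    (trans (cong (λ s → ext s x) (val-iter i j h′)) (cong iter (sym (+-∸-assoc 1 h′))))

  abstract
    repetition : ∃₂ λ i p → iter i ≡ iter (i + suc p)
    repetition with Finₚ.pigeonhole (n<1+n (size F)) (enc F ∘ iter ∘ toℕ)
    ... | i , j , i<j , e = toℕ i , toℕ j ∸ suc (toℕ i) , trans (enc-injective F e)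
      (cong iter (sym (trans (+-suc (toℕ i) _) (m+[n∸m]≡n i<j))))

  preperiod period block-length : ℕ
  preperiod = proj₁ repetition
  period = suc (proj₁ (proj₂ repetition))
  block-length = suc preperiod * period

  iter-period : ∀ n → preperiod ≤ n → iter (n + period) ≡ iter n
  iter-period n h = trans (cong iter e₁) (trans (iter-cong (preperiod + period) preperiod (n ∸ preperiod) (sym (proj₂ (proj₂ repetition))))
      (cong iter (m+[n∸m]≡n h)))
    where
    e₁ : n + period ≡ (preperiod + period) + (n ∸ preperiod)
    e₁ = trans (cong (_+ period) (sym (m+[n∸m]≡n h)))
      (trans (+-assoc preperiod _ period) (trans (cong (preperiod +_) (+-comm _ period)) (sym (+-assoc preperiod period _))))

  iter-periods : ∀ l → iter (block-length + l * period) ≡ iter block-length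
  iter-periods zero = cong iter (+-identityʳ block-length)
  iter-periods (suc l) = trans (cong iter e) (trans (iter-period _ (≤-trans preperiod≤ (m≤m+n block-length _))) (iter-periods l))
    where
    e : block-length + (period + l * period) ≡ (block-length + l * period) + period
    e = trans (cong (block-length +_) (+-comm period (l * period))) (sym (+-assoc block-length _ period))
    preperiod≤ : preperiod ≤ block-length
    preperiod≤ = ≤-trans (n≤1+n preperiod) (m≤m*n (suc preperiod) period)

  abstract
    loop : S
    loop = iter block-length

    iter-multiple : ∀ n → iter (block-length * suc n) ≡ loop
    iter-multiple n = trans (cong iter e) (iter-periods (n * suc preperiod))
      where
      e : block-length * suc n ≡ block-length + (n * suc preperiod) * period
      e = trans (*-suc block-length n) (cong (block-length +_) (trans (*-comm block-length n) (sym (*-assoc n (suc preperiod) period))))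

    constant-ramsey : Ramsey (λ _ → x) loop loop
    constant-ramsey = record
      -- The cuts begin after one full block, so the prefix has the value `loop` as well.
      { cut = λ n → block-length * suc n
      ; increasing = λ n → *-monoʳ-< block-length (n<1+n (suc n))
      ; prefix = λ n → trans (val-iter 0 (block-length * suc n) z≤n) (iter-multiple n)
      ; block = λ {m} {n} m<n → trans (val-iter _ _ (*-monoʳ-≤ block-length (s≤s (<⇒≤ m<n))))
          (trans (cong iter (trans (sym (*-distribˡ-∸ block-length (suc n) (suc m))) (cong (block-length *_) (positive m<n))))
            (iter-multiple (n ∸ suc m))) }
      where
      positive : ∀ {m n} → m < n → n ∸ m ≡ suc (n ∸ suc m)
      positive {m} {suc n} (s≤s h) = +-∸-assoc 1 h

-- The paths of a graph are the runs on the constant word whose letter is the edge relation. The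
-- factorisation of this word is computable, and so is the question whether some path is losing.
module FiniteGraph {D : Set} (D-finite : Finite D) (initial : D → Bool) (prio : D → ℕ) (c : ℕ) (prio≤ : ∀ d → prio d ≤ c)
  (graph : D → D → Bool) where

  open ParityRuns D-finite initial prio c prio≤
  open ConstantWord Paths-finite ε ext graph

  Path : (ℕ → D) → Set
  Path ρ = initial (ρ 0) ≡ true × (∀ k → graph (ρ k) (ρ (suc k)) ≡ true)

  abstract
    losing : Bool
    losing = bad loop loop

    wins-if-not-losing : EM₁ → losing ≡ false → ∀ ρ → Path ρ → Wins true (prio ∘ ρ)
    wins-if-not-losing em e ρ path = total (Classical.Wins-total em c (prio ∘ ρ) (prio≤ ∘ ρ))
      where
      total : Wins true (prio ∘ ρ) ⊎ Wins false (prio ∘ ρ) → Wins true (prio ∘ ρ)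
      total (inj₁ w) = w
      total (inj₂ l) = contradiction (trans (sym (run⇒lasso constant-ramsey em (ρ , path , l))) e) true≢false

    not-losing : (∀ ρ → Path ρ → Wins true (prio ∘ ρ)) → losing ≡ false
    not-losing h = ¬-not λ e → let ρ , path , l = lasso⇒run constant-ramsey e in
      true≢false (Wins-unique (h ρ path) l)

-- Parity automata on trees

branch : (ℕ → Bool) → ℕ → Node
branch β zero = []
branch β (suc k) = branch β k ∷ʳ β k

branch-∷ : ∀ β k → branch β (suc k) ≡ β 0 ∷ branch (β ∘ suc) k
branch-∷ β zero = refl
branch-∷ β (suc k) = cong (_∷ʳ β (suc k)) (branch-∷ β k)

along : Node → ℕ → Bool
along [] _ = false
along (b ∷ s) zero = b
along (b ∷ s) (suc k) = along s k

branch-along : ∀ s r → branch (along (s ++ r)) (length s) ≡ s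
branch-along [] r = refl
branch-along (b ∷ s) r = trans (branch-∷ (along (b ∷ s ++ r)) (length s)) (cong (b ∷_) (branch-along s r))

along-last : ∀ s b → along (s ∷ʳ b) (length s) ≡ b
along-last [] b = refl
along-last (_ ∷ s) b = along-last s b

-- Acceptance constrains infinite runs only, so a run that gets stuck does no harm.
record UniversalAutomaton (A : Set) : Set₁ where
  field
    Ann        : Set
    Ann-finite : Finite Ann
    ann₀       : Ann
    Q          : Set
    Q-finite   : Finite Q
    initial    : Q → Bool
    Δ     : Q → A → Ann → Bool → Q → Bool
    prio       : Q → ℕ
    prio-max   : ℕ
    prio≤      : ∀ q → prio q ≤ prio-max

  Run : (Node → A) → (Node → Ann) → (ℕ → Bool) → (ℕ → Q) → Set
  Run t r β ρ = initial (ρ 0) ≡ true ×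
    (∀ k → Δ (ρ k) (t (branch β k)) (r (branch β k)) (β k) (ρ (suc k)) ≡ true)

  AcceptsWith : (Node → A) → (Node → Ann) → Set
  AcceptsWith t r = ∀ β ρ → Run t r β ρ → Wins true (prio ∘ ρ)

open UniversalAutomaton

Accepts : ∀ {A} → UniversalAutomaton A → (Node → A) → Set
Accepts U t = Σ (Node → Ann U) (AcceptsWith U t)

_⟺_ : ∀ {a b} → Set a → Set b → Set _
A ⟺ B = (A → B) × (B → A)

relabel : ∀ {A B} → (A → B) → UniversalAutomaton B → UniversalAutomaton A
relabel f U = record
  { Ann = Ann U ; Ann-finite = Ann-finite U ; ann₀ = ann₀ U
  ; Q = Q U ; Q-finite = Q-finite U ; initial = initial U
  ; Δ = λ q a → Δ U q (f a)
  ; prio = prio U ; prio-max = prio-max U ; prio≤ = prio≤ U }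

project : ∀ {A B} → Finite B → B → UniversalAutomaton (A × B) → UniversalAutomaton A
project {A} {B} F b₀ U = record
  { Ann = Ann U × B ; Ann-finite = ×-finite (Ann-finite U) F ; ann₀ = ann₀ U , b₀
  ; Q = Q U ; Q-finite = Q-finite U ; initial = initial U
  ; Δ = λ q a (m , b) → Δ U q (a , b) m
  ; prio = prio U ; prio-max = prio-max U ; prio≤ = prio≤ U }

project-correct : ∀ {A B} (F : Finite B) b₀ (U : UniversalAutomaton (A × B)) t →
  Accepts (project F b₀ U) t ⟺ (Σ (Node → B) λ u → Accepts U (λ s → t s , u s))
project-correct F b₀ U t = (λ (r , h) → proj₂ ∘ r , proj₁ ∘ r , h) , (λ (u , r , h) → (λ s → r s , u s) , h)

_∩_ : ∀ {A} → UniversalAutomaton A → UniversalAutomaton A → UniversalAutomaton A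
U ∩ V = record
  { Ann = Ann U × Ann V ; Ann-finite = ×-finite (Ann-finite U) (Ann-finite V) ; ann₀ = ann₀ U , ann₀ V
  ; Q = Q U ⊎ Q V ; Q-finite = ⊎-finite (Q-finite U) (Q-finite V)
  ; initial = λ { (inj₁ q) → initial U q ; (inj₂ q) → initial V q }
  ; Δ = step
  ; prio = λ { (inj₁ q) → prio U q ; (inj₂ q) → prio V q }
  ; prio-max = prio-max U + prio-max V
  ; prio≤ = λ { (inj₁ q) → ≤-trans (prio≤ U q) (m≤m+n _ _) ; (inj₂ q) → ≤-trans (prio≤ V q) (m≤n+m _ _) } }
  where
  step : Q U ⊎ Q V → _ → Ann U × Ann V → Bool → Q U ⊎ Q V → Bool
  step (inj₁ q) a (m , _) b (inj₁ q′) = Δ U q a m b q′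
  step (inj₂ q) a (_ , m) b (inj₂ q′) = Δ V q a m b q′
  step _ _ _ _ _ = false

∩-correct : ∀ {A} (U V : UniversalAutomaton A) t → Accepts (U ∩ V) t ⟺ (Accepts U t × Accepts V t)
∩-correct U V t = to , from
  where
  to : Accepts (U ∩ V) t → Accepts U t × Accepts V t
  to (r , h) = (proj₁ ∘ r , λ β ρ run → h β (inj₁ ∘ ρ) run) , (proj₂ ∘ r , λ β ρ run → h β (inj₂ ∘ ρ) run)
  stays₁ : ∀ {p p′ q a m b} → p ≡ inj₁ q → Δ (U ∩ V) p a m b p′ ≡ true → ∃ λ q′ → p′ ≡ inj₁ q′
  stays₁ {p′ = inj₁ q′} refl _ = q′ , refl
  stays₁ {p′ = inj₂ _} refl ()
  stays₂ : ∀ {p p′ q a m b} → p ≡ inj₂ q → Δ (U ∩ V) p a m b p′ ≡ true → ∃ λ q′ → p′ ≡ inj₂ q′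
  stays₂ {p′ = inj₂ q′} refl _ = q′ , refl
  stays₂ {p′ = inj₁ _} refl ()
  from : Accepts U t × Accepts V t → Accepts (U ∩ V) t
  from ((r , h) , (r′ , h′)) = (λ s → r s , r′ s) , accepts
    where
    accepts : AcceptsWith (U ∩ V) t (λ s → r s , r′ s)
    accepts β ρ (i , step) with ρ 0 in eq
    ... | inj₁ q₀ = Wins-cong (λ k → cong (prio (U ∩ V)) (sym (proj₂ (side k))))
          (h β (proj₁ ∘ side)
            (i
            , λ k → subst₂ (λ p q → Δ (U ∩ V) p _ (r _ , r′ _) (β k) q ≡ true) (proj₂ (side k)) (proj₂ (side (suc k))) (step k)))
      where
      side : ∀ k → ∃ λ q → ρ k ≡ inj₁ q
      side zero = q₀ , eq
      side (suc k) = stays₁ (proj₂ (side k)) (step k)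
    ... | inj₂ q₀ = Wins-cong (λ k → cong (prio (U ∩ V)) (sym (proj₂ (side k))))
          (h′ β (proj₁ ∘ side)
            (i
            , λ k → subst₂ (λ p q → Δ (U ∩ V) p _ (r _ , r′ _) (β k) q ≡ true) (proj₂ (side k)) (proj₂ (side (suc k))) (step k)))
      where
      side : ∀ k → ∃ λ q → ρ k ≡ inj₂ q
      side zero = q₀ , eq
      side (suc k) = stays₂ (proj₂ (side k)) (step k)

Wins-constant : ∀ {f p} n → (∀ k → n ≤ k → f k ≡ p) → Wins (even p) f
Wins-constant {f} {p} n h = winning (p , refl , (λ m → m + n , m≤m+n m n , h (m + n) (m≤n+m n m))
  , n , λ k nk → ≤-reflexive (h k nk))

-- A state remembers the summary `g` of the parent and the direction taken, `just nothing` stands at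
-- the root, and `nothing` is a sink of odd priority entered after a failed check.
module EdgeCondition {A B : Set} (B-finite : Finite B) (g : A → B) (root : A → Bool) (edge : B → Bool → A → Bool) where

  State : Set
  State = Maybe (Maybe (B × Bool))

  State-finite : Finite State
  State-finite = Maybe-finite (Maybe-finite (×-finite B-finite Bool-finite))

  check : Maybe (B × Bool) → A → Bool
  check nothing a = root a
  check (just (b , d)) a = edge b d a

  δ : State → A → Bool → State
  δ nothing a d = nothing
  δ (just p) a d = if check p a then just (just (g a , d)) else nothing

  state-prio : State → ℕ
  state-prio nothing = 1
  state-prio (just _) = 0

  edges : UniversalAutomaton A
  edges = record
    { Ann = ⊤ ; Ann-finite = ⊤-finite ; ann₀ = tt
    ; Q = State ; Q-finite = State-finite
    ; initial = λ q → does (≟-finite State-finite q (just nothing))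
    ; Δ = λ q a _ d q′ → does (≟-finite State-finite q′ (δ q a d))
    ; prio = state-prio ; prio-max = 1
    ; prio≤ = λ { nothing → ≤-refl ; (just _) → z≤n } }

  Holds : (Node → A) → Set
  Holds t = root (t []) ≡ true × (∀ s d → edge (g (t s)) d (t (s ∷ʳ d)) ≡ true)

  edges-complete : ∀ t → Holds t → Accepts edges t
  edges-complete t (rt , ed) = _ , λ β ρ (i , step) →
    Wins-constant 0 (λ k _ → cong state-prio (proj₁ (proj₂ (good β ρ i step k))))
    where
    Good : (ℕ → Bool) → ℕ → Maybe (B × Bool) → Set
    Good β k p = check p (t (branch β k)) ≡ true
    good : ∀ β ρ → does (≟-finite State-finite (ρ 0) (just nothing)) ≡ true →
      (∀ k → does (≟-finite State-finite (ρ (suc k)) (δ (ρ k) (t (branch β k)) (β k))) ≡ true) →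
      ∀ k → ∃ λ p → ρ k ≡ just p × Good β k p
    good β ρ i step zero = nothing , does⁻ (≟-finite State-finite _ _) i , rt
    good β ρ i step (suc k) with good β ρ i step k
    ... | p , e , c = just (g (t (branch β k)) , β k)
      , trans (does⁻ (≟-finite State-finite _ _) (step k)) (trans (cong (λ q → δ q (t (branch β k)) (β k)) e)
          (cong (λ b → if b then just (just (g (t (branch β k)) , β k)) else nothing) c))
      , ed (branch β k) (β k)

  module _ (t : Node → A) (accepted : Accepts edges t) where

    state : (ℕ → Bool) → ℕ → State
    state β zero = just nothing
    state β (suc k) = δ (state β k) (t (branch β k)) (β k)

    wins-state : ∀ β → Wins true (state-prio ∘ state β)
    wins-state β = proj₂ accepted β (state β)
      (dec-true (≟-finite State-finite _ _) refl , λ k → dec-true (≟-finite State-finite _ _) refl)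

    never-failing : ∀ β k → state β k ≢ nothing
    never-failing β k e = true≢false (Wins-unique (wins-state β) (Wins-constant k λ l h → cong state-prio (stuck l h)))
      where
      stuck : ∀ l → k ≤ l → state β l ≡ nothing
      stuck l h with m≤n⇒m<n∨m≡n h
      ... | inj₂ refl = e
      stuck (suc l) h | inj₁ (s≤s h′) rewrite stuck l h′ = refl

    δ-check : ∀ {q p a d} → q ≡ just p → δ q a d ≢ nothing → check p a ≡ true × δ q a d ≡ just (just (g a , d))
    δ-check {p = p} {a} refl h with check p a
    ... | true = refl , refl
    ... | false = contradiction refl h

    checked : ∀ β k p → state β k ≡ just p → check p (t (branch β k)) ≡ true × state β (suc k) ≡ just (just (g (t (branch β k)) , β k))
    checked β k p e = δ-check e (never-failing β (suc k))

    state-suc : ∀ β k → state β (suc k) ≡ just (just (g (t (branch β k)) , β k))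
    state-suc β zero = proj₂ (checked β zero nothing refl)
    state-suc β (suc k) = proj₂ (checked β (suc k) _ (state-suc β k))

    edges-sound : Holds t
    edges-sound = proj₁ (checked (λ _ → false) 0 nothing refl) , λ s d →
      let β = along (s ∷ʳ d)
          e₁ = branch-along s (d ∷ [])
          e₂ = along-last s d
      in trans (cong₂ (λ s′ d′ → edge (g (t s′)) d′ (t (s′ ∷ʳ d′))) (sym e₁) (sym e₂))
           (proj₁ (checked β (suc (length s)) _ (state-suc β (length s))))

  edges-correct : ∀ t → Accepts edges t ⟺ Holds t
  edges-correct t = edges-sound t , edges-complete t

module Along {D : Set} (δ : Node → D → Bool → D) (d₀ : D) where

  go : Node → D → Node → D
  go p d [] = d
  go p d (b ∷ s) = go (p ∷ʳ b) (δ p d b) s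

  at : Node → D
  at = go [] d₀

  go-∷ʳ : ∀ p d s b → go p d (s ∷ʳ b) ≡ δ (p ++ s) (go p d s) b
  go-∷ʳ p d [] b = cong (λ q → δ q d b) (sym (Listₚ.++-identityʳ p))
  go-∷ʳ p d (a ∷ s) b = trans (go-∷ʳ (p ∷ʳ a) (δ p d a) s b)
    (cong (λ q → δ q (go (p ∷ʳ a) (δ p d a) s) b) (Listₚ.++-assoc p (a ∷ []) s))

  at-∷ʳ : ∀ s b → at (s ∷ʳ b) ≡ δ s (at s) b
  at-∷ʳ = go-∷ʳ [] d₀

module Deterministic {A : Set} (U : UniversalAutomaton A) where

  open ParityRuns (Q-finite U) (initial U) (prio U) (prio-max U) (prio≤ U)
  private module D = Determinize Paths-finite ε ext bad

  letter : A → Ann U → Bool → Letter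
  letter a m b q q′ = Δ U q a m b q′

  word : (Node → A) → (Node → Ann U) → (ℕ → Bool) → ℕ → Letter
  word t r β k = letter (t (branch β k)) (r (branch β k)) (β k)

  run-unique : ∀ w (d : ℕ → D.DState) → d 0 ≡ D.start → (∀ k → d (suc k) ≡ D.step (d k) (w k)) → ∀ k → D.run w k ≡ d k
  run-unique w d e f zero = sym e
  run-unique w d e f (suc k) = trans (cong (λ x → D.step x (w k)) {D.run w k} {d k} (run-unique w d e f k)) (sym (f k))

  run-wins : ∀ {i} w (d : ℕ → D.DState) → d 0 ≡ D.start → (∀ k → d (suc k) ≡ D.step (d k) (w k)) →
    Wins i (D.priority ∘ d) → Wins i (D.priority ∘ D.run w)
  run-wins w d e f = Wins-cong (λ k → sym (cong D.priority {D.run w k} {d k} (run-unique w d e f k)))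

  abstract
    DState : Set
    DState = D.DState

    DState-finite : Finite DState
    DState-finite = D.DState-finite

    start : DState
    start = D.start

    step : DState → Letter → DState
    step = D.step

    priority : DState → ℕ
    priority = D.priority

    priority-max : ℕ
    priority-max = 1 + (D.N + D.N)

    priority-bound : ∀ d → priority d ≤ priority-max
    priority-bound = D.priority-bound

  IsRunOn : (ℕ → Letter) → (ℕ → DState) → Set
  IsRunOn w d = d 0 ≡ start × (∀ k → d (suc k) ≡ step (d k) (w k))

  abstract
    -- A losing run would make the pair of the factorisation bad, and the deterministic run would
    -- then have an odd limit.
    run-good : EM₁ → ∀ w d → IsRunOn w d → Wins true (priority ∘ d) → ∀ ρ → IsRun w ρ → Wins true (prio U ∘ ρ)
    run-good em w d isD win ρ isRun with Classical.Wins-total em (prio-max U) (prio U ∘ ρ) (prio≤ U ∘ ρ)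
    ... | inj₁ h = h
    ... | inj₂ h = let _ , _ , ramsey , win′ = D.Correct.determinize-correct w em in
      contradiction (trans (sym (cong not (run⇒lasso ramsey em (ρ , isRun , h))))
        (Wins-unique win′ (run-wins w d (proj₁ isD) (proj₂ isD) win))) (λ ())

    run-bad : EM₁ → ∀ w d → IsRunOn w d → Wins false (priority ∘ d) → ∃ λ ρ → IsRun w ρ × Wins false (prio U ∘ ρ)
    run-bad em w d isD win = let _ , _ , ramsey , win′ = D.Correct.determinize-correct w em in
      lasso⇒run ramsey (not-injective (Wins-unique win′
        (run-wins w d (proj₁ isD) (proj₂ isD) win)))

  δ : A → Ann U → DState → Bool → DState
  δ a m d b = step d (letter a m b)

  module _ (em : EM₁) where
    open Classical em

    accepts-if : ∀ t r (d : Node → DState) → d [] ≡ start → (∀ s b → d (s ∷ʳ b) ≡ δ (t s) (r s) (d s) b) →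
      (∀ β → Wins true (priority ∘ d ∘ branch β)) → AcceptsWith U t r
    accepts-if t r d e f h β ρ isRun = run-good em (word t r β) (d ∘ branch β)
      (e , λ k → f (branch β k) (β k)) (h β) ρ isRun

    accepts-run : ∀ t r → AcceptsWith U t r → ∀ β d → d 0 ≡ start →
      (∀ k → d (suc k) ≡ δ (t (branch β k)) (r (branch β k)) (d k) (β k)) → Wins true (priority ∘ d)
    accepts-run t r h β d e f with Wins-total priority-max (priority ∘ d) (priority-bound ∘ d)
    ... | inj₁ w = w
    ... | inj₂ l with run-bad em (word t r β) d (e , f) l
    ...   | ρ , isRun , bd = contradiction (Wins-unique (h β ρ isRun) bd) λ ()

    -- The opponent looks at the state before turning, so the branch and the states along it have to
    -- be built together.
    respond : ∀ (t : Node → A) (r : Node → Ann U) (f : Node → DState → Bool) → Σ (ℕ → Bool) λ β → Σ (ℕ → DState) λ d → d 0 ≡ start ×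
      (∀ k → β k ≡ f (branch β k) (d k) × d (suc k) ≡ δ (t (branch β k)) (r (branch β k)) (d k) (β k))
    respond t r f = β , proj₂ ∘ at , refl , λ k → cong (λ s → f s (proj₂ (at k))) (node-at k)
      , cong (λ s → δ (t s) (r s) (proj₂ (at k)) (β k)) (node-at k)
      where
      at : ℕ → Node × DState
      at zero = [] , start
      at (suc k) = let s , d = at k in s ∷ʳ f s d , δ (t s) (r s) d (f s d)
      β : ℕ → Bool
      β k = f (proj₁ (at k)) (proj₂ (at k))
      node-at : ∀ k → proj₁ (at k) ≡ branch β k
      node-at zero = refl
      node-at (suc k) = cong (_∷ʳ β k) (node-at k)

-- The automaton player chooses the annotation, the opponent the branch, and the parity condition
-- is that of the determinised automaton. If the tree is rejected, the opponent has a positional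
-- winning strategy, which the complement automaton guesses as its annotation; it then runs
-- through all plays against this strategy.
module Complement {A : Set} (U : UniversalAutomaton A) where

  open Deterministic U

  Response-finite : Finite (DState × Ann U)
  Response-finite = ×-finite DState-finite (Ann-finite U)

  Response : Set
  Response = Tab Response-finite Bool

  Move : DState → A → Response → Bool → DState → Ann U → Set
  Move d a τ b d′ m = get Response-finite τ (d , m) ≡ b × d′ ≡ δ a m d b

  Move? : ∀ d a τ b d′ → Dec (∃ (Move d a τ b d′))
  Move? d a τ b d′ = any-finite (Ann-finite U) λ m →
    (get Response-finite τ (d , m) ≟ᵇ b) ×-dec ≟-finite DState-finite d′ (δ a m d b)

  complement : UniversalAutomaton A
  complement = record
    { Ann = Response ; Ann-finite = Tab-finite Response-finite Bool-finite ; ann₀ = tab Response-finite (λ _ → false)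
    ; Q = DState ; Q-finite = DState-finite
    ; initial = λ d → does (≟-finite DState-finite d start)
    ; Δ = λ d a τ b d′ → does (Move? d a τ b d′)
    -- Raising every priority by one exchanges the two players.
    ; prio = suc ∘ priority ; prio-max = suc priority-max ; prio≤ = λ d → s≤s (priority-bound d) }

  module _ (em : EM₁) (t : Node → A) where

    disjoint : Accepts complement t → ¬ Accepts U t
    disjoint (τ , h) (r , h′) with respond em t r (λ s d → get Response-finite (τ s) (d , r s))
    ... | β , d , e , f = contradiction
      (Wins-unique (Wins-suc⁻ {false} (h β d (dec-true (≟-finite DState-finite _ _) e
          , λ k → dec-true (Move? _ _ _ _ _) (r (branch β k) , sym (proj₁ (f k)) , proj₂ (f k)))))
        (accepts-run em t r h′ β d e (proj₂ ∘ f))) (λ ())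

    position-code : Node × DState → List Bool
    position-code (s , d) = unary (toℕ (enc DState-finite d)) s

    position-code-injective : ∀ {p q} → position-code p ≡ position-code q → p ≡ q
    position-code-injective {s , d} {s′ , d′} e =
      let e₁ , e₂ = unary-injective {toℕ (enc DState-finite d)} e in
      cong₂ _,_ e₂ (enc-injective DState-finite (Finₚ.toℕ-injective e₁))

    open Lockstep em (Ann-finite U) (ann₀ U) (λ (s , d) m b → s ∷ʳ b , δ (t s) m d b)
      (priority ∘ proj₂) priority-max (priority-bound ∘ proj₂) position-code position-code-injective

    -- The deterministic state at a node is fixed by the annotations above it, so following the
    -- strategy from the root annotates every node exactly once.
    eve-accepts : EveWins ([] , start) → Accepts U t
    eve-accepts (σ , h) = r , accepts-if em t r at refl at-∷ʳ
      (λ β → h (λ k → branch β k , at (branch β k)) β refl (λ k → cong (branch β (suc k) ,_) (at-∷ʳ (branch β k) (β k))))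
      where
      open Along (λ s d b → δ (t s) (σ (s , d)) d b) start
      r : Node → Ann U
      r s = σ (s , at s)

    -- The annotation at a node tabulates the replies there to every state and every move, so it
    -- defeats all annotations of `U` at once.
    adam-rejects : AdamWins ([] , start) → Accepts complement t
    adam-rejects (τ , h) = r , accepts
      where
      r : Node → Response
      r s = tab Response-finite (λ (d , m) → τ (s , d) m)
      accepts : AcceptsWith complement t r
      accepts β ρ (i , st) = Wins-suc {false} (h (λ k → branch β k , ρ k) (proj₁ ∘ move)
        (cong ([] ,_) (does⁻ (≟-finite DState-finite _ _) i))
        (λ k → let m , e , e′ = move k
                   b≡ = trans (sym (get-tab Response-finite _ (ρ k , m))) e
               in cong₂ _,_ (cong (branch β k ∷ʳ_) (sym b≡)) (trans e′ (cong (δ (t (branch β k)) m (ρ k)) (sym b≡)))))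
        where
        move : ∀ k → ∃ (Move (ρ k) (t (branch β k)) (r (branch β k)) (β k) (ρ (suc k)))
        move k = does⁻ (Move? _ _ _ _ _) (st k)

    complement-correct : Accepts complement t ⟺ (¬ Accepts U t)
    complement-correct = disjoint , total (lockstep-determined ([] , start))
      where
      total : EveWins ([] , start) ⊎ AdamWins ([] , start) → ¬ Accepts U t → Accepts complement t
      total (inj₁ eve) n = contradiction (eve-accepts eve) n
      total (inj₂ adam) n = adam-rejects adam

module Emptiness {A : Set} (A-finite : Finite A) (a₀ : A) (U : UniversalAutomaton A) where

  open Deterministic U

  Choice-finite : Finite (A × Ann U)
  Choice-finite = ×-finite A-finite (Ann-finite U)

  Strategy : Set
  Strategy = Tab DState-finite (A × Ann U)

  Strategy-finite : Finite Strategy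
  Strategy-finite = Tab-finite DState-finite Choice-finite

  next : DState → A × Ann U → Bool → DState
  next d (a , m) b = δ a m d b

  module Play (σ : Strategy) where

    Moves? : ∀ d d′ → Dec (∃ λ b → d′ ≡ next d (get DState-finite σ d) b)
    Moves? d d′ = any-finite Bool-finite λ b → ≟-finite DState-finite d′ (next d (get DState-finite σ d) b)

    graph : DState → DState → Bool
    graph d d′ = does (Moves? d d′)

    open FiniteGraph DState-finite (λ d → does (≟-finite DState-finite d start)) priority priority-max priority-bound graph public

  -- The algorithm solves no game: it enumerates the positional strategies. Determinacy only serves
  -- to prove that this search is exhaustive.
  nonempty? : Dec (∃ λ σ → Play.losing σ ≡ false)
  nonempty? = any-finite Strategy-finite λ σ → Play.losing σ ≟ᵇ false

  nonempty : Bool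
  nonempty = does nonempty?

  module _ (em : EM₁) where

    nonempty-sound : nonempty ≡ true → ∃ (Accepts U)
    nonempty-sound h with does⁻ nonempty? h
    ... | σ , e = t , r , accepts-if em t r at refl at-∷ʳ (λ β → wins-if-not-losing em e (at ∘ branch β)
      (dec-true (≟-finite DState-finite _ _) refl
      , λ k → dec-true (Moves? _ _) (β k , at-∷ʳ (branch β k) (β k))))
      where
      open Play σ
      open Along (λ _ d b → next d (get DState-finite σ d) b) start
      t : Node → A
      t s = proj₁ (get DState-finite σ (at s))
      r : Node → Ann U
      r s = proj₂ (get DState-finite σ (at s))

    open Lockstep em Choice-finite (a₀ , ann₀ U) next priority priority-max priority-bound
      (λ d → unary (toℕ (enc DState-finite d)) [])
      (λ e → enc-injective DState-finite (Finₚ.toℕ-injective (proj₁ (unary-injective e))))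

    eve-nonempty : EveWins start → nonempty ≡ true
    eve-nonempty (σ , win) = dec-true nonempty? (table , Play.not-losing table λ ρ (i , st) →
      let move = λ k → does⁻ (Play.Moves? table _ _) (st k) in
      win ρ (proj₁ ∘ move) (does⁻ (≟-finite DState-finite _ _) i)
        (λ k → trans (proj₂ (move k)) (cong (λ c → next (ρ k) c (proj₁ (move k))) (get-tab DState-finite σ (ρ k)))))
      where
      table : Strategy
      table = tab DState-finite σ

    adam-empty : AdamWins start → ¬ ∃ (Accepts U)
    adam-empty (τ , win) (t , r , h) = let β , d , e , f = respond em t r (λ s d → τ d (t s , r s)) in
      true≢false (Wins-unique (accepts-run em t r h β d e (proj₂ ∘ f))
        (win d (λ k → t (branch β k) , r (branch β k)) e
          (λ k → trans (proj₂ (f k)) (cong (δ (t (branch β k)) (r (branch β k)) (d k)) (proj₁ (f k))))))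

    nonempty-complete : ∃ (Accepts U) → nonempty ≡ true
    nonempty-complete = total (lockstep-determined start)
      where
      total : EveWins start ⊎ AdamWins start → ∃ (Accepts U) → nonempty ≡ true
      total (inj₁ eve) _ = eve-nonempty eve
      total (inj₂ adam) h = contradiction h (adam-empty adam)

-- Recognizable tree languages

-- The automaton is given outright and can be run; only its correctness is classical.
record Recognizable {A : Set} (L : (Node → A) → Set) : Set₂ where
  field
    automaton : UniversalAutomaton A
    correct   : EM₁ → ∀ t → Accepts automaton t ⟺ L t

open Recognizable

⟺-trans : ∀ {a b c} {A : Set a} {B : Set b} {C : Set c} → A ⟺ B → B ⟺ C → A ⟺ C
⟺-trans (f , g) (f′ , g′) = f′ ∘ f , g ∘ g′

abstract
  rec-⟺ : ∀ {A} {L L′ : (Node → A) → Set} → (EM₁ → ∀ t → L t ⟺ L′ t) → Recognizable L → Recognizable L′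
  rec-⟺ e R = record { automaton = automaton R ; correct = λ em t → ⟺-trans (correct R em t) (e em t) }

  rec-¬ : ∀ {A} {L : (Node → A) → Set} → Recognizable L → Recognizable (λ t → ¬ L t)
  rec-¬ R = record
    { automaton = Complement.complement (automaton R)
    ; correct = λ em t → ⟺-trans (Complement.complement-correct (automaton R) em t)
        ((λ n l → n (proj₂ (correct R em t) l)) , (λ n a → n (proj₁ (correct R em t) a))) }

  rec-× : ∀ {A} {L L′ : (Node → A) → Set} → Recognizable L → Recognizable L′ → Recognizable (λ t → L t × L′ t)
  rec-× R R′ = record
    { automaton = automaton R ∩ automaton R′
    ; correct = λ em t → ⟺-trans (∩-correct (automaton R) (automaton R′) t)
        ((λ (a , a′) → proj₁ (correct R em t) a , proj₁ (correct R′ em t) a′)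
        , (λ (l , l′) → proj₂ (correct R em t) l , proj₂ (correct R′ em t) l′)) }

  rec-∃ : ∀ {A B} → Finite B → B → {L : (Node → A × B) → Set} → Recognizable L →
    Recognizable (λ t → Σ (Node → B) λ u → L (λ s → t s , u s))
  rec-∃ F b₀ R = record
    { automaton = project F b₀ (automaton R)
    ; correct = λ em t → ⟺-trans (project-correct F b₀ (automaton R) t)
        ((λ (u , a) → u , proj₁ (correct R em _) a) , (λ (u , l) → u , proj₂ (correct R em _) l)) }

  rec-∘ : ∀ {A B} (f : A → B) {L : (Node → B) → Set} → Recognizable L → Recognizable (λ t → L (f ∘ t))
  rec-∘ f R = record { automaton = relabel f (automaton R) ; correct = λ em t → correct R em (f ∘ t) }

  rec-edges : ∀ {A B} → Finite B → (g : A → B) (root : A → Bool) (edge : B → Bool → A → Bool) →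
    Recognizable (λ t → root (t []) ≡ true × (∀ s d → edge (g (t s)) d (t (s ∷ʳ d)) ≡ true))
  rec-edges F g root edge = record
    { automaton = EdgeCondition.edges F g root edge ; correct = λ _ t → EdgeCondition.edges-correct F g root edge t }

module _ {A : Set} where

  Everywhere Somewhere AtMostOnce : (A → Bool) → (Node → A) → Set
  Everywhere p t = ∀ s → p (t s) ≡ true
  Somewhere p t = ∃ λ s → p (t s) ≡ true
  AtMostOnce p t = ∀ s s′ → p (t s) ≡ true → p (t s′) ≡ true → s ≡ s′

  rec-everywhere : ∀ p → Recognizable (Everywhere p)
  rec-everywhere p = rec-⟺ (λ _ t → (λ (r , e) s → to t r e (initLast s)) , (λ h → h [] , λ s d → h (s ∷ʳ d)))
    (rec-edges ⊤-finite _ p (λ _ _ → p))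
    where
    to : ∀ t → p (t []) ≡ true → (∀ s d → p (t (s ∷ʳ d)) ≡ true) → ∀ {s} → InitLast s → p (t s) ≡ true
    to t r e [] = r
    to t r e (s ∷ʳ′ d) = e s d

  rec-somewhere : ∀ p → Recognizable (Somewhere p)
  rec-somewhere p = rec-⟺ (λ em t →
      (λ n → let s , h = Classical.¬∀⟶∃¬ em n in s , Classical.stable em (λ ¬p → h (not-true⁺ ¬p)))
      , (λ (s , h) a → true≢false (trans (sym h) (not-true⁻ (a s)))))
    (rec-¬ (rec-everywhere (not ∘ p)))

  rec-⊤ : Recognizable {A} (λ _ → ⊤)
  rec-⊤ = rec-⟺ (λ _ _ → _ , λ _ _ → refl) (rec-everywhere (λ _ → true))

  rec-dec : ∀ {P : Set} → Dec P → Recognizable {A} (λ _ → P)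
  rec-dec (yes p) = rec-⟺ (λ _ _ → (λ _ → p) , _) rec-⊤
  rec-dec (no ¬p) = rec-⟺ (λ _ _ → (λ n → contradiction tt n) , (λ p → contradiction p ¬p)) (rec-¬ rec-⊤)

  rec-∀Fin : ∀ n {L : Fin n → (Node → A) → Set} → (∀ i → Recognizable (L i)) → Recognizable (λ t → ∀ i → L i t)
  rec-∀Fin zero R = rec-⟺ (λ _ _ → (λ _ ()) , _) rec-⊤
  rec-∀Fin (suc n) R = rec-⟺ (λ _ _ → (λ (l , ls) → λ { zero → l ; (suc i) → ls i }) , (λ ls → ls zero , ls ∘ suc))
    (rec-× (R zero) (rec-∀Fin n (R ∘ suc)))

⇒⁺ : ∀ {a b} → (a ≡ true → b ≡ true) → not a ∨ b ≡ true
⇒⁺ {true} h = h refl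
⇒⁺ {false} _ = refl

⇒⁻ : ∀ {a b} → not a ∨ b ≡ true → a ≡ true → b ≡ true
⇒⁻ h refl = h

_≡ˢ?_ : (s s′ : Node) → Dec (s ≡ s′)
_≡ˢ?_ = Listₚ.≡-dec _≟ᵇ_

-- A set of nodes has at most one element iff it has no nonempty proper subset.
rec-atMostOnce : ∀ {A} (p : A → Bool) → Recognizable (AtMostOnce p)
rec-atMostOnce {A} p = rec-⟺ (λ em t → to em t , from t)
  (rec-¬ (rec-∃ Bool-finite false (rec-× (rec-everywhere (λ (a , y) → not y ∨ p a))
    (rec-× (rec-somewhere proj₂) (rec-somewhere (λ (a , y) → p a ∧ not y))))))
  where
  Split : (Node → A) → (Node → Bool) → Set
  Split t u = (∀ s → not (u s) ∨ p (t s) ≡ true) × (∃ λ s → u s ≡ true) × (∃ λ s → p (t s) ∧ not (u s) ≡ true)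
  to : EM₁ → ∀ t → ¬ (Σ (Node → Bool) (Split t)) → AtMostOnce p t
  to em t n s s′ h h′ = Classical.stable em λ s≢s′ → n (u , (λ v → ⇒⁺ (λ e → subst (λ v → p (t v) ≡ true) (sym (does⁻ (v ≡ˢ? s) e)) h))
    , (s , dec-true (s ≡ˢ? s) refl) , s′ , ∧⁺ h′ (cong not (dec-false (s′ ≡ˢ? s) (s≢s′ ∘ sym))))
    where
    u : Node → Bool
    u v = does (v ≡ˢ? s)
  from : ∀ t → AtMostOnce p t → ¬ (Σ (Node → Bool) (Split t))
  from t h (u , sub , (s , us) , (s′ , e)) with ∧⁻ {p (t s′)} e
  ... | ps′ , ¬us′ = true≢false (trans (sym us) (trans (cong u (h s s′ (⇒⁻ (sub s) us) ps′)) (not-true⁻ ¬us′)))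

-- MSO formulas read on decorated trees

module Trees (S : Signature) (k : ℕ) where

  Colour : Set
  Colour = Maybe (Fin k)

  Colour-finite : Finite Colour
  Colour-finite = Maybe-finite (Fin-finite k)

  own-colour : Deco S k → Colour
  own-colour (cst _ j) = just j
  own-colour (star j) = just j
  own-colour _ = nothing

  is-entity : Deco S k → Bool
  is-entity (cst _ _) = true
  is-entity (star _) = true
  is-entity _ = false

  is-cst : ℕ → Deco S k → Bool
  is-cst c (cst c′ _) = does (c ≟ c′)
  is-cst _ _ = false

  recolouring : Deco S k → Maybe (Fin k × Fin k)
  recolouring (recolor a b) = just (a , b)
  recolouring _ = nothing

  apply : Maybe (Fin k × Fin k) → Fin k → Fin k
  apply nothing j = j
  apply (just (a , b)) j = if does (j Finₚ.≟ a) then b else j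

  -- The colour at s of the entity introduced at s ++ w.
  colour : (Node → Deco S k) → Node → Node → Colour
  colour T s [] = own-colour (T s)
  colour T s (b ∷ w) = Data.Maybe.map (apply (recolouring (T s))) (colour T (s ∷ʳ b) w)

  is-add : Fin (nRel S) → Deco S k → Bool
  is-add R (add R′ _) = does (R′ Finₚ.≟ R)
  is-add R _ = false

  required : (R : Fin (nRel S)) → Fin (arity S R) → Deco S k → Colour
  required R i (add R′ ks) with R′ Finₚ.≟ R
  ... | yes refl = just (lookup ks i)
  ... | no _ = nothing
  required R i _ = nothing

  is-add⁻ : ∀ R d → is-add R d ≡ true → ∃ λ ks → d ≡ add R ks
  is-add⁻ R (add R′ ks) h with R′ Finₚ.≟ R
  ... | yes refl = ks , refl

  is-add⁺ : ∀ R ks → is-add R (add R ks) ≡ true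
  is-add⁺ R ks = dec-true (R Finₚ.≟ R) refl

  required-add : ∀ R i ks → required R i (add R ks) ≡ just (lookup ks i)
  required-add R i ks with R Finₚ.≟ R
  ... | yes refl = refl
  ... | no n = contradiction refl n

  -- This alphabet is infinite, with one bit for every variable. Only the emptiness test enumerates
  -- letters, and it runs on the finite alphabet `Index d`.
  Letter : Set
  Letter = Deco S k × (ℕ → Bool) × (ℕ → Bool)

  deco : Letter → Deco S k
  deco = proj₁

  at-term : FOT → Letter → Bool
  at-term (var x) (_ , fo , _) = fo x
  at-term (con c) (d , _ , _) = is-cst c d

  in-set : ℕ → Letter → Bool
  in-set X (_ , _ , so) = so X

  set : (ℕ → Bool) → ℕ → Bool → ℕ → Bool
  set ν x b y with x ≟ y
  ... | yes _ = b
  ... | no _ = ν y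

  set-fo set-so : ℕ → Letter × Bool → Letter
  set-fo x ((d , fo , so) , b) = d , set fo x b , so
  set-so X ((d , fo , so) , b) = d , fo , set so X b

  ⟦_⟧ : Formula S → (Node → Letter) → Set
  ⟦ atom R ts ⟧ t = ∃ λ s → ∃ λ ks → deco (t s) ≡ add R ks × (∀ i → ∃ λ w →
    at-term (lookup ts i) (t (s ++ w)) ≡ true × colour (deco ∘ t) s w ≡ just (lookup ks i))
  -- A constant equals itself even if it does not occur in the instance, where no node could witness
  -- the equality.
  ⟦ equal (con c) (con c′) ⟧ t = c ≡ c′
  ⟦ equal a b ⟧ t = Somewhere (λ l → at-term a l ∧ at-term b l) t
  ⟦ memb a X ⟧ t = Somewhere (λ l → at-term a l ∧ in-set X l) t
  ⟦ neg φ ⟧ t = ¬ ⟦ φ ⟧ t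
  ⟦ conj φ ψ ⟧ t = ⟦ φ ⟧ t × ⟦ ψ ⟧ t
  ⟦ ex1 x φ ⟧ t = Σ (Node → Bool) λ u → (∀ s → not (u s) ∨ is-entity (deco (t s)) ≡ true)
    × (∃ λ s → u s ≡ true) × (∀ s s′ → u s ≡ true → u s′ ≡ true → s ≡ s′) × ⟦ φ ⟧ (λ s → set-fo x (t s , u s))
  ⟦ ex2 X φ ⟧ t = Σ (Node → Bool) λ u → (∀ s → not (u s) ∨ is-entity (deco (t s)) ≡ true)
    × ⟦ φ ⟧ (λ s → set-so X (t s , u s))

  ∷ʳ-++ : ∀ (s : Node) b w → (s ∷ʳ b) ++ w ≡ s ++ b ∷ w
  ∷ʳ-++ s b w = Listₚ.++-assoc s (b ∷ []) w

  -- The path from s down to the entity at s ++ w is marked by the colours along it. Every marked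
  -- node other than s has a marked parent, so climbing from a marked entity leads to s.
  module Marking (R : Fin (nRel S)) (a : FOT) (i : Fin (arity S R)) where

    Marked : Set
    Marked = (Letter × Bool) × Colour

    root-ok : Marked → Bool
    root-ok (_ , nothing) = true
    root-ok ((_ , b) , just _) = b

    parent-info : Marked → Maybe (Fin k × Fin k) × Colour
    parent-info ((l , _) , c) = recolouring (deco l) , c

    edge-ok : Maybe (Fin k × Fin k) × Colour → Bool → Marked → Bool
    edge-ok _ _ (_ , nothing) = true
    edge-ok (r , c) _ ((_ , b) , just c′) = b ∨ does (≟-finite Colour-finite c (just (apply r c′)))

    top-ok bottom : Marked → Bool
    top-ok ((l , b) , c) = not b ∨ does (≟-finite Colour-finite c (required R i (deco l)))
    bottom ((l , _) , c) = at-term a l ∧ (is-entity (deco l) ∧ does (≟-finite Colour-finite c (own-colour (deco l))))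

    Marks : (Node → Marked) → Set
    Marks m = (root-ok (m []) ≡ true × (∀ s d → edge-ok (parent-info (m s)) d (m (s ∷ʳ d)) ≡ true))
      × Everywhere top-ok m × Somewhere bottom m

    rec-marks : Recognizable Marks
    rec-marks = rec-× (rec-edges (×-finite (Maybe-finite (×-finite (Fin-finite k) (Fin-finite k))) Colour-finite) parent-info root-ok edge-ok)
      (rec-× (rec-everywhere top-ok) (rec-somewhere bottom))

    Reaches : (Node → Letter) → Node → Set
    Reaches t s = ∃ λ w → at-term a (t (s ++ w)) ≡ true × is-entity (deco (t (s ++ w))) ≡ true
      × colour (deco ∘ t) s w ≡ required R i (deco (t s))

    module Sound (t : Node → Letter) (u : Node → Bool) (s : Node) (us : ∀ v → u v ≡ true → v ≡ s) (us′ : u s ≡ true)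
      (C : Node → Colour) (marks : Marks (λ v → (t v , u v) , C v)) where

      T : Node → Deco S k
      T = deco ∘ t

      entity-colour : ∀ d → is-entity d ≡ true → ∃ λ c → own-colour d ≡ just c
      entity-colour (cst _ j) _ = j , refl
      entity-colour (star j) _ = j , refl

      parent : ∀ v b {c} → C (v ∷ʳ b) ≡ just c → u (v ∷ʳ b) ≡ false → C v ≡ just (apply (recolouring (T v)) c)
      parent v b {c} e f = does⁻ (≟-finite Colour-finite (C v) (just (apply (recolouring (T v)) c)))
        (trans (sym (cong₂ (λ c b′ → edge-ok (recolouring (T v) , C v) b ((t (v ∷ʳ b) , b′) , c)) e f)) (proj₂ (proj₁ marks) v b))

      climb : ∀ n v w → length v ≤ n → ∀ {c} → C v ≡ just c → colour T v w ≡ just c →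
        ∃ λ w′ → s ++ w′ ≡ v ++ w × colour T s w′ ≡ C s
      climb n v w h {c} e e′ with u v in uv | initLast v
      ... | true | _ = w , cong (_++ w) (sym (us v uv)) , subst (λ v → colour T v w ≡ C v) (us v uv) (trans e′ (sym e))
      ... | false | [] = contradiction (trans (sym (proj₁ (proj₁ marks)))
              (cong₂ (λ c b → root-ok ((t [] , b) , c)) e uv)) true≢false
      climb zero v w h e e′ | false | (v₀ ∷ʳ′ b) = contradiction (subst (_≤ 0) (Listₚ.length-++ v₀) h) (λ z → 1+n≰n (≤-trans (m≤n+m 1 (length v₀)) z))
      climb (suc n) v w h {c} e e′ | false | (v₀ ∷ʳ′ b) =
        let w′ , p , q = climb n v₀ (b ∷ w) (s≤s⁻¹ (≤-trans (≤-reflexive (trans (+-comm 1 (length v₀)) (sym (Listₚ.length-++ v₀)))) h))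
                           (parent v₀ b e uv) (cong (Data.Maybe.map (apply (recolouring (T v₀)))) e′)
        in w′ , trans p (sym (∷ʳ-++ v₀ b w)) , q

      reaches : Reaches t s
      reaches = let v , h = proj₂ (proj₂ marks)
                    a⁺ , h′ = ∧⁻ {at-term a (t v)} h
                    ent , o = ∧⁻ {is-entity (T v)} h′
                    o′ = does⁻ (≟-finite Colour-finite (C v) (own-colour (T v))) o
                    c , oc = entity-colour (T v) ent
                    w , p , q = climb (length v) v [] ≤-refl (trans o′ oc) oc
                    p′ = trans p (Listₚ.++-identityʳ v)
                in w , subst (λ v → at-term a (t v) ≡ true) (sym p′) a⁺ , subst (λ v → is-entity (T v) ≡ true) (sym p′) ent
                   , trans q (does⁻ (≟-finite Colour-finite (C s) (required R i (T s))) (⇒⁻ (proj₁ (proj₂ marks) s) us′))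

    module Complete (em : EM₁) (t : Node → Letter) (u : Node → Bool) (s : Node) (us : ∀ v → u v ≡ true → v ≡ s) (us′ : u s ≡ true)
      (w : Node) (aw : at-term a (t (s ++ w)) ≡ true) (ew : is-entity (deco (t (s ++ w))) ≡ true)
      (cw : colour (deco ∘ t) s w ≡ required R i (deco (t s))) where

      open Classical em

      T : Node → Deco S k
      T = deco ∘ t

      OnPath : Node → Set
      OnPath v = ∃₂ λ w₁ w₂ → v ≡ s ++ w₁ × w ≡ w₁ ++ w₂

      mark : ∀ {v} → Dec (OnPath v) → Colour
      mark {v} (yes (_ , w₂ , _)) = colour T v w₂
      mark (no _) = nothing

      C : Node → Colour
      C v = mark (lem (OnPath v))

      C-on : ∀ w₁ {w₂} → w ≡ w₁ ++ w₂ → C (s ++ w₁) ≡ colour T (s ++ w₁) w₂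
      C-on w₁ {w₂} e = go (lem (OnPath (s ++ w₁)))
        where
        go : (d : Dec (OnPath (s ++ w₁))) → mark d ≡ colour T (s ++ w₁) w₂
        go (no n) = contradiction (w₁ , w₂ , refl , e) n
        go (yes (w₁′ , w₂′ , p , q)) with Listₚ.++-cancelˡ s w₁ w₁′ p
        ... | refl = cong (colour T (s ++ w₁)) (Listₚ.++-cancelˡ w₁ w₂′ w₂ (trans (sym q) e))

      C-just : ∀ {v c} → C v ≡ just c → OnPath v
      C-just {v} = go (lem (OnPath v))
        where
        go : (d : Dec (OnPath v)) → ∀ {c} → mark d ≡ just c → OnPath v
        go (yes p) _ = p
        go (no _) ()

      m : Node → Marked
      m v = (t v , u v) , C v

      root-holds : ∀ c → C [] ≡ c → root-ok ((t [] , u []) , c) ≡ true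
      root-holds nothing _ = refl
      root-holds (just c) e = let w₁ , _ , p , _ = C-just e in
        subst (λ v → u v ≡ true) (Listₚ.++-conicalˡ s w₁ (sym p)) us′

      edge-holds : ∀ v b c → C (v ∷ʳ b) ≡ c → edge-ok (parent-info (m v)) b ((t (v ∷ʳ b) , u (v ∷ʳ b)) , c) ≡ true
      edge-holds v b nothing _ = refl
      edge-holds v b (just c) e with C-just e
      ... | w₁ , w₂ , p , q with initLast w₁
      ...   | [] = cong (_∨ does (≟-finite Colour-finite (C v) _)) {u (v ∷ʳ b)} {true} (trans (cong u (trans p (Listₚ.++-identityʳ s))) us′)
      ...   | w₀ ∷ʳ′ b′ with Listₚ.∷ʳ-injective v (s ++ w₀) (trans p (sym (Listₚ.++-assoc s w₀ (b′ ∷ []))))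
      ...     | refl , refl = ∨-true (u (v ∷ʳ b)) (dec-true (≟-finite Colour-finite (C v) _)
                (trans (C-on w₀ (trans q (∷ʳ-++ w₀ b w₂)))
                  (cong (Data.Maybe.map (apply (recolouring (T v))))
                    (trans (cong (λ x → colour T x w₂) (sym p′)) (trans (sym (C-on (w₀ ∷ʳ b) q)) (trans (cong C p′) e))))))
        where
        p′ : s ++ w₀ ∷ʳ b ≡ (s ++ w₀) ∷ʳ b
        p′ = sym (Listₚ.++-assoc s w₀ (b ∷ []))
        ∨-true : ∀ a {b} → b ≡ true → a ∨ b ≡ true
        ∨-true true _ = refl
        ∨-true false e = e

      marks : Marks m
      marks = (root-holds (C []) refl , λ v b → edge-holds v b (C (v ∷ʳ b)) refl)
        , (λ v → ⇒⁺ λ uv → dec-true (≟-finite Colour-finite (C v) _)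
            (subst (λ v → C v ≡ required R i (T v)) (sym (us v uv)) (trans C-top cw)))
        , s ++ w , ∧⁺ aw (∧⁺ ew (dec-true (≟-finite Colour-finite (C (s ++ w)) _) (C-on w (sym (Listₚ.++-identityʳ w)))))
        where
        C-top : C s ≡ colour T s w
        C-top = subst (λ v → C v ≡ colour T v w) (Listₚ.++-identityʳ s) (C-on [] refl)

module Recognition (S : Signature) (k : ℕ) where

  open Trees S k

  module Atoms (R : Fin (nRel S)) (ts : Vec FOT (arity S R)) where

    -- The node of the `add` decorator is guessed before the markings, because all arguments of the
    -- atom must share it.
    Guess : (Node → Letter × Bool) → Set
    Guess m = Somewhere proj₂ m × AtMostOnce proj₂ m × Everywhere (λ (l , b) → not b ∨ is-add R (deco l)) m
      × (∀ i → Σ (Node → Colour) λ C → Marking.Marks R (lookup ts i) i (λ s → m s , C s))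

    colour-entity : ∀ T s w {j} → colour T s w ≡ just j → is-entity (T (s ++ w)) ≡ true
    colour-entity T s [] {j} e = subst (λ v → is-entity (T v) ≡ true) (sym (Listₚ.++-identityʳ s)) (own (T s) e)
      where
      own : ∀ d → own-colour d ≡ just j → is-entity d ≡ true
      own (cst _ _) _ = refl
      own (star _) _ = refl
    colour-entity T s (b ∷ w) e with colour T (s ∷ʳ b) w in eq
    ... | just _ = subst (λ v → is-entity (T v) ≡ true) (∷ʳ-++ s b w) (colour-entity T (s ∷ʳ b) w eq)

    guess-sound : ∀ t → (Σ (Node → Bool) λ u → Guess (λ s → t s , u s)) → ⟦ atom R ts ⟧ t
    guess-sound t (u , (s , us) , once , added , marks) = s , ks , d≡ , λ i →
      let w , aw , _ , c = Marking.Sound.reaches R (lookup ts i) i t u s (λ v uv → once v s uv us) us (proj₁ (marks i)) (proj₂ (marks i))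
      in w , aw , trans c (trans (cong (required R i) d≡) (required-add R i ks))
      where
      ks = proj₁ (is-add⁻ R (deco (t s)) (⇒⁻ (added s) us))
      d≡ = proj₂ (is-add⁻ R (deco (t s)) (⇒⁻ (added s) us))

    guess-complete : EM₁ → ∀ t → ⟦ atom R ts ⟧ t → Σ (Node → Bool) λ u → Guess (λ s → t s , u s)
    guess-complete em t (s , ks , d≡ , h) = u , (s , us′) , (λ v v′ e e′ → trans (us v e) (sym (us v′ e′)))
      , (λ v → ⇒⁺ λ e → subst (λ v → is-add R (deco (t v)) ≡ true) (sym (us v e)) (trans (cong (is-add R) d≡) (is-add⁺ R ks)))
      , λ i → let w , aw , c = h i
                  module M = Marking.Complete R (lookup ts i) i em t u s us us′ w aw (colour-entity (deco ∘ t) s w c)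
                    (trans c (sym (trans (cong (required R i) d≡) (required-add R i ks))))
              in M.C , M.marks
      where
      u : Node → Bool
      u v = does (v ≡ˢ? s)
      us : ∀ v → u v ≡ true → v ≡ s
      us v = does⁻ (v ≡ˢ? s)
      us′ : u s ≡ true
      us′ = dec-true (s ≡ˢ? s) refl

    rec-guess : Recognizable Guess
    rec-guess = rec-× (rec-somewhere proj₂) (rec-× (rec-atMostOnce proj₂)
      (rec-× (rec-everywhere (λ (l , b) → not b ∨ is-add R (deco l)))
        (rec-∀Fin _ λ i → rec-∃ Colour-finite nothing (Marking.rec-marks R (lookup ts i) i))))

    rec-atom : Recognizable ⟦ atom R ts ⟧
    rec-atom = rec-⟺ (λ em t → guess-sound t , guess-complete em t) (rec-∃ Bool-finite false rec-guess)

  rec-entities : Recognizable {Letter × Bool} (Everywhere (λ (l , b) → not b ∨ is-entity (deco l)))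
  rec-entities = rec-everywhere (λ (l , b) → not b ∨ is-entity (deco l))

  rec-formula : ∀ φ → Recognizable ⟦ φ ⟧
  rec-formula (atom R ts) = Atoms.rec-atom R ts
  rec-formula (equal (con c) (con c′)) = rec-dec (c ≟ c′)
  rec-formula (equal (con c) (var y)) = rec-somewhere (λ l → at-term (con c) l ∧ at-term (var y) l)
  rec-formula (equal (var x) b) = rec-somewhere (λ l → at-term (var x) l ∧ at-term b l)
  rec-formula (memb a X) = rec-somewhere (λ l → at-term a l ∧ in-set X l)
  rec-formula (neg φ) = rec-¬ (rec-formula φ)
  rec-formula (conj φ ψ) = rec-× (rec-formula φ) (rec-formula ψ)
  rec-formula (ex1 x φ) = rec-∃ Bool-finite false (rec-× rec-entities (rec-× (rec-somewhere proj₂)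
    (rec-× (rec-atMostOnce proj₂) (rec-∘ (set-fo x) {⟦ φ ⟧} (rec-formula φ)))))
  rec-formula (ex2 X φ) = rec-∃ Bool-finite false (rec-× rec-entities (rec-∘ (set-so X) {⟦ φ ⟧} (rec-formula φ)))

  -- Well-decorated trees over a finite alphabet

  is-void : Deco S k → Bool
  is-void void = true
  is-void _ = false

  is-void⁺ : ∀ {d} → d ≡ void → is-void d ≡ true
  is-void⁺ refl = refl

  is-void⁻ : ∀ d → is-void d ≡ true → d ≡ void
  is-void⁻ void _ = refl

  ¬void⁺ : ∀ {d} → d ≢ void → not (is-void d) ≡ true
  ¬void⁺ {d} n = not-true⁺ (n ∘ is-void⁻ d)

  ¬void⁻ : ∀ {d} → not (is-void d) ≡ true → d ≢ void
  ¬void⁻ h refl = true≢false (sym h)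

  -- nothing for leaves, just false for unary and just true for binary decorators
  shape : Deco S k → Maybe Bool
  shape (add _ _) = just false
  shape (recolor _ _) = just false
  shape plus = just true
  shape _ = nothing

  child-ok : Maybe Bool → Bool → Deco S k → Bool
  child-ok nothing _ d = is-void d
  child-ok (just false) false d = not (is-void d)
  child-ok (just false) true d = is-void d
  child-ok (just true) _ d = not (is-void d)

  local⁺ : ∀ d {l r} → child-ok (shape d) false l ≡ true → child-ok (shape d) true r ≡ true → LocalOK d l r
  local⁺ (cst _ _) a b = is-void⁻ _ a , is-void⁻ _ b
  local⁺ (star _) a b = is-void⁻ _ a , is-void⁻ _ b
  local⁺ (add _ _) a b = ¬void⁻ a , is-void⁻ _ b
  local⁺ (recolor _ _) a b = ¬void⁻ a , is-void⁻ _ b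
  local⁺ plus a b = ¬void⁻ a , ¬void⁻ b
  local⁺ void a b = is-void⁻ _ a , is-void⁻ _ b

  local⁻ : ∀ d {l r} → LocalOK d l r → child-ok (shape d) false l ≡ true × child-ok (shape d) true r ≡ true
  local⁻ (cst _ _) (a , b) = is-void⁺ a , is-void⁺ b
  local⁻ (star _) (a , b) = is-void⁺ a , is-void⁺ b
  local⁻ (add _ _) (a , b) = ¬void⁺ a , is-void⁺ b
  local⁻ (recolor _ _) (a , b) = ¬void⁺ a , is-void⁺ b
  local⁻ plus (a , b) = ¬void⁺ a , ¬void⁺ b
  local⁻ void (a , b) = is-void⁺ a , is-void⁺ b

  LocallyOK : Tree S k → Set
  LocallyOK T = ∀ s → LocalOK (T s) (T (s ∷ʳ false)) (T (s ∷ʳ true))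

  rec-local : Recognizable LocallyOK
  rec-local = rec-⟺ (λ _ T → (λ (_ , e) s → local⁺ (T s) (e s false) (e s true))
      , (λ h → refl , λ { s false → proj₁ (local⁻ (T s) (h s)) ; s true → proj₂ (local⁻ (T s) (h s)) }))
    (rec-edges (Maybe-finite Bool-finite) shape (λ _ → true) child-ok)

  ConstantsOnce : ℕ → Tree S k → Set
  ConstantsOnce d T = ∀ (c : Fin d) → AtMostOnce (is-cst (toℕ c)) T

  rec-tree : ∀ d φ → Recognizable {Letter} (λ t → (LocallyOK (deco ∘ t) × ConstantsOnce d (deco ∘ t)) × ⟦ φ ⟧ t)
  rec-tree d φ = rec-× (rec-∘ deco (rec-× rec-local (rec-∀Fin d λ c → rec-atMostOnce (is-cst (toℕ c))))) (rec-formula φ)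

  -- Only the constants below a bound for the given formula need to be kept in the decorations.
  keep : ∀ {P : Set} → Dec P → ℕ → Fin k → Deco S k
  keep (yes _) c j = cst c j
  keep (no _) c j = star j

  keep-yes : ∀ {P : Set} (q : Dec P) {c j} → P → keep q c j ≡ cst c j
  keep-yes (yes _) _ = refl
  keep-yes (no ¬p) p = contradiction p ¬p

  forget : ℕ → Deco S k → Deco S k
  forget d (cst c j) = keep (c <? d) c j
  forget d e = e

  csts : ℕ → List (Deco S k)
  csts d = List.cartesianProductWith cst (List.upTo d) (List.allFin k)

  stars adds recolors : List (Deco S k)
  stars = List.map star (List.allFin k)
  adds = List.concat (List.map adds-of (List.allFin (nRel S)))
    where
    adds-of : Fin (nRel S) → List (Deco S k)
    adds-of R = List.map (add R) (elems (Vec-finite (Fin-finite k) (arity S R)))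
  recolors = List.cartesianProductWith recolor (List.allFin k) (List.allFin k)

  decos : ℕ → List (Deco S k)
  decos d = csts d ++ stars ++ adds ++ recolors ++ plus ∷ void ∷ []

  forget-∈ : ∀ d e → forget d e ∈ decos d
  forget-∈ d (cst c j) = keep-∈ (c <? d)
    where
    keep-∈ : (q : Dec (c < d)) → keep q c j ∈ decos d
    keep-∈ (yes c<d) = ∈-++⁺ˡ (∈-cartesianProductWith⁺ cst (∈-upTo⁺ c<d) (∈-allFin j))
    keep-∈ (no _) = ∈-++⁺ʳ (csts d) (∈-++⁺ˡ (∈-map⁺ star (∈-allFin j)))
  forget-∈ d (star j) = ∈-++⁺ʳ (csts d) (∈-++⁺ˡ (∈-map⁺ star (∈-allFin j)))
  forget-∈ d (add R ks) = ∈-++⁺ʳ (csts d) (∈-++⁺ʳ stars (∈-++⁺ˡ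
    (∈-concat⁺′ (∈-map⁺ (add R) (complete (Vec-finite (Fin-finite k) (arity S R)) ks)) (∈-map⁺ _ (∈-allFin R)))))
  forget-∈ d (recolor a b) = ∈-++⁺ʳ (csts d) (∈-++⁺ʳ stars (∈-++⁺ʳ adds
    (∈-++⁺ˡ (∈-cartesianProductWith⁺ recolor (∈-allFin a) (∈-allFin b)))))
  forget-∈ d plus = ∈-++⁺ʳ (csts d) (∈-++⁺ʳ stars (∈-++⁺ʳ adds (∈-++⁺ʳ recolors (here refl))))
  forget-∈ d void = ∈-++⁺ʳ (csts d) (∈-++⁺ʳ stars (∈-++⁺ʳ adds (∈-++⁺ʳ recolors (there (here refl)))))

  forget-forget : ∀ d e → forget d (forget d e) ≡ forget d e
  forget-forget d (cst c j) = forget-keep (c <? d)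
    where
    forget-keep : (q : Dec (c < d)) → forget d (keep q c j) ≡ keep q c j
    forget-keep (yes c<d) = keep-yes (c <? d) c<d
    forget-keep (no _) = refl
  forget-forget d (star j) = refl
  forget-forget d (add R ks) = refl
  forget-forget d (recolor a b) = refl
  forget-forget d plus = refl
  forget-forget d void = refl

  Index : ℕ → Set
  Index d = Fin (length (decos d))

  index-of : ∀ d → Deco S k → Index d
  index-of d e = index (forget-∈ d e)

  -- Applying `forget` once more shows that all constants are below `d` without any argument about
  -- the members of the list.
  deco-at : ∀ d → Index d → Deco S k
  deco-at d i = forget d (List.lookup (decos d) i)

  deco-at-index : ∀ d e → deco-at d (index-of d e) ≡ forget d e
  deco-at-index d e = trans (cong (forget d) (sym (lookup-index (forget-∈ d e)))) (forget-forget d e)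

  letter-at : ∀ d → Index d → Letter
  letter-at d i = deco-at d i , (λ _ → false) , (λ _ → false)

  Model : (d : ℕ) → Formula S → (Node → Index d) → Set
  Model d φ t = (LocallyOK (deco-at d ∘ t) × ConstantsOnce d (deco-at d ∘ t)) × ⟦ φ ⟧ (letter-at d ∘ t)

  rec-model : ∀ d φ → Recognizable (Model d φ)
  rec-model d φ = rec-∘ (letter-at d) (rec-tree d φ)

  abstract
    has-model : ℕ → Formula S → Bool
    has-model d φ = Emptiness.nonempty (Fin-finite _) (index-of d void) (automaton (rec-model d φ))

    has-model-correct : EM₁ → ∀ d φ → (has-model d φ ≡ true) ⟺ ∃ (Model d φ)
    has-model-correct em d φ =
      (λ h → let t , a = Emptiness.nonempty-sound (Fin-finite _) (index-of d void) (automaton (rec-model d φ)) em h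
             in t , proj₁ (correct (rec-model d φ) em t) a)
      , (λ (t , h) → Emptiness.nonempty-complete (Fin-finite _) (index-of d void) (automaton (rec-model d φ)) em
             (t , proj₂ (correct (rec-model d φ) em t) h))

-- Instances and trees

module Semantics (S : Signature) (k : ℕ) where

  open Trees S k
  open Recognition S k

  TreeAtom : Tree S k → (R : Fin (nRel S)) → (Fin (arity S R) → Node) → Set
  TreeAtom T R f = ∃ λ s → ∃ λ ks → T s ≡ add R ks × (∀ i → ∃ λ w → f i ≡ s ++ w × colour T s w ≡ just (lookup ks i))

  -- What the evaluation of formulas needs to know of an isomorphism. Only constants below `d` must
  -- be visible in the tree, so a tree whose other constants were forgotten still matches the
  -- original instance.
  record Match (d : ℕ) (I : Instance S) (T : Tree S k) (g : Term → Node) : Set where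
    field
      entity    : ∀ {t} → Adom I t → is-entity (T (g t)) ≡ true
      injective : ∀ {t u} → Adom I t → Adom I u → g t ≡ g u → t ≡ u
      covered   : ∀ s → is-entity (T s) ≡ true → ∃ λ t → Adom I t × g t ≡ s
      constant⁺ : ∀ {c} → c < d → Adom I (const c) → is-cst c (T (g (const c))) ≡ true
      constant⁻ : ∀ {t c} → Adom I t → is-cst c (T (g t)) ≡ true → t ≡ const c
      atom⁺     : ∀ R ts → I (rel R ts) → TreeAtom T R (g ∘ lookup ts)
      atom⁻     : ∀ R ts → (∀ i → Adom I (lookup ts i)) → TreeAtom T R (g ∘ lookup ts) → I (rel R ts)

  term-bound : FOT → ℕ
  term-bound (var _) = 0
  term-bound (con c) = suc c

  terms-bound : ∀ {n} → Vec FOT n → ℕ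
  terms-bound [] = 0
  terms-bound (a ∷ ts) = term-bound a + terms-bound ts

  constant-bound : Formula S → ℕ
  constant-bound (atom R ts) = terms-bound ts
  constant-bound (equal a b) = term-bound a + term-bound b
  constant-bound (memb a X) = term-bound a
  constant-bound (neg φ) = constant-bound φ
  constant-bound (conj φ ψ) = constant-bound φ + constant-bound ψ
  constant-bound (ex1 x φ) = constant-bound φ
  constant-bound (ex2 X φ) = constant-bound φ

  lookup-bound : ∀ {n} (ts : Vec FOT n) i → term-bound (lookup ts i) ≤ terms-bound ts
  lookup-bound (a ∷ ts) zero = m≤m+n _ _
  lookup-bound (a ∷ ts) (suc i) = ≤-trans (lookup-bound ts i) (m≤n+m _ _)

  is-cst⇒entity : ∀ c e → is-cst c e ≡ true → is-entity e ≡ true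
  is-cst⇒entity c (cst _ _) _ = refl

  module Transfer (em : EM₁) {d I T g} (M : Match d I T g) where

    open Match M
    open Classical em

    -- Values are confined to the active domain because only its elements have a node in the tree.
    record Env (xs Xs : List ℕ) (ν : ℕ → Term) (μ : ℕ → Term → Set) (fo so : Node → ℕ → Bool) : Set where
      field
        fo-adom : ∀ {x} → x ∈ xs → Adom I (ν x)
        fo-here : ∀ {x} → x ∈ xs → fo (g (ν x)) x ≡ true
        fo-only : ∀ {x s} → x ∈ xs → fo s x ≡ true → s ≡ g (ν x)
        so-adom : ∀ {X t} → X ∈ Xs → μ X t → Adom I t
        so-set  : ∀ {X t} → X ∈ Xs → Adom I t → μ X t ⟺ (so (g t) X ≡ true)

    open Env

    tree : (fo so : Node → ℕ → Bool) → Node → Letter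
    tree fo so s = T s , fo s , so s

    module _ {xs Xs ν μ fo so} (env : Env xs Xs ν μ fo so) where

      at-term⁺ : ∀ a → ScopedT xs a → term-bound a ≤ d → Adom I (evalT ν a) →
        at-term a (tree fo so (g (evalT ν a))) ≡ true
      at-term⁺ (var x) x∈ _ _ = fo-here env x∈
      at-term⁺ (con c) _ c<d a = constant⁺ c<d a

      at-term⁻ : ∀ a {s} → ScopedT xs a → at-term a (tree fo so s) ≡ true → Adom I (evalT ν a) × s ≡ g (evalT ν a)
      at-term⁻ (var x) x∈ h = fo-adom env x∈ , fo-only env x∈ h
      at-term⁻ (con c) {s} _ h with covered s (is-cst⇒entity c (T s) h)
      ... | t , a , refl with constant⁻ a h
      ...   | refl = a , refl

      extend-fo : ∀ x t (u : Node → Bool) → Adom I t → u (g t) ≡ true → (∀ s → u s ≡ true → s ≡ g t) →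
        Env (x ∷ xs) Xs (updateT ν x t) μ (λ s → set (fo s) x (u s)) so
      extend-fo x t u a here! only = record
        { fo-adom = adom ; fo-here = at ; fo-only = unique ; so-adom = so-adom env ; so-set = so-set env }
        where
        old : ∀ {y} → x ≢ y → y ∈ x ∷ xs → y ∈ xs
        old n (here refl) = contradiction refl n
        old n (there p) = p
        adom : ∀ {y} → y ∈ x ∷ xs → Adom I (updateT ν x t y)
        adom {y} p with x ≟ y
        ... | yes _ = a
        ... | no n = fo-adom env (old n p)
        at : ∀ {y} → y ∈ x ∷ xs → set (fo (g (updateT ν x t y))) x (u (g (updateT ν x t y))) y ≡ true
        at {y} p with x ≟ y
        ... | yes _ = here!
        ... | no n = fo-here env (old n p)
        unique : ∀ {y s} → y ∈ x ∷ xs → set (fo s) x (u s) y ≡ true → s ≡ g (updateT ν x t y)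
        unique {y} {s} p h with x ≟ y
        ... | yes _ = only s h
        ... | no n = fo-only env (old n p) h

      extend-so : ∀ X P (u : Node → Bool) → (∀ {t} → P t → Adom I t) → (∀ {t} → Adom I t → P t ⟺ (u (g t) ≡ true)) →
        Env xs (X ∷ Xs) ν (update μ X P) fo (λ s → set (so s) X (u s))
      extend-so X P u sub eqv = record
        { fo-adom = fo-adom env ; fo-here = fo-here env ; fo-only = fo-only env ; so-adom = adom ; so-set = sets }
        where
        old : ∀ {Y} → X ≢ Y → Y ∈ X ∷ Xs → Y ∈ Xs
        old n (here refl) = contradiction refl n
        old n (there p) = p
        adom : ∀ {Y t} → Y ∈ X ∷ Xs → update μ X P Y t → Adom I t
        adom {Y} p h with X ≟ Y
        ... | yes _ = sub h
        ... | no n = so-adom env (old n p) h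
        sets : ∀ {Y t} → Y ∈ X ∷ Xs → Adom I t → update μ X P Y t ⟺ (set (so (g t)) X (u (g t)) Y ≡ true)
        sets {Y} p a with X ≟ Y
        ... | yes _ = eqv a
        ... | no n = so-set env (old n p) a

      meet⁺ : ∀ a b → ScopedT xs a → ScopedT xs b → term-bound a + term-bound b ≤ d → Adom I (evalT ν a) →
        evalT ν a ≡ evalT ν b → Somewhere (λ l → at-term a l ∧ at-term b l) (tree fo so)
      meet⁺ a b sa sb bd ad e = g (evalT ν a) , ∧⁺ (at-term⁺ a sa (≤-trans (m≤m+n _ _) bd) ad)
        (subst (λ t → at-term b (tree fo so (g t)) ≡ true) (sym e)
          (at-term⁺ b sb (≤-trans (m≤n+m _ _) bd) (subst (Adom I) e ad)))

      meet⁻ : ∀ a b → ScopedT xs a → ScopedT xs b → Somewhere (λ l → at-term a l ∧ at-term b l) (tree fo so) →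
        evalT ν a ≡ evalT ν b
      meet⁻ a b sa sb (s , h) = let ha , hb = ∧⁻ {at-term a (tree fo so s)} h
                                    aa , ea = at-term⁻ a sa ha
                                    ab , eb = at-term⁻ b sb hb
                                in injective aa ab (trans (sym ea) eb)

    transfer : ∀ {xs Xs ν μ fo so} → Env xs Xs ν μ fo so → ∀ φ → Scoped xs Xs φ → constant-bound φ ≤ d →
      Sat I ν μ φ ⟺ ⟦ φ ⟧ (tree fo so)
    transfer {ν = ν} {fo = fo} {so} env (atom R ts) sc bd = to , from
      where
      args : ∀ i → lookup (Vec.map (evalT ν) ts) i ≡ evalT ν (lookup ts i)
      args i = Vecₚ.lookup-map i (evalT ν) ts
      to : Lift (lsuc 0ℓ) (I (rel R (Vec.map (evalT ν) ts))) → ⟦ atom R ts ⟧ (tree fo so)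
      to (lift r) = let s , ks , e , h = atom⁺ R _ r in s , ks , e , λ i →
        let w , p , c = h i
            q = trans (sym p) (cong g (args i))
        in w , subst (λ v → at-term (lookup ts i) (tree fo so v) ≡ true) (sym q)
                 (at-term⁺ env (lookup ts i) (sc i) (≤-trans (lookup-bound ts i) bd) (inj₁ (R , _ , r , i , args i))) , c
      from : ⟦ atom R ts ⟧ (tree fo so) → Lift (lsuc 0ℓ) (I (rel R (Vec.map (evalT ν) ts)))
      from (s , ks , e , h) = lift (atom⁻ R _
        (λ i → subst (Adom I) (sym (args i)) (proj₁ (at-term⁻ env (lookup ts i) (sc i) (proj₁ (proj₂ (h i))))))
        (s , ks , e , λ i → let w , a , c = h i in
          w , trans (cong g (args i)) (sym (proj₂ (at-term⁻ env (lookup ts i) (sc i) a))) , c))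
    transfer env (equal (con c) (con c′)) _ _ = (λ { (lift refl) → refl }) , (λ { refl → lift refl })
    transfer env (equal (con c) (var y)) (sa , sb) bd =
      (λ { (lift e) → meet⁺ env (con c) (var y) sa sb bd (subst (Adom I) (sym e) (fo-adom env sb)) e })
      , (λ h → lift (meet⁻ env (con c) (var y) sa sb h))
    transfer env (equal (var x) b) (sa , sb) bd =
      (λ { (lift e) → meet⁺ env (var x) b sa sb bd (fo-adom env sa) e })
      , (λ h → lift (meet⁻ env (var x) b sa sb h))
    transfer {ν = ν} {fo = fo} {so} env (memb a X) (sa , X∈) bd =
      (λ { (lift m) → let ad = so-adom env X∈ m in
           g (evalT ν a) , ∧⁺ (at-term⁺ env a sa bd ad) (proj₁ (so-set env X∈ ad) m) })
      , (λ (s , h) → let ha , hX = ∧⁻ {at-term a (tree fo so s)} h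
                         ad , e = at-term⁻ env a sa ha
                     in lift (proj₂ (so-set env X∈ ad) (subst (λ s → so s X ≡ true) e hX)))
    transfer env (neg φ) sc bd = let f , f⁻ = transfer env φ sc bd in (λ n h → n (f⁻ h)) , (λ n h → n (f h))
    transfer env (conj φ ψ) (sφ , sψ) bd =
      let f , f⁻ = transfer env φ sφ (≤-trans (m≤m+n _ _) bd)
          h , h⁻ = transfer env ψ sψ (≤-trans (m≤n+m _ _) bd)
      in (λ (a , b) → f a , h b) , (λ (a , b) → f⁻ a , h⁻ b)
    transfer {xs} {Xs} {ν} {μ} {fo} {so} env (ex1 x φ) sc bd = to , from
      where
      to : Sat I ν μ (ex1 x φ) → ⟦ ex1 x φ ⟧ (tree fo so)
      to (t , lift a , h) = u , (λ s → ⇒⁺ λ e → subst (λ v → is-entity (T v) ≡ true) (sym (only s e)) (entity a))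
        , (g t , at) , (λ s s′ e e′ → trans (only s e) (sym (only s′ e′)))
        , proj₁ (transfer (extend-fo env x t u a at only) φ sc bd) h
        where
        u : Node → Bool
        u s = does (s ≡ˢ? g t)
        only : ∀ s → u s ≡ true → s ≡ g t
        only s = does⁻ (s ≡ˢ? g t)
        at : u (g t) ≡ true
        at = dec-true (g t ≡ˢ? g t) refl
      from : ⟦ ex1 x φ ⟧ (tree fo so) → Sat I ν μ (ex1 x φ)
      from (u , ent , (s , us) , once , h) with covered s (⇒⁻ (ent s) us)
      ... | t , a , refl = t , lift a , proj₂ (transfer (extend-fo env x t u a us (λ v e → once v (g t) e us)) φ sc bd) h
    transfer {xs} {Xs} {ν} {μ} {fo} {so} env (ex2 X φ) sc bd = to , from
      where
      to : Sat I ν μ (ex2 X φ) → ⟦ ex2 X φ ⟧ (tree fo so)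
      to (P , lift sub , h) = u
        , (λ s → ⇒⁺ λ e → let t , p , q = does⁻ (lem (member s)) e in subst (λ v → is-entity (T v) ≡ true) q (entity (sub t p)))
        , proj₁ (transfer (extend-so env X P u (sub _) eqv) φ sc bd) h
        where
        member : Node → Set
        member s = ∃ λ t → P t × g t ≡ s
        -- A set of nodes is a Boolean labelling, so excluded middle has to decide the given
        -- predicate.
        u : Node → Bool
        u s = does (lem (member s))
        eqv : ∀ {t} → Adom I t → P t ⟺ (u (g t) ≡ true)
        eqv {t} a = (λ p → dec-true (lem (member (g t))) (t , p , refl))
          , (λ e → let t′ , p , q = does⁻ (lem (member (g t))) e in subst P (injective (sub t′ p) a q) p)
      from : ⟦ ex2 X φ ⟧ (tree fo so) → Sat I ν μ (ex2 X φ)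
      from (u , ent , h) = P , lift (λ _ → proj₁) , proj₂ (transfer (extend-so env X P u proj₁ eqv) φ sc bd) h
        where
        P : Term → Set
        P t = Adom I t × u (g t) ≡ true
        eqv : ∀ {t} → Adom I t → P t ⟺ (u (g t) ≡ true)
        eqv a = proj₂ , (a ,_)

  is-cst-forget⁻ : ∀ d c e → is-cst c (forget d e) ≡ true → ∃ λ j → e ≡ cst c j
  is-cst-forget⁻ d c (cst c′ j) h = kept (c′ <? d) h
    where
    kept : (q : Dec (c′ < d)) → is-cst c (keep q c′ j) ≡ true → ∃ λ i → cst {S} c′ j ≡ cst c i
    kept (yes _) h = j , cong (λ a → cst a j) (sym (does⁻ (c ≟ c′) h))

  is-cst-forget⁺ : ∀ {d c} → c < d → ∀ j → is-cst c (forget d (cst c j)) ≡ true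
  is-cst-forget⁺ {d} {c} c<d j = trans (cong (is-cst c) (keep-yes (c <? d) c<d)) (dec-true (c ≟ c) refl)

  is-entity-forget : ∀ d e → is-entity (forget d e) ≡ is-entity e
  is-entity-forget d (cst c j) with c <? d
  ... | yes _ = refl
  ... | no _ = refl
  is-entity-forget d (star j) = refl
  is-entity-forget d (add R ks) = refl
  is-entity-forget d (recolor a b) = refl
  is-entity-forget d plus = refl
  is-entity-forget d void = refl

  own-colour-forget : ∀ d e → own-colour (forget d e) ≡ own-colour e
  own-colour-forget d (cst c j) with c <? d
  ... | yes _ = refl
  ... | no _ = refl
  own-colour-forget d (star j) = refl
  own-colour-forget d (add R ks) = refl
  own-colour-forget d (recolor a b) = refl
  own-colour-forget d plus = refl
  own-colour-forget d void = refl

  recolouring-forget : ∀ d e → recolouring (forget d e) ≡ recolouring e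
  recolouring-forget d (cst c j) with c <? d
  ... | yes _ = refl
  ... | no _ = refl
  recolouring-forget d (star j) = refl
  recolouring-forget d (add R ks) = refl
  recolouring-forget d (recolor a b) = refl
  recolouring-forget d plus = refl
  recolouring-forget d void = refl

  forget-add : ∀ d e {R ks} → forget d e ≡ add R ks → e ≡ add R ks
  forget-add d (cst c j) h with c <? d
  forget-add d (cst c j) () | yes _
  forget-add d (cst c j) () | no _
  forget-add d (add R ks) h = h

  module Entities (em : EM₁) (Cnst : List ℕ) (T : Tree S k) (wd : WellDecorated Cnst T) where

    open Classical em

    Loc : Ent → Node → Set
    Loc (node u) v = u ≡ v × ∃ λ j → T v ≡ star j
    Loc (cnst c) v = ∃ λ j → T v ≡ cst c j

    Loc-unique : ∀ e {v v′} → Loc e v → Loc e v′ → v ≡ v′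
    Loc-unique (node u) (refl , _) (refl , _) = refl
    Loc-unique (cnst c) (j , p) (j′ , p′) = proj₂ (proj₂ wd) _ _ c j j′ p p′

    Loc-entity : ∀ e e′ {v} → Loc e v → Loc e′ v → e ≡ e′
    Loc-entity (node u) (node u′) (refl , _) (refl , _) = refl
    Loc-entity (node u) (cnst c) (_ , _ , p) (_ , q) with trans (sym p) q
    ... | ()
    Loc-entity (cnst c) (node u) (_ , p) (_ , _ , q) with trans (sym p) q
    ... | ()
    Loc-entity (cnst c) (cnst c′) (_ , p) (_ , q) with trans (sym p) q
    ... | refl = refl

    Loc⇒entity : ∀ e {v} → Loc e v → is-entity (T v) ≡ true
    Loc⇒entity (node u) (_ , _ , p) = cong is-entity p
    Loc⇒entity (cnst c) (_ , p) = cong is-entity p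

    InEnt⇒Loc : ∀ {s} e → InEnt T s e → ∃ λ w → Loc e (s ++ w)
    InEnt⇒Loc (node u) (w , e , j , p) = w , e , j , trans (cong T (sym e)) p
    InEnt⇒Loc (cnst c) (w , j , p) = w , j , p

    Loc⇒InEnt : ∀ {s} e w → Loc e (s ++ w) → InEnt T s e
    Loc⇒InEnt (node u) w (e , j , p) = w , e , j , trans (cong T e) p
    Loc⇒InEnt (cnst c) w (j , p) = w , j , p

    Located : Ent → Set
    Located e = ∃ (Loc e)

    choose : ∀ {e} → Dec (Located e) → Node
    choose (yes (v , _)) = v
    choose (no _) = []

    locate : Ent → Node
    locate e = choose (lem (Located e))

    locate-Loc : ∀ e → Located e → Loc e (locate e)
    locate-Loc e l = go (lem (Located e))
      where
      go : (q : Dec (Located e)) → Loc e (choose q)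
      go (yes (_ , h)) = h
      go (no n) = contradiction l n

    locate-≡ : ∀ e {v} → Loc e v → locate e ≡ v
    locate-≡ e l = Loc-unique e (locate-Loc e (_ , l)) l

    void-below : ∀ s w → T s ≡ void → T (s ++ w) ≡ void
    void-below s [] e = trans (cong T (Listₚ.++-identityʳ s)) e
    void-below s (b ∷ w) e = trans (cong T (sym (∷ʳ-++ s b w))) (void-below (s ∷ʳ b) w (child b))
      where
      ok : LocalOK void (T (s ∷ʳ false)) (T (s ∷ʳ true))
      ok = subst (λ x → LocalOK {S} {k} x (T (s ∷ʳ false)) (T (s ∷ʳ true))) e (proj₁ wd s)
      child : ∀ b → T (s ∷ʳ b) ≡ void
      child false = proj₁ ok
      child true = proj₂ ok

    apply-≡ : ∀ a b → apply (just (a , b)) a ≡ b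
    apply-≡ a b with a Finₚ.≟ a
    ... | yes _ = refl
    ... | no n = contradiction refl n

    apply-≢ : ∀ {a b j} → j ≢ a → apply (just (a , b)) j ≡ j
    apply-≢ {a} {b} {j} n with j Finₚ.≟ a
    ... | yes e = contradiction e n
    ... | no _ = refl

    Coloured : Node → Ent → Fin k → Set
    Coloured s e j = ∃ λ w → Loc e (s ++ w) × colour T s w ≡ just j

    coloured-self : ∀ {s} e {j} → Loc e s → own-colour (T s) ≡ just j → Coloured s e j
    coloured-self {s} e l o = [] , subst (Loc e) (sym (Listₚ.++-identityʳ s)) l , o

    coloured-child : ∀ {s} b e {j r} → recolouring (T s) ≡ r → Coloured (s ∷ʳ b) e j → Coloured s e (apply r j)
    coloured-child {s} b e p (w , l , c) = b ∷ w , subst (Loc e) (∷ʳ-++ s b w) l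
      , trans (cong (Data.Maybe.map (apply (recolouring (T s)))) c) (cong (λ r → just (apply r _)) p)

    Col⇒Coloured : ∀ {s e j} → Col T s e j → Coloured s e j
    Col⇒Coloured (col-cst p) = coloured-self (cnst _) (_ , p) (cong own-colour p)
    Col⇒Coloured (col-star p) = coloured-self (node _) (refl , _ , p) (cong own-colour p)
    Col⇒Coloured {s} {e} (col-rec≡ {a = a} {b} p c) =
      subst (Coloured s e) (apply-≡ a b) (coloured-child false e (cong recolouring p) (Col⇒Coloured c))
    Col⇒Coloured {s} {e} (col-rec≢ {a = a} {b} p c n) =
      subst (Coloured s e) (apply-≢ n) (coloured-child false e (cong recolouring p) (Col⇒Coloured c))
    Col⇒Coloured {e = e} (col-add p c) = coloured-child false e (cong recolouring p) (Col⇒Coloured c)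
    Col⇒Coloured {e = e} (col-plus b p _ c) = coloured-child b e (cong recolouring p) (Col⇒Coloured c)

    -- `colour` follows any path, whereas `Col` descends only where the decorators allow it. The two
    -- agree because the child on the way to an entity is not void: hence `s` is not a leaf, and
    -- below a unary decorator the path goes left.
    Colour⇒Col : ∀ e s w {j} → Loc e (s ++ w) → colour T s w ≡ just j → Col T s e j
    Colour⇒Col e s [] l c = self e (subst (Loc e) (Listₚ.++-identityʳ s) l) c
      where
      self : ∀ e {j} → Loc e s → own-colour (T s) ≡ just j → Col T s e j
      self (node u) (refl , j , p) c with trans (sym (cong own-colour p)) c
      ... | refl = col-star p
      self (cnst x) (j , p) c with trans (sym (cong own-colour p)) c
      ... | refl = col-cst p
    Colour⇒Col e s (b ∷ w) {j} l c with colour T (s ∷ʳ b) w in eq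
    ... | just c′ = step (T s) refl (Colour⇒Col e (s ∷ʳ b) w l′ eq) c
      where
      l′ : Loc e ((s ∷ʳ b) ++ w)
      l′ = subst (Loc e) (sym (∷ʳ-++ s b w)) l
      nonvoid : T (s ∷ʳ b) ≢ void
      nonvoid v = true≢false (trans (sym (Loc⇒entity e l′)) (cong is-entity (void-below (s ∷ʳ b) w v)))
      ok : ∀ {d} → T s ≡ d → LocalOK d (T (s ∷ʳ false)) (T (s ∷ʳ true))
      ok p = subst (λ x → LocalOK x (T (s ∷ʳ false)) (T (s ∷ʳ true))) p (proj₁ wd s)
      leaf : T (s ∷ʳ false) ≡ void → T (s ∷ʳ true) ≡ void → ⊥
      leaf p q = nonvoid (child b)
        where
        child : ∀ x → T (s ∷ʳ x) ≡ void
        child false = p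
        child true = q
      left : T (s ∷ʳ true) ≡ void → b ≡ false
      left q = go b refl
        where
        go : ∀ x → x ≡ b → b ≡ false
        go false e = sym e
        go true e = contradiction (subst (λ x → T (s ∷ʳ x) ≡ void) e q) nonvoid
      move : Col T (s ∷ʳ b) e c′ → b ≡ false → Col T (s ∷ʳ false) e c′
      move h refl = h
      step : ∀ d → T s ≡ d → Col T (s ∷ʳ b) e c′ → just (apply (recolouring (T s)) c′) ≡ just j → Col T s e j
      step (cst _ _) p _ _ = ⊥-elim (leaf (proj₁ (ok p)) (proj₂ (ok p)))
      step (star _) p _ _ = ⊥-elim (leaf (proj₁ (ok p)) (proj₂ (ok p)))
      step void p _ _ = ⊥-elim (leaf (proj₁ (ok p)) (proj₂ (ok p)))
      step (add R ks) p h q with trans (sym (cong (λ x → just (apply (recolouring x) c′)) p)) q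
      ... | refl = col-add p (move h (left (proj₂ (ok p))))
      step plus p h q with trans (sym (cong (λ x → just (apply (recolouring x) c′)) p)) q
      ... | refl = col-plus b p (Loc⇒InEnt e w l′) h
      step (recolor x y) p h q with c′ Finₚ.≟ x
      ... | yes refl with trans (sym (trans (cong (λ z → just (apply (recolouring z) c′)) p) (cong just (apply-≡ c′ y)))) q
      ...   | refl = col-rec≡ p (move h (left (proj₂ (ok p))))
      step (recolor x y) p h q | no n with trans (sym (trans (cong (λ z → just (apply (recolouring z) c′)) p) (cong just (apply-≢ n)))) q
      ...   | refl = col-rec≢ p (move h (left (proj₂ (ok p)))) n

    Col-functional : ∀ {s e j j′} → Col T s e j → Col T s e j′ → j ≡ j′
    Col-functional {s} {e} c c′ with Col⇒Coloured c | Col⇒Coloured c′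
    ... | w , l , p | w′ , l′ , p′ with Listₚ.++-cancelˡ s w w′ (Loc-unique e l l′)
    ...   | refl with trans (sym p) p′
    ...     | refl = refl

    module _ {I λc lab} (iso : IsoRep I λc lab T) (d : ℕ) (T° : Tree S k) (T°≡ : ∀ s → T° s ≡ forget d (T s)) where

      f = proj₁ iso
      f-ent = proj₁ (proj₂ iso)
      f-injective = proj₁ (proj₂ (proj₂ iso))
      f-surjective = proj₁ (proj₂ (proj₂ (proj₂ iso)))
      f-constant = proj₁ (proj₂ (proj₂ (proj₂ (proj₂ iso))))
      f-atoms = proj₁ (proj₂ (proj₂ (proj₂ (proj₂ (proj₂ iso)))))

      g : Term → Node
      g t = locate (f t)

      g-Loc : ∀ {t} → Adom I t → Loc (f t) (g t)
      g-Loc {t} a = locate-Loc (f t) (InEnt⇒Loc {[]} (f t) (f-ent t a))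

      entity° : ∀ s → is-entity (T° s) ≡ is-entity (T s)
      entity° s = trans (cong is-entity (T°≡ s)) (is-entity-forget d (T s))

      colour° : ∀ s w → colour T° s w ≡ colour T s w
      colour° s [] = trans (cong own-colour (T°≡ s)) (own-colour-forget d (T s))
      colour° s (b ∷ w) = cong₂ (λ r c → Data.Maybe.map (apply r) c)
        (trans (cong recolouring (T°≡ s)) (recolouring-forget d (T s))) (colour° (s ∷ʳ b) w)

      entity-at : ∀ s → is-entity (T s) ≡ true → ∃ λ e → Loc e s
      entity-at s h = go (T s) refl h
        where
        go : ∀ x → T s ≡ x → is-entity x ≡ true → ∃ λ e → Loc e s
        go (cst c j) p _ = cnst c , j , p
        go (star j) p _ = node s , refl , j , p

      -- Forgetting constants changes neither entities nor colours nor recolourings nor `add` nodes.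
      -- Since isomorphisms fix constants, `T°` itself need not represent `I`, but it still matches
      -- it.
      match : Match d I T° g
      match = record
        { entity = λ {t} a → trans (entity° (g t)) (Loc⇒entity (f t) (g-Loc a))
        ; injective = λ {t} {u} a b e → f-injective t u a b
            (Loc-entity (f t) (f u) (g-Loc a) (subst (Loc (f u)) (sym e) (g-Loc b)))
        ; covered = covered
        ; constant⁺ = constant⁺
        ; constant⁻ = constant⁻
        ; atom⁺ = atom⁺
        ; atom⁻ = atom⁻ }
        where
        covered : ∀ s → is-entity (T° s) ≡ true → ∃ λ t → Adom I t × g t ≡ s
        covered s h with entity-at s (trans (sym (entity° s)) h)
        ... | e , l with f-surjective e (Loc⇒InEnt {[]} e s l)
        ...   | t , a , refl = t , a , locate-≡ (f t) l
        constant⁺ : ∀ {c} → c < d → Adom I (const c) → is-cst c (T° (g (const c))) ≡ true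
        constant⁺ {c} c<d a with subst (λ e → Loc e (g (const c))) (proj₁ (f-constant (const c) c a) refl) (g-Loc a)
        ... | j , p = trans (cong (is-cst c) (trans (T°≡ (g (const c))) (cong (forget d) p))) (is-cst-forget⁺ c<d j)
        constant⁻ : ∀ {t c} → Adom I t → is-cst c (T° (g t)) ≡ true → t ≡ const c
        constant⁻ {t} {c} a h = proj₂ (f-constant t c a)
          (Loc-entity (f t) (cnst c) (g-Loc a) (is-cst-forget⁻ d c (T (g t)) (trans (cong (is-cst c) (sym (T°≡ (g t)))) h)))
        atom⁺ : ∀ R ts → I (rel R ts) → TreeAtom T° R (g ∘ lookup ts)
        atom⁺ R ts r with proj₁ (f-atoms R ts (λ i → inj₁ (R , ts , r , i , refl))) r
        ... | s , ks , p , h = s , ks , trans (T°≡ s) (cong (forget d) p) , λ i →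
          let w , l , c = Col⇒Coloured (subst (λ e → Col T s e (lookup ks i)) (Vecₚ.lookup-map i f ts) (proj₂ (h i)))
          in w , locate-≡ (f (lookup ts i)) l , trans (colour° s w) c
        atom⁻ : ∀ R ts → (∀ i → Adom I (lookup ts i)) → TreeAtom T° R (g ∘ lookup ts) → I (rel R ts)
        atom⁻ R ts a (s , ks , p , h) = proj₂ (f-atoms R ts a)
          (s , ks , forget-add d (T s) (trans (sym (T°≡ s)) p) , λ i →
            let w , q , c = h i
                l = subst (Loc (f (lookup ts i))) q (g-Loc (a i))
            in subst (λ e → InEnt T s e × Col T s e (lookup ks i)) (sym (Vecₚ.lookup-map i f ts))
                 (Loc⇒InEnt (f (lookup ts i)) w l , Colour⇒Col (f (lookup ts i)) s w l (trans (sym (colour° s w)) c)))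
  -- The instance represented by a tree: constants denote themselves, and nulls are numbers of nodes.
  module Represented (em : EM₁) (Cnst : List ℕ) (T : Tree S k) (wd : WellDecorated Cnst T) where

    open Entities em Cnst T wd
    open Classical em

    Numbers : ℕ → Set
    Numbers n = ∃ λ u → number u ≡ n

    numbered : ∀ {n} → Dec (Numbers n) → Node
    numbered (yes (u , _)) = u
    numbered (no _) = []

    node-of : ℕ → Node
    node-of n = numbered (lem (Numbers n))

    node-of-number : ∀ u → node-of (number u) ≡ u
    node-of-number u = go (lem (Numbers (number u)))
      where
      go : (q : Dec (Numbers (number u))) → numbered q ≡ u
      go (yes (_ , e)) = number-injective e
      go (no n) = contradiction (u , refl) n

    ent : Term → Ent
    ent (const c) = cnst c
    ent (null n) = node (node-of n)

    -- On nulls this says that `node-of` is inverted by `number`, which makes `ent` injective.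
    Proper : Term → Set
    Proper (const c) = ⊤
    Proper (null n) = number (node-of n) ≡ n

    ent-injective : ∀ t u → Proper t → Proper u → ent t ≡ ent u → t ≡ u
    ent-injective (const _) (const _) _ _ refl = refl
    ent-injective (null m) (null n) p q e = cong null (trans (sym p) (trans (cong number (node-≡ e)) q))
      where
      node-≡ : ∀ {u v} → node u ≡ node v → u ≡ v
      node-≡ refl = refl

    Present : Term → Set
    Present t = Proper t × InEnt T [] (ent t)

    I : Instance S
    I (rel R ts) = (∀ i → Present (lookup ts i)) × RepAtom T R (Vec.map ent ts)
    I (top t) = Present t

    adom⁻ : ∀ {t} → Adom I t → Present t
    adom⁻ (inj₁ (R , ts , (p , _) , i , refl)) = p i
    adom⁻ (inj₂ p) = p

    colour-of : ∀ {t} → Dec (∃ (Col T [] (ent t))) → ℕ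
    colour-of (yes (j , _)) = toℕ j
    colour-of (no _) = 0

    λc : Term → ℕ
    λc t = colour-of (lem (∃ (Col T [] (ent t))))

    λc-Col : ∀ t j → Col T [] (ent t) j → λc t ≡ toℕ j
    λc-Col t j c = go (lem (∃ (Col T [] (ent t))))
      where
      go : (q : Dec (∃ (Col T [] (ent t)))) → colour-of q ≡ toℕ j
      go (yes (_ , c′)) = cong toℕ (Col-functional c′ c)
      go (no n) = contradiction (j , c) n

    represented : IsoRep I λc toℕ T
    represented = ent , (λ t a → proj₂ (adom⁻ a))
      , (λ t u a b → ent-injective t u (proj₁ (adom⁻ a)) (proj₁ (adom⁻ b)))
      , onto
      , (λ t c _ → (λ { refl → refl }) , constant t c)
      , (λ R ts a → proj₂ , (λ r → (λ i → adom⁻ (a i)) , r))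
      , (λ t j _ → λc-Col t j)
      where
      onto : ∀ e → InEnt T [] e → ∃ λ t → Adom I t × ent t ≡ e
      onto (cnst c) p = const c , inj₂ (tt , p) , refl
      onto (node u) p = null (number u) , inj₂ (cong number (node-of-number u)
        , subst (λ v → InEnt T [] (node v)) (sym (node-of-number u)) p) , cong node (node-of-number u)
      constant : ∀ t c → ent t ≡ cnst c → t ≡ const c
      constant (const _) c refl = refl

    represented-width : ∀ {n} → k ≤ n → CwLe I n
    represented-width k≤n = λc , k , k≤n , toℕ , Finₚ.toℕ-injective , Cnst , T , wd , represented

  module Correctness (em : EM₁) (φ : Formula S) (sentence : Sentence φ) where

    d : ℕ
    d = constant-bound φ

    models⟺ : ∀ {I g} (t : Node → Index d) → Match d I (deco-at d ∘ t) g → Models I φ ⟺ ⟦ φ ⟧ (letter-at d ∘ t)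
    models⟺ t M = Transfer.transfer em M (record
      { fo-adom = λ () ; fo-here = λ () ; fo-only = λ () ; so-adom = λ () ; so-set = λ () }) φ sentence ≤-refl

    model⇒tree : ∀ {I λc lab Cnst T} → WellDecorated Cnst T → IsoRep {S} {k} I λc lab T → Models I φ → ∃ (Model d φ)
    model⇒tree {Cnst = Cnst} {T} wd iso m = t , (local , once) , proj₁ (models⟺ t (match iso d (deco-at d ∘ t) T°≡)) m
      where
      open Entities em Cnst T wd
      t : Node → Index d
      t s = index-of d (T s)
      T°≡ : ∀ s → deco-at d (t s) ≡ forget d (T s)
      T°≡ s = deco-at-index d (T s)
      void° : ∀ e → is-void (forget d e) ≡ is-void e
      void° (cst c j) with c <? d
      ... | yes _ = refl
      ... | no _ = refl
      void° (star j) = refl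
      void° (add R ks) = refl
      void° (recolor a b) = refl
      void° plus = refl
      void° void = refl
      shape° : ∀ e → shape (forget d e) ≡ shape e
      shape° (cst c j) with c <? d
      ... | yes _ = refl
      ... | no _ = refl
      shape° (star j) = refl
      shape° (add R ks) = refl
      shape° (recolor a b) = refl
      shape° plus = refl
      shape° void = refl
      child° : ∀ r b e → child-ok r b e ≡ true → child-ok r b (forget d e) ≡ true
      child° nothing b e h = trans (void° e) h
      child° (just false) false e h = trans (cong not (void° e)) h
      child° (just false) true e h = trans (void° e) h
      child° (just true) b e h = trans (cong not (void° e)) h
      ok : ∀ s b → child-ok (shape (T s)) b (T (s ∷ʳ b)) ≡ true → child-ok (shape (deco-at d (t s))) b (deco-at d (t (s ∷ʳ b))) ≡ true
      ok s b h = subst₂ (λ x y → child-ok (shape x) b y ≡ true) (sym (T°≡ s)) (sym (T°≡ (s ∷ʳ b)))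
        (subst (λ r → child-ok r b (forget d (T (s ∷ʳ b))) ≡ true) (sym (shape° (T s))) (child° (shape (T s)) b (T (s ∷ʳ b)) h))
      local : LocallyOK (deco-at d ∘ t)
      local s = let a , b = local⁻ (T s) (proj₁ wd s) in local⁺ (deco-at d (t s)) (ok s false a) (ok s true b)
      once : ConstantsOnce d (deco-at d ∘ t)
      once c s s′ h h′ =
        let j , p = is-cst-forget⁻ d (toℕ c) (T s) (trans (cong (is-cst (toℕ c)) (sym (T°≡ s))) h)
            j′ , p′ = is-cst-forget⁻ d (toℕ c) (T s′) (trans (cong (is-cst (toℕ c)) (sym (T°≡ s′))) h′)
        in proj₂ (proj₂ wd) s s′ (toℕ c) j j′ p p′

    tree⇒model : ∀ {n} → k ≤ n → ∃ (Model d φ) → HasModelW CwLe n φ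
    tree⇒model k≤n (t , (local , once) , h) = I , proj₂ (models⟺ t M) h , lift (represented-width k≤n)
      where
      T : Tree S k
      T = deco-at d ∘ t
      constant-below : ∀ e {c j} → forget d e ≡ cst c j → c < d
      constant-below (cst c′ j′) = kept (c′ <? d)
        where
        kept : (q : Dec (c′ < d)) → ∀ {c j} → keep q c′ j′ ≡ cst c j → c < d
        kept (yes c′<d) refl = c′<d
      below : ∀ s c j → T s ≡ cst c j → c < d
      below s c j = constant-below (List.lookup (decos d) (t s))
      wd : WellDecorated (List.upTo d) T
      wd = local , (λ s c j p → ∈-upTo⁺ (below s c j p)) , λ s s′ c j j′ p p′ →
        let c<d = below s c j p
            here-c = λ {e i} (q : e ≡ cst c i) → trans (cong (is-cst (toℕ (fromℕ< c<d))) q)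
              (trans (cong (λ x → is-cst x (cst {S} c i)) (Finₚ.toℕ-fromℕ< c<d)) (dec-true (c ≟ c) refl))
        in once (fromℕ< c<d) s s′ (here-c p) (here-c p′)
      open Represented em (List.upTo d) T wd
      -- The constants of this tree are below `d` already, so it is its own forgotten tree and
      -- `match` applies to the instance it represents.
      fixed : ∀ s → T s ≡ forget d (T s)
      fixed s = sym (forget-forget d (List.lookup (decos d) (t s)))
      M : Match d I T (Entities.g em (List.upTo d) T wd {I} {λc} {toℕ} represented d T fixed)
      M = Entities.match em (List.upTo d) T wd {I} {λc} {toℕ} represented d T fixed

    has-model⟺ : (has-model d φ ≡ true) ⟺ ∃ (Model d φ)
    has-model⟺ = has-model-correct em d φ

-- The decision procedure

open Semantics using (constant-bound)

HasModel : ∀ S → Formula S → ℕ → Set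
HasModel S φ k = Recognition.has-model S k (constant-bound S k φ) φ ≡ true

-- The automata are built for a fixed number of colours, so each number from 0 to `n` is tried.
search : ∀ S n φ → Dec (∃ λ (i : Fin (suc n)) → HasModel S φ (toℕ i))
search S n φ = any-finite (Fin-finite (suc n)) λ _ → _ ≟ᵇ true

abstract
  has-model-within : ∀ S → ℕ → Formula S → Bool
  has-model-within S n φ = does (search S n φ)

  has-model-within⁻ : ∀ S n φ → has-model-within S n φ ≡ true → ∃ λ k → k ≤ n × HasModel S φ k
  has-model-within⁻ S n φ h = let i , e = does⁻ (search S n φ) h in toℕ i , Finₚ.toℕ≤pred[n] i , e

  has-model-within⁺ : ∀ S n φ k → k ≤ n → HasModel S φ k → has-model-within S n φ ≡ true
  has-model-within⁺ S n φ k k≤n e = dec-true (search S n φ)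
    (fromℕ< (s≤s k≤n) , subst (HasModel S φ) (sym (Finₚ.toℕ-fromℕ< (s≤s k≤n))) e)

module _ (S : Signature) (n : ℕ) (em : EM₁) (φ : Formula S) (sentence : Sentence φ) where

  has-model-within-sound : has-model-within S n φ ≡ true → HasModelW CwLe n φ
  has-model-within-sound h = let k , k≤n , e = has-model-within⁻ S n φ h
                                 open Semantics.Correctness S k em φ sentence
                             in tree⇒model k≤n (proj₁ has-model⟺ e)

  has-model-within-complete : HasModelW CwLe n φ → has-model-within S n φ ≡ true
  has-model-within-complete (I , m , lift (λc , k , k≤n , lab , _ , Cnst , T , wd , iso)) =
    has-model-within⁺ S n φ k k≤n (proj₂ has-model⟺ (model⇒tree wd iso m))
    where open Semantics.Correctness S k em φ sentence

theorem11 : (S : Signature) →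
    ((n : ℕ) → DecidesBoundedSat S CwLe n) × MSOFriendly S CwLe
theorem11 S =
  (λ n → has-model-within S n , λ em φ sentence →
    has-model-within-sound S n em φ sentence , has-model-within-complete S n em φ sentence)
  -- The decision procedure counts as terminated, from step 0 on, exactly if a model of width at
  -- most `n` exists; on an unsatisfiable sentence this never happens.
  , (λ n φ _ → has-model-within S n φ)
  , λ em n φ sentence →
      (λ unsat _ → ¬-not λ h → let I , m , _ = has-model-within-sound S n em φ sentence h in unsat (I , m))
      , λ h → 0 , has-model-within-complete S n em φ sentence h
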